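{- Let $n\ge 3$ be an integer. The number of shifted standard Young tableaux of truncated shape $\delta_n\setminus\delta_1$ is equal to $$g_n\,\frac{C_n\,C_{n-2}}{2\,C_{2n-3}},$$ where $g_n=\dfrac{\binom{n+1}{2}!}{\prod_{0\le i<j\le n}(i+j)}$ is the number of shifted standard Young tableaux of the (untruncated) shifted staircase shape $(n,n-1,\ldots,1)$ and $C_m=\frac{1}{m+1}\binom{2m}{m}$ is the $m$-th Catalan number.
   Context: Here $\delta_k=(k,k-1,\ldots,1)$. For integer partitions $\lambda,\mu$ with $\lambda_i\ge\mu_i$ for all $i$ (with $\mu_i=0$ beyond the length of $\mu$) and $\lambda$ having distinct parts, the shifted diagram of truncated shape $\lambda\setminus\mu$ is the array of boxes in which row $i$ (counted from the top) has $\lambda_i-\mu_i$ boxes and starts one box to the right of where row $i-1$ starts; i.e. row $i$ consists of the boxes in positions (row $i$, column $c$) with $i\le c\le i+\lambda_i-\mu_i-1$. Thus $\delta_n\setminus\delta_1$ is the shifted staircase with rows of lengths $n-1,n-1,n-2,\ldots,1$ (the shifted staircase $(n,n-1,\ldots,1)$ with the box in its upper right corner removed). A shifted standard Young tableau of such a shape with $N$ boxes is a filling of the boxes with the integers $1,\ldots,N$, each used exactly once, such that the entries increase along rows (left to right) and down columns. -}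

module Defs where

open import Data.Fin as Fin using (Fin; toℕ)
open import Data.Integer using (+_)
open import Data.List using (List; []; _∷_; length; tabulate; applyUpTo; applyDownFrom)
open import Data.List.Relation.Unary.All.Properties using (applyUpTo⁺₁)
open import Data.Nat hiding (_⊔_)
open import Data.Nat.Combinatorics using (_C_; nCk≡n!/k![n-k]!; [n∸k]!k!∣n!)
open import Data.Nat.Divisibility using (∣⇒≤; _∣_)
open import Data.Nat.DivMod using (m≥n⇒m/n>0)
open import Data.Nat.ListAction using (sum; product)
open import Data.Nat.ListAction.Properties using (product≢0)
open import Data.Nat.Properties
open import Data.Product using (Σ-syntax; _,_)
open import Data.Rational as ℚ using (ℚ)
import Data.Rational.Properties as ℚ
open import Function.Bundles using (Inverse)
open import Function.Definitions using (Bijective)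
open import Level using (0ℓ; _⊔_)
open import Relation.Binary.Bundles using (Setoid)
import Relation.Binary.Construct.On as On
open import Relation.Binary.PropositionalEquality
  using (_≡_; sym; subst; _→-setoid_; setoid)

------------------------------------------------------------------------
-- Shifted diagrams of truncated shape

δ : ℕ → List ℕ
δ k = applyDownFrom suc k

-- Parts are indexed from 0, so that `part Λ i` is Λ_{i+1}.
part : List ℕ → ℕ → ℕ
part []       _       = 0
part (x ∷ _)  zero    = x
part (_ ∷ xs) (suc i) = part xs i

-- The definitions below are meant for partitions Λ, μ with Λ having
-- distinct parts and μ_i ≤ Λ_i for all i, so that ∸ is true subtraction.
module _ (Λ μ : List ℕ) where

  rowLength : Fin (length Λ) → ℕ
  rowLength i = part Λ (toℕ i) ∸ part μ (toℕ i)

  -- A box is a row together with an offset from the start of that row.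
  -- Rows and columns are counted from 0; row i starts in column i.
  Box : Set
  Box = Σ[ i ∈ Fin (length Λ) ] Fin (rowLength i)

  row col : Box → ℕ
  row (i , _) = toℕ i
  col (i , j) = toℕ i + toℕ j

  size : ℕ
  size = sum (tabulate rowLength)

  -- The element v of `Fin size` stands for the integer toℕ v + 1, so the
  -- entries range over 1, …, size.
  record ShiftedSYT : Set where
    field
      entry           : Box → Fin size
      entry-bijective : Bijective _≡_ _≡_ entry
      row-increasing  : ∀ a b → row a ≡ row b → col a < col b → entry a Fin.< entry b
      col-increasing  : ∀ a b → col a ≡ col b → row a < row b → entry a Fin.< entry b

  -- Two tableaux are equal when they have the same entries.
  ShiftedSYT-setoid : Setoid 0ℓ 0ℓ
  ShiftedSYT-setoid = On.setoid (Box →-setoid Fin size) ShiftedSYT.entry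

HasCardinality : ∀ {a ℓ} → Setoid a ℓ → ℕ → Set (a ⊔ ℓ)
HasCardinality S k = Inverse (setoid (Fin k)) S

------------------------------------------------------------------------
-- The numbers g_n

-- ∏_{0 ≤ i < j ≤ n} (i + j)
∏[i+j] : ℕ → ℕ
∏[i+j] n = product (applyUpTo (λ j → product (applyUpTo (λ i → i + j) j)) (suc n))

∏[i+j]-nonZero : ∀ n → NonZero (∏[i+j] n)
∏[i+j]-nonZero n =
  product≢0 (applyUpTo⁺₁ _ (suc n) λ {j} _ →
  product≢0 (applyUpTo⁺₁ _ j λ {i} i<j →
  >-nonZero (≤-trans (≤-trans (s≤s z≤n) i<j) (m≤n+m j i))))

g : ℕ → ℚ
g n = ((+ ((suc n C 2) !)) ℚ./ ∏[i+j] n) {{∏[i+j]-nonZero n}}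

------------------------------------------------------------------------
-- Catalan numbers

catalan : ℕ → ℚ
catalan m = (+ 1 ℚ./ suc m) ℚ.* (+ ((2 * m) C m) ℚ./ 1)

C-nonZero : ∀ {n k} → k ≤ n → NonZero (n C k)
C-nonZero {n} {k} k≤n = subst NonZero (sym (nCk≡n!/k![n-k]! k≤n))
  (>-nonZero (m≥n⇒m/n>0 (∣⇒≤ k!*[n∸k]!∣n!)))
  where
  instance
    _ = n !≢0
    _ = k !* (n ∸ k) !≢0
  k!*[n∸k]!∣n! : k ! * (n ∸ k) ! ∣ n !
  k!*[n∸k]!∣n! = subst (_∣ n !) (*-comm ((n ∸ k) !) (k !)) ([n∸k]!k!∣n! k≤n)

catalan-positive : ∀ m → ℚ.Positive (catalan m)
catalan-positive m =
  ℚ.pos*pos⇒pos (+ 1 ℚ./ suc m) {{ℚ.normalize-pos 1 (suc m)}} (+ c ℚ./ 1)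
    {{ℚ.normalize-pos c 1 {{_}} {{C-nonZero (m≤m+n m _)}}}}
  where c = (2 * m) C m

2catalan-nonZero : ∀ m → ℚ.NonZero ((+ 2 ℚ./ 1) ℚ.* catalan m)
2catalan-nonZero m = ℚ.pos⇒nonZero ((+ 2 ℚ./ 1) ℚ.* catalan m)
  {{ℚ.pos*pos⇒pos (+ 2 ℚ./ 1) (catalan m) {{catalan-positive m}}}}

-- Let the pivot be the box in row 2 and column n − 1. In a tableau of shape δₙ ∖ δ₁ the entries
-- smaller than that of the pivot fill a shifted diagram (n − 1, n − 3, ν) with ν ⊆ {1, …, n − 4}, and
-- by the symmetry of the shape the larger entries fill, after reflection, (n − 1, n − 3, νᶜ),
-- where νᶜ is the complement of ν. So the number of tableaux is ∑ f(n−1, n−3, ν) f(n−1, n−3, νᶜ)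
-- with f given by Schur's product formula. In this product the factors coupling n − 1 and n − 3
-- with ν and νᶜ combine to a constant, so that each summand is f(ν) f(νᶜ) times a function of |ν|.
-- For fixed |ν| the sum of f(ν) f(νᶜ) is the number of tableaux of shape δₙ₋₄, and the remaining
-- sum over |ν| is a Vandermonde convolution. Schur's formula itself satisfies the recursion for f
-- by Lagrange interpolation.
module Submission where

-- The truncated shape has no product formula of its own. What helps is that a down-closed set of
-- boxes avoiding the pivot is an ordinary shifted diagram, and that the reflection fixes the pivot,
-- so the boxes coming after it behave alike. Just before the pivot enters, its left and upper
-- neighbours are present: rows 1 and 2 have n - 1 and n - 3 boxes, and row 3 has at most n - 4. The
-- coupling factors combine to a constant because each i ≤ n - 4 is a part of exactly one of ν and
-- νᶜ.
--
-- Pairs of tableaux never appear. A down-closed set is recorded by its number of boxes on the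
-- shortest diagonal and by the steps, 0 or 1, from each diagonal to the next. The step vector
-- doubles as a strict partition: moving a box exchanges neighbouring bits, and complement with
-- reflection flips all bits. Counts become functions on bit vectors with a recursion by the box of
-- the largest entry. Removal and addition of boxes are adjoint under the sum over all vectors, so
-- the cut at the pivot is a summation by parts.

open import Defs
open import Data.Bool using (Bool; true; false; not)
open import Data.List as List using (List; []; _∷_; _++_; _∷ʳ_; applyUpTo; concat; length)
open import Data.List.Properties using (applyUpTo-∷ʳ; length-++; length-applyDownFrom; length-map)
open import Data.Nat using (ℕ; _≤_; _∸_) renaming (_*_ to _*ℕ_)
open import Data.Nat as ℕ using (zero; suc; _!; s≤s; z≤n)
open import Data.Nat.ListAction using (product; sum)
import Data.Nat.Properties as ℕ
open import Data.Nat.Tactic.RingSolver using () renaming (solve-∀ to solveℕ-∀)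
open import Data.Product using (∃; ∃₂; ∃-syntax; _×_; _,_; proj₁; proj₂)
open import Data.Rational using (_*_; _/_; _÷_)
open import Data.Vec using (Vec; []; _∷_; map; replicate)
open import Function using (_∘_)
open import Relation.Binary.PropositionalEquality
open import Relation.Nullary using (¬_; yes; no; contradiction; dec⇒maybe)

-- A vector in Vec Bool k is read as a strict partition with parts in {1, …, k}; the entry
-- followed by b others tells whether b + 1 is a part.
weight : ∀ {k} → Vec Bool k → ℕ
weight []                  = 0
weight (false ∷ v)         = weight v
weight {suc k} (true ∷ v)  = suc k ℕ.+ weight v

-- Order ideals of the truncated staircase and their linear extensions

module LinearExtensions where

  open import Data.List.Membership.Propositional using (find; lose)
  open import Data.List.Relation.Unary.All as All using (All; []; _∷_)
  import Data.List.Relation.Unary.All.Properties as All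
  open import Data.List.Relation.Unary.AllPairs as AllPairs using (AllPairs; []; _∷_)
  import Data.List.Relation.Unary.AllPairs.Properties as AllPairs
  open import Data.List.Relation.Unary.Any as Any using (Any; here; there)
  import Data.List.Relation.Unary.Any.Properties as Any
  open import Data.Nat hiding (_*_; _/_)
  open import Data.Nat.Properties
  open import Data.Sum using (_⊎_; inj₁; inj₂)
  open import Data.Unit using (⊤; tt)
  open import Relation.Nullary.Decidable using (_×-dec_)

  bit : Bool → ℕ
  bit false = 0
  bit true  = 1

  -- Diagonals of δₙ ∖ δ₁ are numbered from the truncated corner, so that diagonal r has r + 2
  -- boxes. They are chains, and an order ideal is determined by its numbers of boxes on them:
  -- a on diagonal 0, and from each diagonal to the next one more if the bit in v is set.
  diag : ∀ {k} → ℕ → Vec Bool k → ℕ → ℕ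
  diag a v       zero    = a
  diag a []      (suc r) = 0
  diag a (d ∷ v) (suc r) = diag (bit d + a) v r

  -- Each box on diagonal 0 accounts for one box on every one of the `suc k` diagonals; a set bit
  -- adds a box to its own diagonal and to all later ones, as many as the part it stands for.
  idealSize : ∀ {k} → ℕ → Vec Bool k → ℕ
  idealSize {k} a v = a *ℕ suc k + weight v

  -- When the preceding diagonal loses a box, the step to the next one grows by 1, so it must have
  -- been 0. After the last diagonal there is no step and no condition.
  incs : ∀ {k} → Vec Bool k → List (Vec Bool k)
  incs []          = [] ∷ []
  incs (false ∷ v) = (true ∷ v) ∷ []
  incs (true ∷ v)  = []

  -- Losing a box on an inner diagonal turns the steps 1, 0 around it into 0, 1: a part b + 1
  -- becomes b. On the last diagonal the final 1 is cleared. The index is the number of the diagonal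
  -- minus 1.
  rems : ∀ {k} → Vec Bool k → List (ℕ × Vec Bool k)
  rems []          = []
  rems (false ∷ v) = List.map (λ (r , w) → suc r , false ∷ w) (rems v)
  rems (true ∷ v)  = List.map (λ w → 0 , false ∷ w) (incs v) ++ List.map (λ (r , w) → suc r , true ∷ w) (rems v)

  Move : ℕ → Set
  Move k = ℕ × ℕ × Vec Bool k

  tops : ∀ {k} → ℕ → Vec Bool k → List (Move k)
  tops zero    v = []
  tops (suc a) v = List.map (λ w → 0 , a , w) (incs v)

  moves : ∀ {k} → ℕ → Vec Bool k → List (Move k)
  moves a v = tops a v ++ List.map (λ (r , w) → suc r , a , w) (rems v)

  -- The box lost is in row `c′ r` of diagonal r; `above` and `below` exclude its right and its
  -- lower neighbour from the ideal.
  record IsRemoval (r : ℕ) (c c′ : ℕ → ℕ) : Set where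
    field
      top   : c r ≡ suc (c′ r)
      other : ∀ {q} → q ≢ r → c q ≡ c′ q
      above : ∀ {q} → r ≡ suc q → c q ≤ c′ r
      below : c (suc r) ≤ c r

  incs-sound : ∀ {k} (v : Vec Bool k) → All (λ w → (∀ a q → diag (suc a) v (suc q) ≡ diag a w (suc q)) × (∀ a → diag (suc a) v 1 ≤ suc a)) (incs v)
  incs-sound []          = ((λ a q → refl) , λ a → z≤n) ∷ []
  incs-sound (false ∷ v) = ((λ a q → refl) , λ a → ≤-refl) ∷ []
  incs-sound (true ∷ v)  = []

  bump-sound : ∀ {k} d (v w : Vec Bool k) r → (∀ a → IsRemoval (suc r) (diag a v) (diag a w)) → ∀ a → IsRemoval (suc (suc r)) (diag a (d ∷ v)) (diag a (d ∷ w))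
  bump-sound d v w r rem a = record
    { top   = top
    ; other = λ { {zero} q≢ → refl ; {suc q} q≢ → other (q≢ ∘ cong suc) }
    ; above = λ { refl → above refl }
    ; below = below
    }
    where open IsRemoval (rem (bit d + a))

  rems-sound : ∀ {k} (v : Vec Bool k) → All (λ (r , w) → ∀ a → IsRemoval (suc r) (diag a v) (diag a w)) (rems v)
  rems-sound []          = []
  rems-sound (false ∷ v) = All.map⁺ (All.map (λ {(r , w)} → bump-sound false v w r) (rems-sound v))
  rems-sound (true ∷ v)  = All.++⁺
    (All.map⁺ (All.map (λ (other , below) a → record
      { top   = refl
      ; other = λ { {zero} q≢ → refl ; {suc zero} q≢ → contradiction refl q≢ ; {suc (suc q)} q≢ → other a q }
      ; above = λ { refl → ≤-refl }
      ; below = below a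
      }) (incs-sound v)))
    (All.map⁺ (All.map (λ {(r , w)} → bump-sound true v w r) (rems-sound v)))

  moves-sound : ∀ {k} a (v : Vec Bool k) → All (λ (r , a′ , w) → IsRemoval r (diag a v) (diag a′ w)) (moves a v)
  moves-sound a v = All.++⁺ (tops-sound a) (All.map⁺ (All.map (λ rem → rem a) (rems-sound v)))
    where
    tops-sound : ∀ a → All (λ (r , a′ , w) → IsRemoval r (diag a v) (diag a′ w)) (tops a v)
    tops-sound zero    = []
    tops-sound (suc a) = All.map⁺ (All.map (λ (other , below) → record
      { top   = refl
      ; other = λ { {zero} q≢ → contradiction refl q≢ ; {suc q} q≢ → other a q }
      ; above = λ ()
      ; below = below a
      }) (incs-sound v))

  incs-complete : ∀ {k} a (v : Vec Bool k) → diag (suc a) v 1 ≤ suc a → Any (λ _ → ⊤) (incs v)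
  incs-complete a []          below = here tt
  incs-complete a (false ∷ v) below = here tt
  incs-complete a (true ∷ v)  below = contradiction below (<⇒≱ ≤-refl)

  rems-complete : ∀ {k} a (v : Vec Bool k) r i → diag a v (suc r) ≡ suc i → diag a v r ≤ i → diag a v (suc (suc r)) ≤ suc i →
    Any (λ m → proj₁ m ≡ r) (rems v)
  rems-complete a (false ∷ v) zero    i top above below = contradiction (subst (_≤ i) top above) (<⇒≱ ≤-refl)
  rems-complete a (true ∷ v)  zero    .a refl above below = Any.++⁺ˡ (Any.map⁺ (Any.map (λ _ → refl) (incs-complete a v below)))
  rems-complete a (false ∷ v) (suc r) i top above below = Any.map⁺ (Any.map (cong suc) (rems-complete a v r i top above below))
  rems-complete a (true ∷ v)  (suc r) i top above below =
    Any.++⁺ʳ (List.map (λ w → 0 , false ∷ w) (incs v)) (Any.map⁺ (Any.map (cong suc) (rems-complete (suc a) v r i top above below)))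

  moves-complete : ∀ {k} a (v : Vec Bool k) r i → diag a v r ≡ suc i → (∀ {q} → r ≡ suc q → diag a v q ≤ i) → diag a v (suc r) ≤ suc i →
    Any (λ m → proj₁ m ≡ r) (moves a v)
  moves-complete .(suc i) v zero    i refl above below = Any.++⁺ˡ (Any.map⁺ (Any.map (λ _ → refl) (incs-complete i v below)))
  moves-complete a        v (suc r) i top  above below = Any.++⁺ʳ (tops a v) (Any.map⁺ (Any.map (cong suc) (rems-complete a v r i top (above refl) below)))

  incs-unique : ∀ {k} {R : Vec Bool k → Vec Bool k → Set} v → AllPairs R (incs v)
  incs-unique []          = [] ∷ []
  incs-unique (false ∷ v) = [] ∷ []
  incs-unique (true ∷ v)  = []

  rems-unique : ∀ {k} (v : Vec Bool k) → AllPairs (λ m m′ → proj₁ m ≢ proj₁ m′) (rems v)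
  rems-unique []          = []
  rems-unique (false ∷ v) = AllPairs.map⁺ (AllPairs.map (λ r≢ → r≢ ∘ suc-injective) (rems-unique v))
  rems-unique (true ∷ v)  = AllPairs.++⁺
    (AllPairs.map⁺ (incs-unique v))
    (AllPairs.map⁺ (AllPairs.map (λ r≢ → r≢ ∘ suc-injective) (rems-unique v)))
    (All.map⁺ (All.universal (λ _ → All.map⁺ (All.universal (λ _ ()) (rems v))) (incs v)))

  moves-unique : ∀ {k} a (v : Vec Bool k) → AllPairs (λ m m′ → proj₁ m ≢ proj₁ m′) (moves a v)
  moves-unique a v = AllPairs.++⁺ (tops-unique a)
    (AllPairs.map⁺ (AllPairs.map (λ r≢ → r≢ ∘ suc-injective) (rems-unique v))) (tops≢ a)
    where
    tops-unique : ∀ a → AllPairs (λ m m′ → proj₁ m ≢ proj₁ m′) (tops a v)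
    tops-unique zero    = []
    tops-unique (suc a) = AllPairs.map⁺ (incs-unique v)
    tops≢ : ∀ a′ → All (λ m → All (λ m′ → proj₁ m ≢ proj₁ m′) (List.map (λ (r , w) → suc r , a , w) (rems v))) (tops a′ v)
    tops≢ zero     = []
    tops≢ (suc a′) = All.map⁺ (All.universal (λ _ → All.map⁺ (All.universal (λ _ ()) (rems v))) (incs v))

  incs-weight : ∀ {k} (v : Vec Bool k) → All (λ w → weight w ≡ k + weight v) (incs v)
  incs-weight []          = refl ∷ []
  incs-weight (false ∷ v) = refl ∷ []
  incs-weight (true ∷ v)  = []

  rems-weight : ∀ {k} (v : Vec Bool k) → All (λ (r , w) → weight v ≡ suc (weight w)) (rems v)
  rems-weight []          = []
  rems-weight (false ∷ v) = All.map⁺ (rems-weight v)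
  rems-weight {suc k} (true ∷ v)  = All.++⁺
    (All.map⁺ (All.map (λ eq → cong suc (sym eq)) (incs-weight v)))
    (All.map⁺ (All.map (λ {(r , w)} eq → trans (cong (suc k +_) eq) (+-suc (suc k) (weight w))) (rems-weight v)))

  moves-size : ∀ {k} a (v : Vec Bool k) → All (λ (r , a′ , w) → idealSize a v ≡ suc (idealSize a′ w)) (moves a v)
  moves-size {k} a v = All.++⁺ (tops-size a)
    (All.map⁺ (All.map (λ {(r , w)} eq → trans (cong (a *ℕ suc k +_) eq) (+-suc (a *ℕ suc k) (weight w))) (rems-weight v)))
    where
    l : ∀ k b c → suc k + b + c ≡ suc (b + (k + c))
    l = solveℕ-∀
    tops-size : ∀ a → All (λ (r , a′ , w) → idealSize a v ≡ suc (idealSize a′ w)) (tops a v)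
    tops-size zero    = []
    tops-size (suc a) = All.map⁺ (All.map (λ eq → trans (l k (a *ℕ suc k) (weight v)) (cong (λ n → suc (a *ℕ suc k + n)) (sym eq))) (incs-weight v))

  Filling : Set
  Filling = ℕ → ℕ → ℕ

  -- e i r is the entry of the box in row i on diagonal r. The right neighbour of (i , r + 1)
  -- is (i , r), and the lower neighbour of (i , r) is (i + 1 , r + 1).
  record IsLinear (t : ℕ) (c : ℕ → ℕ) (e : Filling) : Set where
    field
      bounded : ∀ {i r} → i < c r → e i r < t
      inj     : ∀ {i r i′ r′} → i < c r → i′ < c r′ → e i r ≡ e i′ r′ → i ≡ i′ × r ≡ r′
      sur     : ∀ {u} → u < t → ∃₂ λ i r → i < c r × e i r ≡ u
      step    : ∀ {i r} → i < c r → i < c (suc r) → e i (suc r) < e i r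
      fall    : ∀ {i r} → i < c r → suc i < c (suc r) → e i r < e (suc i) (suc r)

  _≈⟨_⟩_ : Filling → (ℕ → ℕ) → Filling → Set
  e ≈⟨ c ⟩ e′ = ∀ {i r} → i < c r → e i r ≡ e′ i r

  place : ℕ → ℕ → ℕ → Filling → Filling
  place i r t e i′ r′ with (i′ ≟ i) ×-dec (r′ ≟ r)
  ... | yes _ = t
  ... | no  _ = e i′ r′

  place-same : ∀ i r t e → place i r t e i r ≡ t
  place-same i r t e with (i ≟ i) ×-dec (r ≟ r)
  ... | yes _  = refl
  ... | no neq = contradiction (refl , refl) neq

  place-other : ∀ {i r i′ r′} t e → ¬ (i′ ≡ i × r′ ≡ r) → place i r t e i′ r′ ≡ e i′ r′
  place-other {i} {r} {i′} {r′} t e neq with (i′ ≟ i) ×-dec (r′ ≟ r)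
  ... | yes eq = contradiction eq neq
  ... | no  _  = refl

  module _ {r c c′} (rem : IsRemoval r c c′) where
    open IsRemoval rem

    new : c′ r < c r
    new = ≤-reflexive (sym top)

    old : ∀ {i q} → i < c′ q → i < c q
    old {i} {q} i< with q ≟ r
    ... | yes refl = <-trans i< new
    ... | no q≢r   = subst (i <_) (sym (other q≢r)) i<

    old≢new : ∀ {i q} → i < c′ q → ¬ (i ≡ c′ r × q ≡ r)
    old≢new i< (refl , refl) = <-irrefl refl i<

    split : ∀ {i q} → i < c q → (i ≡ c′ r × q ≡ r) ⊎ i < c′ q
    split {i} {q} i< with q ≟ r
    ... | no q≢r   = inj₂ (subst (i <_) (other q≢r) i<)
    ... | yes refl with i ≟ c′ r
    ...   | yes eq = inj₁ (eq , refl)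
    ...   | no neq = inj₂ (≤∧≢⇒< (≤-pred (subst (i <_) top i<)) neq)

    place-linear : ∀ {t e} → IsLinear t c′ e → IsLinear (suc t) c (place (c′ r) r t e)
    place-linear {t} {e} lin = record { bounded = bounded′ ; inj = inj′ ; sur = sur′ ; step = step′ ; fall = fall′ }
      where
      open IsLinear lin
      e⁺ : Filling
      e⁺ = place (c′ r) r t e
      e⁺-old : ∀ {i q} → i < c′ q → e⁺ i q ≡ e i q
      e⁺-old i< = place-other t e (old≢new i<)
      e⁺-old< : ∀ {i q} → i < c′ q → e⁺ i q < t
      e⁺-old< i< = subst (_< t) (sym (e⁺-old i<)) (bounded i<)
      e⁺-new : ∀ {i q} → i ≡ c′ r × q ≡ r → e⁺ i q ≡ t
      e⁺-new (refl , refl) = place-same (c′ r) r t e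
      bounded′ : ∀ {i q} → i < c q → e⁺ i q < suc t
      bounded′ i< with split i<
      ... | inj₁ eq  = ≤-reflexive (cong suc (e⁺-new eq))
      ... | inj₂ i<′ = m<n⇒m<1+n (e⁺-old< i<′)
      inj′ : ∀ {i q i′ q′} → i < c q → i′ < c q′ → e⁺ i q ≡ e⁺ i′ q′ → i ≡ i′ × q ≡ q′
      inj′ i< i′< eq with split i< | split i′<
      ... | inj₁ (refl , refl) | inj₁ (refl , refl) = refl , refl
      ... | inj₁ new | inj₂ o = contradiction (trans (sym eq) (e⁺-new new)) (<⇒≢ (e⁺-old< o))
      ... | inj₂ o | inj₁ new = contradiction (trans eq (e⁺-new new)) (<⇒≢ (e⁺-old< o))
      ... | inj₂ o | inj₂ o′ = inj o o′ (trans (sym (e⁺-old o)) (trans eq (e⁺-old o′)))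
      sur′ : ∀ {u} → u < suc t → ∃₂ λ i q → i < c q × e⁺ i q ≡ u
      sur′ {u} u< with u ≟ t
      ... | yes refl = c′ r , r , new , place-same (c′ r) r t e
      ... | no u≢t   with i , q , i< , eq ← sur (≤∧≢⇒< (≤-pred u<) u≢t) = i , q , old i< , trans (e⁺-old i<) eq
      step′ : ∀ {i q} → i < c q → i < c (suc q) → e⁺ i (suc q) < e⁺ i q
      step′ {i} {q} i< i<′ with split i< | split i<′
      ... | inj₁ (refl , refl) | inj₁ (_ , ())
      ... | inj₁ new | inj₂ o = subst (e⁺ i (suc q) <_) (sym (e⁺-new new)) (e⁺-old< o)
      ... | inj₂ o | inj₁ (refl , refl) = contradiction (above refl) (<⇒≱ i<)
      ... | inj₂ o | inj₂ o′ = subst₂ _<_ (sym (e⁺-old o′)) (sym (e⁺-old o)) (step o o′)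
      fall′ : ∀ {i q} → i < c q → suc i < c (suc q) → e⁺ i q < e⁺ (suc i) (suc q)
      fall′ {i} {q} i< i<′ with split i< | split i<′
      ... | inj₁ (refl , refl) | inj₁ (_ , ())
      ... | inj₁ (refl , refl) | inj₂ o = contradiction (subst (c (suc r) ≤_) top below) (<⇒≱ i<′)
      ... | inj₂ o | inj₁ new = subst (e⁺ i q <_) (sym (e⁺-new new)) (e⁺-old< o)
      ... | inj₂ o | inj₂ o′ = subst₂ _<_ (sym (e⁺-old o)) (sym (e⁺-old o′)) (fall o o′)

    restrict-linear : ∀ {t e} → IsLinear (suc t) c e → e (c′ r) r ≡ t → IsLinear t c′ e
    restrict-linear {t} {e} lin e≡t = record
      { bounded = λ i< → ≤∧≢⇒< (≤-pred (bounded (old i<))) (λ eq → old≢new i< (inj (old i<) new (trans eq (sym e≡t))))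
      ; inj     = λ i< i′< → inj (old i<) (old i′<)
      ; sur     = sur′
      ; step    = λ i< i<′ → step (old i<) (old i<′)
      ; fall    = λ i< i<′ → fall (old i<) (old i<′)
      }
      where
      open IsLinear lin
      sur′ : ∀ {u} → u < t → ∃₂ λ i q → i < c′ q × e i q ≡ u
      sur′ {u} u<t with sur (m<n⇒m<1+n u<t)
      ... | i , q , i< , eq with split i<
      ...   | inj₁ (refl , refl) = contradiction (trans (sym eq) e≡t) (<⇒≢ u<t)
      ...   | inj₂ o             = i , q , o , eq

    place-restrict : ∀ {t e e′} → e (c′ r) r ≡ t → e ≈⟨ c′ ⟩ e′ → e ≈⟨ c ⟩ place (c′ r) r t e′
    place-restrict {t} {e} {e′} e≡t e≈e′ i< with split i<
    ... | inj₁ (refl , refl) = trans e≡t (sym (place-same (c′ r) r t e′))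
    ... | inj₂ o             = trans (e≈e′ o) (sym (place-other t e′ (old≢new o)))

    place-injective : ∀ {t e e′} → place (c′ r) r t e ≈⟨ c ⟩ place (c′ r) r t e′ → e ≈⟨ c′ ⟩ e′
    place-injective {t} {e} {e′} eq i< = trans (sym (place-other t e (old≢new i<))) (trans (eq (old i<)) (place-other t e′ (old≢new i<)))

  -- The box that holds t in the first filling is an old box for the second removal, which happens
  -- on another diagonal, so there its entry is below t.
  place-disjoint : ∀ {r r₂ c c′ c″ t e e₂} → IsRemoval r c c′ → IsRemoval r₂ c c″ → r ≢ r₂ → IsLinear t c″ e₂ →
    ¬ place (c′ r) r t e ≈⟨ c ⟩ place (c″ r₂) r₂ t e₂
  place-disjoint {r} {r₂} {c} {c′} {c″} {t} {e} {e₂} rem rem₂ r≢r₂ lin eq =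
    <⇒≢ (bounded (subst (c′ r <_) (IsRemoval.other rem₂ r≢r₂) (new rem)))
      (trans (sym (place-other t e₂ (r≢r₂ ∘ proj₂))) (trans (sym (eq (new rem))) (place-same (c′ r) r t e)))
    where open IsLinear lin

  -- The largest entry, t, sits at a removable box, and the rest is an extension of the smaller
  -- ideal. Values outside the ideal carry no meaning, so the empty ideal gets one constant filling,
  -- and fillings are compared by `≈⟨ c ⟩` only.
  extensions : ∀ {k} → ℕ → ℕ → Vec Bool k → List Filling
  extend : ∀ {k} → ℕ → Move k → List Filling

  extensions zero    a v = (λ _ _ → 0) ∷ []
  extensions (suc t) a v = concat (List.map (extend t) (moves a v))

  extend t (r , a , v) = List.map (place (diag a v r) r t) (extensions t a v)

  empty-diag : ∀ {k} (v : Vec Bool k) r → weight v ≡ 0 → diag 0 v r ≡ 0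
  empty-diag v           zero    eq = refl
  empty-diag []          (suc r) eq = refl
  empty-diag (false ∷ v) (suc r) eq = empty-diag v r eq

  extensions-sound : ∀ {k} t a (v : Vec Bool k) → idealSize a v ≡ t → All (IsLinear t (diag a v)) (extensions t a v)
  extensions-sound zero zero v eq = record
    { bounded = λ {_} {r} → absurd r ; inj = λ {_} {r} → absurd r ; sur = λ () ; step = λ {_} {r} → absurd r ; fall = λ {_} {r} → absurd r } ∷ []
    where
    absurd : ∀ r {i} {A : Set} → i < diag 0 v r → A
    absurd r {i} i< with () ← subst (i <_) (empty-diag v r eq) i<
  extensions-sound (suc t) a v eq = All.concat⁺ (All.map⁺ (All.map
    (λ {(r , a′ , w)} (rem , size≡) → All.map⁺ (All.map (place-linear rem) (extensions-sound t a′ w (suc-injective (trans (sym size≡) eq)))))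
    (All.zip (moves-sound a v , moves-size a v))))

  diag-suc : ∀ {k} a (v : Vec Bool k) r → diag a v (suc r) ≤ suc (diag a v r)
  diag-suc a []          zero    = z≤n
  diag-suc a []          (suc r) = z≤n
  diag-suc a (false ∷ v) zero    = n≤1+n a
  diag-suc a (true ∷ v)  zero    = ≤-refl
  diag-suc a (d ∷ v)     (suc r) = diag-suc (bit d + a) v r

  diag-first : ∀ {k} a (v : Vec Bool (suc k)) → a ≤ diag a v 1
  diag-first a (d ∷ v) = m≤n+m a (bit d)

  -- A right or lower neighbour would have an entry above t. A further box on the same diagonal
  -- would bring such a neighbour into the ideal; on diagonal 0 this is the lower one, on diagonal
  -- 1, whence the positive length of v.
  last-removable : ∀ {k} t a (v : Vec Bool (suc k)) {e} → IsLinear (suc t) (diag a v) e → ∀ {i r} → i < diag a v r → e i r ≡ t →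
    diag a v r ≡ suc i × (∀ {q} → r ≡ suc q → diag a v q ≤ i) × diag a v (suc r) ≤ suc i
  last-removable t a v {e} lin {i} {r} i< e≡t = top r i< above below , above , below
    where
    open IsLinear lin
    above : ∀ {q} → r ≡ suc q → diag a v q ≤ i
    above {q} refl = ≮⇒≥ λ i<q → <⇒≱ (subst (_< e i q) e≡t (step i<q i<)) (≤-pred (bounded i<q))
    below : diag a v (suc r) ≤ suc i
    below = ≮⇒≥ λ i<′ → <⇒≱ (subst (_< e (suc i) (suc r)) e≡t (fall i< i<′)) (≤-pred (bounded i<′))
    top : ∀ r → i < diag a v r → (∀ {q} → r ≡ suc q → diag a v q ≤ i) → diag a v (suc r) ≤ suc i → diag a v r ≡ suc i
    top zero    i< above below = ≤-antisym (≤-trans (diag-first a v) below) i<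
    top (suc q) i< above below = ≤-antisym (≤-trans (diag-suc a v q) (s≤s (above refl))) i<

  extensions-complete : ∀ {k} t a (v : Vec Bool (suc k)) {e} → IsLinear t (diag a v) e → Any (e ≈⟨ diag a v ⟩_) (extensions t a v)
  extensions-complete zero a v lin = here λ {_} {r} i< → contradiction (IsLinear.bounded lin {_} {r} i<) λ ()
  extensions-complete (suc t) a v {e} lin
    with i , r , i< , e≡t ← IsLinear.sur lin (≤-refl {suc t})
    with top , above , below ← last-removable t a v lin i< e≡t
    with (.r , a′ , w) , m∈ , refl ← find (moves-complete a v r i top above below) =
    Any.concat⁺ (Any.map⁺ (lose m∈ (Any.map⁺ (Any.map (place-restrict rem e≡t′) (extensions-complete t a′ w (restrict-linear rem lin e≡t′))))))
    where
    rem : IsRemoval r (diag a v) (diag a′ w)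
    rem = All.lookup (moves-sound a v) m∈
    e≡t′ : e (diag a′ w r) r ≡ t
    e≡t′ = trans (cong (λ i → e i r) (suc-injective (trans (sym (IsRemoval.top rem)) top))) e≡t

  AllPairs-with : ∀ {A : Set} {R : A → A → Set} {P : A → Set} {xs} → All P xs → AllPairs R xs → AllPairs (λ x y → P x × P y × R x y) xs
  AllPairs-with []         []         = []
  AllPairs-with (px ∷ pxs) (rx ∷ rxs) = All.map (λ (py , r) → px , py , r) (All.zip (pxs , rx)) ∷ AllPairs-with pxs rxs

  extensions-unique : ∀ {k} t a (v : Vec Bool k) → idealSize a v ≡ t → AllPairs (λ e e′ → ¬ e ≈⟨ diag a v ⟩ e′) (extensions t a v)
  extensions-unique zero    a v eq = [] ∷ []
  extensions-unique (suc t) a v eq = AllPairs.concat⁺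
    (All.map⁺ (All.map (λ {(r , a′ , w)} (rem , size≡) →
      AllPairs.map⁺ (AllPairs.map (λ e≉ → e≉ ∘ place-injective rem) (extensions-unique t a′ w (suc-injective (trans (sym size≡) eq))))) ms))
    (AllPairs.map⁺ (AllPairs.map (λ {(r , a₁ , w₁)} {(r₂ , a₂ , w₂)} ((rem₁ , size₁) , (rem₂ , size₂) , r≢) →
      All.map⁺ (All.universal (λ e → All.map⁺ (All.map (λ lin → place-disjoint rem₁ rem₂ r≢ lin) (extensions-sound t a₂ w₂ (suc-injective (trans (sym size₂) eq))))) (extensions t a₁ w₁)))
      (AllPairs-with ms (moves-unique a v))))
    where
    ms : All (λ (r , a′ , w) → IsRemoval r (diag a v) (diag a′ w) × idealSize a v ≡ suc (idealSize a′ w)) (moves a v)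
    ms = All.zip (moves-sound a v , moves-size a v)

-- Tableaux as linear extensions

module Bijection where

  open import Data.Fin as Fin using (Fin; toℕ; fromℕ<) renaming (zero to 0F; suc to sucF)
  open import Data.Fin.Properties as Fin using (toℕ-fromℕ<; toℕ-injective; toℕ<n)
  open import Data.List using (tabulate; lookup)
  open import Data.List.Membership.Propositional.Properties using (∈-lookup)
  open import Data.List.Relation.Unary.All as All using (All; []; _∷_)
  open import Data.List.Relation.Unary.AllPairs as AllPairs using (AllPairs; []; _∷_)
  open import Data.List.Relation.Unary.Any as Any using (Any; here; there)
  open import Data.Nat hiding (_*_; _/_)
  open import Data.Nat.Properties

  open LinearExtensions

  import Data.List.Relation.Unary.Any.Properties as Any

  part-δ : ∀ n i → part (δ n) i ≡ n ∸ i
  part-δ zero    i       = sym (0∸n≡0 i)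
  part-δ (suc n) zero    = refl
  part-δ (suc n) (suc i) = part-δ n i

  ∑part-δ : ∀ n → sum (tabulate {n = length (δ n)} (λ i → part (δ n) (toℕ i))) ≡ weight (replicate n true)
  ∑part-δ zero    = refl
  ∑part-δ (suc n) = cong (suc n +_) (∑part-δ n)

  diag-full : ∀ {k} a r → r ≤ k → diag a (replicate k true) r ≡ r + a
  diag-full         a zero    r≤k       = refl
  diag-full {suc k} a (suc r) (s≤s r≤k) = trans (diag-full (suc a) r r≤k) (+-suc r a)

  diag-full⁻ : ∀ {k} a r {i} → i < diag a (replicate k true) r → r ≤ k
  diag-full⁻         a zero    i< = z≤n
  diag-full⁻ {suc k} a (suc r) i< = s≤s (diag-full⁻ (suc a) r i<)

  lookup-unique : ∀ {A : Set} {R : A → A → Set} {xs} → (∀ {x y} → R x y → R y x) → AllPairs (λ x y → ¬ R x y) xs →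
    ∀ i j → R (lookup xs i) (lookup xs j) → i ≡ j
  lookup-unique s (rx ∷ rxs) 0F       0F       r = refl
  lookup-unique {xs = x ∷ xs} s (rx ∷ rxs) 0F       (sucF j) r = contradiction r (All.lookup rx (∈-lookup j))
  lookup-unique {xs = x ∷ xs} s (rx ∷ rxs) (sucF i) 0F       r = contradiction (s r) (All.lookup rx (∈-lookup i))
  lookup-unique s (rx ∷ rxs) (sucF i) (sucF j) r = cong sucF (lookup-unique s rxs i j r)

  module Tableaux (m : ℕ) where

    k n : ℕ
    k = suc m
    n = suc (suc k)

    full : Vec Bool k
    full = replicate k true

    T : Set
    T = ShiftedSYT (δ n) (δ 1)

    B : Set
    B = Box (δ n) (δ 1)

    sz : ℕ
    sz = size (δ n) (δ 1)

    c : ℕ → ℕ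
    c = diag 2 full

    sz≡ : idealSize 2 full ≡ sz
    sz≡ = trans (cong (λ x → suc k + x + weight full) (+-identityʳ (suc k))) (trans (+-assoc (suc k) (suc k) (weight full)) (cong (suc k +_) (sym (∑part-δ (suc k)))))

    i<c⁺ : ∀ {i r} → i < 2 + r → r ≤ k → i < c r
    i<c⁺ {i} {r} i< r≤k = subst (i <_) (trans (+-comm 2 r) (sym (diag-full 2 r r≤k))) i<

    r≤k⁻ : ∀ {i r} → i < c r → r ≤ k
    r≤k⁻ {i} {r} = diag-full⁻ 2 r

    i<c⁻ : ∀ {i r} → i < c r → i < 2 + r
    i<c⁻ {i} {r} i< = subst (i <_) (trans (diag-full 2 r (r≤k⁻ {i} {r} i<)) (+-comm r 2)) i<

    -- Rows 0 and 1 both have k + 1 boxes and no row has more, so the offsets end at k, on diagonal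
    -- 0.
    rowOf diagOf : B → ℕ
    rowOf (i , j) = toℕ i
    diagOf (i , j) = k ∸ toℕ j

    rowLen : ℕ → ℕ
    rowLen i = part (δ n) i ∸ part (δ 1) i

    offset≤k : ∀ (x : B) → toℕ (proj₂ x) ≤ k
    offset≤k (0F     , j) = ≤-pred (toℕ<n j)
    offset≤k (sucF i , j) = ≤-pred (≤-trans (toℕ<n j) (≤-trans (≤-reflexive (part-δ (suc k) (toℕ i))) (m∸n≤m (suc k) (toℕ i))))

    rowOf<2+diagOf : ∀ (x : B) → rowOf x < 2 + diagOf x
    rowOf<2+diagOf (0F     , j) = s≤s z≤n
    rowOf<2+diagOf (sucF i , j) = s≤s (s≤s (m+n≤o⇒m≤o∸n (toℕ i) (≤-pred (subst (_≤ suc k) (+-suc (toℕ i) (toℕ j)) i+j<))))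
      where
      j< : suc (toℕ j) ≤ suc k ∸ toℕ i
      j< = ≤-trans (toℕ<n j) (≤-reflexive (part-δ (suc k) (toℕ i)))
      i+j< : toℕ i + suc (toℕ j) ≤ suc k
      i+j< with toℕ i ≤? suc k
      ... | yes i≤ = ≤-trans (+-monoʳ-≤ (toℕ i) j<) (≤-reflexive (m+[n∸m]≡n i≤))
      ... | no  i≰ = contradiction (≤-trans j< (≤-reflexive (m≤n⇒m∸n≡0 (≰⇒≥ i≰)))) λ ()

    cell : ∀ x → rowOf x < c (diagOf x)
    cell x = i<c⁺ (rowOf<2+diagOf x) (m∸n≤m k (toℕ (proj₂ x)))

    rowLen> : ∀ i r → i < 2 + r → r ≤ k → k ∸ r < rowLen i
    rowLen> zero    r i< r≤k = s≤s (m∸n≤m k r)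
    rowLen> (suc i) r (s≤s (s≤s i≤r)) r≤k = subst (k ∸ r <_) (sym (part-δ (suc k) i))
      (≤-trans (s≤s (∸-monoʳ-≤ k i≤r)) (≤-reflexive (sym (+-∸-assoc 1 (≤-trans i≤r r≤k)))))

    i<length : ∀ i r → i < 2 + r → r ≤ k → i < length (δ n)
    i<length i r i< r≤k = subst (i <_) (sym (length-applyDownFrom suc n)) (≤-trans i< (s≤s (s≤s r≤k)))

    -- The bounds are irrelevant arguments, so that boxes with equal coordinates are equal whichever
    -- proofs were supplied.
    box : ∀ i r → .(i < 2 + r) → .(r ≤ k) → B
    box i r i< r≤k = fromℕ< (i<length i r i< r≤k) ,
      fromℕ< (subst (λ z → k ∸ r < rowLen z) (sym (toℕ-fromℕ< (i<length i r i< r≤k))) (rowLen> i r i< r≤k))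

    module _ {i r} .(i< : i < 2 + r) .(r≤k : r ≤ k) where

      rowOf-box : rowOf (box i r i< r≤k) ≡ i
      rowOf-box = toℕ-fromℕ< (i<length i r i< r≤k)

      offset-box : toℕ (proj₂ (box i r i< r≤k)) ≡ k ∸ r
      offset-box = toℕ-fromℕ< _

    diagOf-box : ∀ {i r} .(i< : i < 2 + r) (r≤k : r ≤ k) → diagOf (box i r i< r≤k) ≡ r
    diagOf-box {i} {r} i< r≤k = trans (cong (k ∸_) (offset-box {i} {r} i< r≤k)) (m∸[m∸n]≡n r≤k)

    col-box : ∀ {i r} .(i< : i < 2 + r) .(r≤k : r ≤ k) → col (δ n) (δ 1) (box i r i< r≤k) ≡ i + (k ∸ r)
    col-box {i} {r} i< r≤k = cong₂ _+_ (rowOf-box i< r≤k) (offset-box {i} {r} i< r≤k)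

    box-≡ : ∀ (x y : B) → rowOf x ≡ rowOf y → diagOf x ≡ diagOf y → x ≡ y
    box-≡ x@(i , j) y@(i′ , j′) i≡ r≡ with refl ← toℕ-injective i≡ =
      cong (i ,_) (toℕ-injective (∸-cancelˡ-≡ (offset≤k x) (offset≤k y) r≡))

    fill : (B → Fin sz) → Filling
    fill f i r with i <? 2 + r | r ≤? k
    ... | yes i< | yes r≤k = toℕ (f (box i r i< r≤k))
    -- A default outside the shape, where `≈⟨ c ⟩` does not look.
    ... | _      | _       = 0

    fill-box : ∀ f {i r} (i< : i < 2 + r) (r≤k : r ≤ k) → fill f i r ≡ toℕ (f (box i r i< r≤k))
    fill-box f {i} {r} i< r≤k with i <? 2 + r | r ≤? k
    ... | yes _ | yes _  = refl
    ... | no i≮ | _      = contradiction i< i≮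
    ... | yes _ | no r≰k = contradiction r≤k r≰k

    fill-cell : ∀ f x → fill f (rowOf x) (diagOf x) ≡ toℕ (f x)
    fill-cell f x = trans (fill-box f (rowOf<2+diagOf x) r≤) (cong (toℕ ∘ f) (box-≡ _ x (rowOf-box (rowOf<2+diagOf x) r≤) (diagOf-box (rowOf<2+diagOf x) r≤)))
      where
      r≤ : diagOf x ≤ k
      r≤ = m∸n≤m k (toℕ (proj₂ x))

    fill-linear : (t : T) → IsLinear sz c (fill (ShiftedSYT.entry t))
    fill-linear t = record { bounded = bounded ; inj = inj ; sur = sur ; step = step ; fall = fall }
      where
      open ShiftedSYT t
      e : Filling
      e = fill entry
      e≡ : ∀ {i r} (i< : i < c r) → e i r ≡ toℕ (entry (box i r (i<c⁻ {i} {r} i<) (r≤k⁻ {i} {r} i<)))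
      e≡ {i} {r} i< = fill-box entry (i<c⁻ {i} {r} i<) (r≤k⁻ {i} {r} i<)
      bounded : ∀ {i r} → i < c r → e i r < sz
      bounded {i} {r} i< = subst (_< sz) (sym (e≡ {i} {r} i<)) (toℕ<n _)
      inj : ∀ {i r i′ r′} → i < c r → i′ < c r′ → e i r ≡ e i′ r′ → i ≡ i′ × r ≡ r′
      inj {i} {r} {i′} {r′} i< i′< eq =
        trans (sym (rowOf-box (i<c⁻ {i} {r} i<) (r≤k⁻ {i} {r} i<))) (trans (cong rowOf b≡) (rowOf-box (i<c⁻ {i′} {r′} i′<) (r≤k⁻ {i′} {r′} i′<))) ,
        trans (sym (diagOf-box (i<c⁻ {i} {r} i<) (r≤k⁻ {i} {r} i<))) (trans (cong diagOf b≡) (diagOf-box (i<c⁻ {i′} {r′} i′<) (r≤k⁻ {i′} {r′} i′<)))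
        where
        b≡ : box i r (i<c⁻ {i} {r} i<) (r≤k⁻ {i} {r} i<) ≡ box i′ r′ (i<c⁻ {i′} {r′} i′<) (r≤k⁻ {i′} {r′} i′<)
        b≡ = proj₁ entry-bijective (toℕ-injective (trans (sym (e≡ {i} {r} i<)) (trans eq (e≡ {i′} {r′} i′<))))
      sur : ∀ {u} → u < sz → ∃₂ λ i r → i < c r × e i r ≡ u
      sur u< with x , entry≡ ← proj₂ entry-bijective (fromℕ< u<) =
        rowOf x , diagOf x , cell x , trans (fill-cell entry x) (trans (cong toℕ (entry≡ refl)) (toℕ-fromℕ< u<))
      step : ∀ {i r} → i < c r → i < c (suc r) → e i (suc r) < e i r
      step {i} {r} i< i<′ = subst₂ _<_ (sym (e≡ {i} {suc r} i<′)) (sym (e≡ {i} {r} i<))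
        (row-increasing _ _ (trans (rowOf-box p′ q′) (sym (rowOf-box p q)))
          (subst₂ _<_ (sym (col-box {i} p′ q′)) (sym (col-box {i} p q)) (+-monoʳ-< i (∸-monoʳ-< ≤-refl q′))))
        where
        p = i<c⁻ {i} {r} i<
        p′ = i<c⁻ {i} {suc r} i<′
        q = r≤k⁻ {i} {r} i<
        q′ = r≤k⁻ {i} {suc r} i<′
      fall : ∀ {i r} → i < c r → suc i < c (suc r) → e i r < e (suc i) (suc r)
      fall {i} {r} i< i<′ = subst₂ _<_ (sym (e≡ {i} {r} i<)) (sym (e≡ {suc i} {suc r} i<′))
        (col-increasing _ _
          (trans (col-box {i} p q) (trans (trans (cong (i +_) (+-∸-assoc 1 q′)) (+-suc i (k ∸ suc r))) (sym (col-box {suc i} p′ q′))))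
          (subst₂ _<_ (sym (rowOf-box p q)) (sym (rowOf-box p′ q′)) ≤-refl))
        where
        p = i<c⁻ {i} {r} i<
        p′ = i<c⁻ {suc i} {suc r} i<′
        q = r≤k⁻ {i} {r} i<
        q′ = r≤k⁻ {suc i} {suc r} i<′

    module _ {e} (lin : IsLinear sz c e) where
      open IsLinear lin

      -- `IsLinear` compares adjacent boxes only, a tableau any two boxes of a row or column; chains
      -- of neighbours bridge the gap.
      step* : ∀ d {i r} → i < 2 + r → suc d + r ≤ k → e i (suc d + r) < e i r
      step* zero    {i} {r} i< ≤k = step {i} {r} (i<c⁺ i< (<⇒≤ ≤k)) (i<c⁺ (m<n⇒m<1+n i<) ≤k)
      step* (suc d) {i} {r} i< ≤k = <-trans (step {i} {suc d + r} (i<c⁺ i<′ (<⇒≤ ≤k)) (i<c⁺ (m<n⇒m<1+n i<′) ≤k)) (step* d i< (<⇒≤ ≤k))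
        where
        i<′ : i < 2 + (suc d + r)
        i<′ = ≤-trans i< (s≤s (s≤s (m≤n+m r (suc d))))

      fall* : ∀ d {i r} → i < 2 + r → suc d + r ≤ k → e i r < e (suc d + i) (suc d + r)
      fall* zero    {i} {r} i< ≤k = fall {i} {r} (i<c⁺ i< (<⇒≤ ≤k)) (i<c⁺ (s≤s i<) ≤k)
      fall* (suc d) {i} {r} i< ≤k = <-trans (fall* d i< (<⇒≤ ≤k)) (fall {suc d + i} {suc d + r} (i<c⁺ i<′ (<⇒≤ ≤k)) (i<c⁺ (s≤s i<′) ≤k))
        where
        i<′ : suc d + i < 2 + (suc d + r)
        i<′ = subst (suc d + i <_) (trans (+-suc (suc d) (suc r)) (cong suc (+-suc (suc d) r))) (+-monoʳ-< (suc d) i<)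

      tableau-entry : B → Fin sz
      tableau-entry x = fromℕ< (bounded {rowOf x} {diagOf x} (cell x))

      toℕ-entry : ∀ x → toℕ (tableau-entry x) ≡ e (rowOf x) (diagOf x)
      toℕ-entry x = toℕ-fromℕ< (bounded {rowOf x} {diagOf x} (cell x))

      tableau : T
      tableau = record
        { entry           = tableau-entry
        ; entry-bijective = injective , surjective
        ; row-increasing  = row-inc
        ; col-increasing  = col-inc
        }
        where
        injective : ∀ {x y} → tableau-entry x ≡ tableau-entry y → x ≡ y
        injective {x} {y} eq with i≡ , r≡ ← inj {rowOf x} {diagOf x} {rowOf y} {diagOf y} (cell x) (cell y) (trans (sym (toℕ-entry x)) (trans (cong toℕ eq) (toℕ-entry y))) = box-≡ x y i≡ r≡
        surjective : ∀ y → ∃ λ x → ∀ {z} → z ≡ x → tableau-entry z ≡ y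
        surjective y with i , r , i< , eq ← sur (toℕ<n y) =
          box i r (i<c⁻ {i} {r} i<) (r≤k⁻ {i} {r} i<) ,
          λ { refl → toℕ-injective (trans (toℕ-entry (box i r (i<c⁻ {i} {r} i<) (r≤k⁻ {i} {r} i<))) (trans (cong₂ e (rowOf-box (i<c⁻ {i} {r} i<) (r≤k⁻ {i} {r} i<)) (diagOf-box (i<c⁻ {i} {r} i<) (r≤k⁻ {i} {r} i<))) eq)) }
        row-inc : ∀ a b → row (δ n) (δ 1) a ≡ row (δ n) (δ 1) b → col (δ n) (δ 1) a < col (δ n) (δ 1) b → tableau-entry a Fin.< tableau-entry b
        row-inc a b row≡ col< = subst₂ _<_ (sym (trans (toℕ-entry a) (cong₂ e row≡ ra≡))) (sym (toℕ-entry b)) (step* d {rowOf b} {diagOf b} (rowOf<2+diagOf b) (subst (_≤ k) ra≡ (m∸n≤m k (toℕ (proj₂ a)))))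
          where
          offset< : toℕ (proj₂ a) < toℕ (proj₂ b)
          offset< = +-cancelˡ-< (rowOf b) _ _ (subst (λ z → z + toℕ (proj₂ a) < rowOf b + toℕ (proj₂ b)) row≡ col<)
          d = diagOf a ∸ suc (diagOf b)
          ra≡ : diagOf a ≡ suc d + diagOf b
          ra≡ = trans (sym (m+[n∸m]≡n (∸-monoʳ-< offset< (offset≤k b)))) (cong suc (+-comm (diagOf b) d))
        col-inc : ∀ a b → col (δ n) (δ 1) a ≡ col (δ n) (δ 1) b → row (δ n) (δ 1) a < row (δ n) (δ 1) b → tableau-entry a Fin.< tableau-entry b
        col-inc a b col≡ row< = subst₂ _<_ (sym (toℕ-entry a)) (sym (trans (toℕ-entry b) (cong₂ e ib≡ rb≡))) (fall* d {rowOf a} {diagOf a} (rowOf<2+diagOf a) (subst (_≤ k) rb≡ (m∸n≤m k (toℕ (proj₂ b)))))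
          where
          d = rowOf b ∸ suc (rowOf a)
          ja jb : ℕ
          ja = toℕ (proj₂ a)
          jb = toℕ (proj₂ b)
          ib≡ : rowOf b ≡ suc d + rowOf a
          ib≡ = trans (sym (m+[n∸m]≡n row<)) (cong suc (+-comm (rowOf a) d))
          ja≡ : ja ≡ suc d + jb
          ja≡ = +-cancelˡ-≡ (rowOf a) _ _ (trans col≡ (trans (cong (_+ jb) (trans ib≡ (+-comm (suc d) (rowOf a)))) (+-assoc (rowOf a) (suc d) jb)))
          rb≡ : diagOf b ≡ suc d + diagOf a
          rb≡ = +-cancelʳ-≡ jb _ _ (trans (m∸n+n≡m (offset≤k b)) (trans (sym (m∸n+n≡m (offset≤k a)))
            (trans (cong (diagOf a +_) ja≡) (trans (sym (+-assoc (diagOf a) (suc d) jb)) (cong (_+ jb) (+-comm (diagOf a) (suc d)))))))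

    exts : List Filling
    exts = extensions sz 2 full

    -- Completeness locates every tableau in the list, and since no two members agree on the whole
    -- shape, this position is inverse to the lookup.
    tableaux-cardinality : HasCardinality (ShiftedSYT-setoid (δ n) (δ 1)) (length exts)
    tableaux-cardinality = record
      { to        = to
      ; from      = from
      ; to-cong   = λ { refl x → refl }
      ; from-cong = λ {t} {t′} t≈t′ → lookup-unique ≈-sym unique (from t) (from t′)
          λ {i} {r} i< → trans (sym (from-lookup t {i} {r} i<)) (trans (fill-cong t t′ t≈t′ i r) (from-lookup t′ {i} {r} i<))
      ; inverse   = (λ { {t} {i} refl → to-from t }) , λ {i} {t} t≈ → lookup-unique ≈-sym unique (from t) i
          λ {j} {r} i< → trans (sym (from-lookup t {j} {r} i<)) (trans (fill-cong t (to i) t≈ j r) (fill-to i {j} {r} i<))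
      }
      where
      unique : AllPairs (λ e e′ → ¬ e ≈⟨ c ⟩ e′) exts
      unique = extensions-unique sz 2 full sz≡
      sound : ∀ i → IsLinear sz c (lookup exts i)
      sound i = All.lookup (extensions-sound sz 2 full sz≡) (∈-lookup i)
      ≈-sym : ∀ {e e′} → e ≈⟨ c ⟩ e′ → e′ ≈⟨ c ⟩ e
      ≈-sym eq {i} {r} i< = sym (eq {i} {r} i<)
      to : Fin (length exts) → T
      to i = tableau (sound i)
      complete : ∀ t → Any (fill (ShiftedSYT.entry t) ≈⟨ c ⟩_) exts
      complete t = extensions-complete sz 2 full (fill-linear t)
      from : T → Fin (length exts)
      from t = Any.index (complete t)
      from-lookup : ∀ t → fill (ShiftedSYT.entry t) ≈⟨ c ⟩ lookup exts (from t)
      from-lookup t = Any.lookup-index (complete t)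
      fill-cong : ∀ t t′ → (∀ x → ShiftedSYT.entry t x ≡ ShiftedSYT.entry t′ x) → ∀ i r → fill (ShiftedSYT.entry t) i r ≡ fill (ShiftedSYT.entry t′) i r
      fill-cong t t′ eq i r with i <? 2 + r | r ≤? k
      ... | yes i< | yes r≤k = cong toℕ (eq _)
      ... | yes _  | no _    = refl
      ... | no _   | _       = refl
      fill-to : ∀ i → fill (ShiftedSYT.entry (to i)) ≈⟨ c ⟩ lookup exts i
      fill-to i {j} {r} i< = trans (fill-box _ p q) (trans (toℕ-entry (sound i) (box j r p q)) (cong₂ (lookup exts i) (rowOf-box p q) (diagOf-box p q)))
        where
        p = i<c⁻ {j} {r} i<
        q = r≤k⁻ {j} {r} i<
      to-from : ∀ t x → ShiftedSYT.entry (to (from t)) x ≡ ShiftedSYT.entry t x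
      to-from t x = toℕ-injective (trans (toℕ-entry (sound (from t)) x) (trans (sym (from-lookup t {rowOf x} {diagOf x} (cell x))) (fill-cell (ShiftedSYT.entry t) x)))

open LinearExtensions
open Bijection

import Data.Integer as ℤ
import Data.Integer.Properties as ℤ
open import Data.Nat.Combinatorics using (_C_; nCk≡n!/k![n-k]!; [n∸k]!k!∣n!; nCk+nC[k+1]≡[n+1]C[k+1]; nC1≡n)
open import Data.Nat.Divisibility using (_∣_)
open import Data.Nat.DivMod using (m/n*n≡m)
open import Data.Nat.ListAction.Properties using (product-++)
open import Data.Rational using (ℚ; 0ℚ; 1ℚ; _+_; _-_; -_; 1/_; NonZero; NonNegative; ≢-nonZero; toℚᵘ)
open import Data.Rational.Properties
import Data.Rational.Unnormalised as ℚᵘ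
import Data.Rational.Unnormalised.Properties as ℚᵘ
open import Level using (0ℓ)
open import Tactic.RingSolver using (solve-∀)
open import Tactic.RingSolver.Core.AlmostCommutativeRing using (AlmostCommutativeRing; fromCommutativeRing)
open ≡-Reasoning


-- Natural numbers and inverses in ℚ

ℚ-ring : AlmostCommutativeRing 0ℓ 0ℓ
ℚ-ring = fromCommutativeRing +-*-commutativeRing λ x → dec⇒maybe (0ℚ ≟ x)

-- The recursion makes `ι (suc n)` unfold to `1ℚ + ι n`, a form the ring solver can work with;
-- `ι≡/1` returns to fractions.
ι : ℕ → ℚ
ι zero    = 0ℚ
ι (suc n) = 1ℚ + ι n

ι-+ : ∀ m n → ι (m ℕ.+ n) ≡ ι m + ι n
ι-+ zero    n = sym (+-identityˡ (ι n))
ι-+ (suc m) n = trans (cong (1ℚ +_) (ι-+ m n)) (sym (+-assoc 1ℚ (ι m) (ι n)))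

ι-* : ∀ m n → ι (m ℕ.* n) ≡ ι m * ι n
ι-* zero    n = sym (*-zeroˡ (ι n))
ι-* (suc m) n = begin
  ι (n ℕ.+ m ℕ.* n)     ≡⟨ ι-+ n (m ℕ.* n) ⟩
  ι n + ι (m ℕ.* n)     ≡⟨ cong (ι n +_) (ι-* m n) ⟩
  ι n + ι m * ι n       ≡⟨ lemma (ι m) (ι n) ⟩
  (1ℚ + ι m) * ι n      ∎
  where
  lemma : ∀ a b → b + a * b ≡ (1ℚ + a) * b
  lemma = solve-∀ ℚ-ring

ι-nonNegative : ∀ n → NonNegative (ι n)
ι-nonNegative zero    = _
ι-nonNegative (suc n) = nonNeg+nonNeg⇒nonNeg 1ℚ (ι n) {{ι-nonNegative n}}

ι-suc≢0 : ∀ n → ι (suc n) ≢ 0ℚ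
ι-suc≢0 n eq = <⇒≢ (+-mono-<-≤ {0ℚ} {1ℚ} {0ℚ} {ι n} (positive⁻¹ 1ℚ) (nonNegative⁻¹ (ι n) {{ι-nonNegative n}})) (sym eq)

opaque
  -- Extended by inv 0ℚ = 0ℚ.
  inv : ℚ → ℚ
  inv x with x ≟ 0ℚ
  ... | yes _  = 0ℚ
  ... | no x≢0 = (1/ x) {{≢-nonZero x≢0}}

  *-inv : ∀ {x} → x ≢ 0ℚ → x * inv x ≡ 1ℚ
  *-inv {x} x≢0 with x ≟ 0ℚ
  ... | yes x≡0 = contradiction x≡0 x≢0
  ... | no  x≢0 = *-inverseʳ x {{≢-nonZero x≢0}}

inv-unique : ∀ {x y} → x * y ≡ 1ℚ → inv x ≡ y
inv-unique {x} {y} xy≡1 = begin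
  inv x             ≡⟨ *-identityˡ (inv x) ⟨
  1ℚ * inv x        ≡⟨ cong (_* inv x) xy≡1 ⟨
  x * y * inv x     ≡⟨ lemma x y (inv x) ⟩
  x * inv x * y     ≡⟨ cong (_* y) (*-inv x≢0) ⟩
  1ℚ * y            ≡⟨ *-identityˡ y ⟩
  y                 ∎
  where
  lemma : ∀ a b c → a * b * c ≡ a * c * b
  lemma = solve-∀ ℚ-ring
  x≢0 : x ≢ 0ℚ
  x≢0 refl with () ← trans (sym xy≡1) (*-zeroˡ y)

-- Schur's product formula and its recursion

sumInc : ∀ {k} → (Vec Bool k → ℚ) → Vec Bool k → ℚ
-- Beyond the last bit there is none to set: a part 1 that loses its box disappears. In the last
-- clause the smaller part is already taken.
sumInc h []          = h []
sumInc h (false ∷ v) = h (true ∷ v)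
sumInc h (true ∷ v)  = 0ℚ

-- The removal of a box that turns a part b + 1 into b is weighted by ψ b.
sumRem : ∀ {k} → (ℕ → ℚ) → (Vec Bool k → ℚ) → Vec Bool k → ℚ
sumRem ψ h []                  = 0ℚ
sumRem ψ h (false ∷ v)         = sumRem ψ (λ w → h (false ∷ w)) v
sumRem {suc k} ψ h (true ∷ v)  = ψ k * sumInc (λ w → h (false ∷ w)) v + sumRem ψ (λ w → h (true ∷ w)) v

p : ℕ → ℕ → ℚ
p x a = (ι x - ι a) * inv (ι x + ι a)

P : ∀ {k} → ℕ → Vec Bool k → ℚ
P x []                 = 1ℚ
P x (false ∷ v)        = P x v
P {suc k} x (true ∷ v) = p x (suc k) * P x v

1/! : ℕ → ℚ
1/! zero    = 1ℚ
1/! (suc n) = inv (ι (suc n)) * 1/! n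

-- Schur's formula for the number of shifted tableaux of shape λ, divided by |λ|!, namely
-- ∏ 1 / λᵢ! · ∏_{i < j} (λᵢ − λⱼ) / (λᵢ + λⱼ).
H : ∀ {k} → Vec Bool k → ℚ
H []                 = 1ℚ
H (false ∷ v)        = H v
H {suc k} (true ∷ v) = H v * P (suc k) v * 1/! (suc k)

-- Since (y - b)(y + b + 1) = `tri y - tri b`, the ratio `ρ y b` has a simple pole in the variable
-- `tri b`, which makes partial fractions available.
tri : ℕ → ℚ
tri n = ι (suc n) * ι n

-- The factor by which P (suc y) grows when a part b + 1 is replaced by b.
ρ : ℕ → ℕ → ℚ
ρ y b = 1ℚ + (1ℚ + 1ℚ) * ι (suc y) * inv (tri y - tri b)

module _ {y b : ℕ} (b<y : b ℕ.< y) where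

  private
    d : ℕ
    d = y ℕ.∸ suc b

    y≡ : ι y ≡ ι b + ι (suc d)
    y≡ = begin
      ι y                        ≡⟨ cong ι (ℕ.m+[n∸m]≡n b<y) ⟨
      ι (suc b ℕ.+ d)            ≡⟨ cong ι (ℕ.+-suc b d) ⟨
      ι (b ℕ.+ suc d)            ≡⟨ ι-+ b (suc d) ⟩
      ι b + ι (suc d)            ∎

  y-b≢0 : ι y - ι b ≢ 0ℚ
  y-b≢0 eq = ι-suc≢0 d (begin
    ι (suc d)               ≡⟨ lemma (ι b) (ι (suc d)) ⟨
    ι b + ι (suc d) - ι b   ≡⟨ cong (_- ι b) y≡ ⟨
    ι y - ι b               ≡⟨ eq ⟩
    0ℚ                      ∎)
    where
    lemma : ∀ a b → a + b - a ≡ b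
    lemma = solve-∀ ℚ-ring

  private
    Y B i₁ i₂ j k : ℚ
    Y = ι y
    B = ι b
    i₁ = inv (1ℚ + Y + B)
    i₂ = inv (1ℚ + Y + (1ℚ + B))
    j = inv (tri y - tri b)
    k = inv (Y - B)

    e₁ : (1ℚ + Y + B) * i₁ ≡ 1ℚ
    e₁ = *-inv λ eq → ι-suc≢0 (y ℕ.+ b) (trans (ι-+ (suc y) b) eq)

    e₂ : (1ℚ + Y + (1ℚ + B)) * i₂ ≡ 1ℚ
    e₂ = *-inv λ eq → ι-suc≢0 (y ℕ.+ suc b) (trans (ι-+ (suc y) (suc b)) eq)

    ek : (Y - B) * k ≡ 1ℚ
    ek = *-inv y-b≢0

    j≡ : j ≡ k * i₁
    j≡ = inv-unique {tri y - tri b} {k * i₁} (begin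
      ((1ℚ + Y) * Y - (1ℚ + B) * B) * (k * i₁)    ≡⟨ lemma Y B k i₁ ⟩
      ((Y - B) * k) * ((1ℚ + Y + B) * i₁)         ≡⟨ cong₂ _*_ ek e₁ ⟩
      1ℚ * 1ℚ                                     ≡⟨ *-identityˡ 1ℚ ⟩
      1ℚ                                          ∎)
      where
      lemma : ∀ Y B k i₁ → ((1ℚ + Y) * Y - (1ℚ + B) * B) * (k * i₁) ≡ ((Y - B) * k) * ((1ℚ + Y + B) * i₁)
      lemma = solve-∀ ℚ-ring

    [Y-B]j : (Y - B) * j ≡ i₁
    [Y-B]j = begin
      (Y - B) * j          ≡⟨ cong ((Y - B) *_) j≡ ⟩
      (Y - B) * (k * i₁)   ≡⟨ *-assoc (Y - B) k i₁ ⟨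
      (Y - B) * k * i₁     ≡⟨ cong (_* i₁) ek ⟩
      1ℚ * i₁              ≡⟨ *-identityˡ i₁ ⟩
      i₁                   ∎

  tri-inv : (tri y - tri b) * j ≡ 1ℚ
  tri-inv = begin
    (tri y - tri b) * j          ≡⟨ lemma Y B j ⟩
    (1ℚ + Y + B) * ((Y - B) * j) ≡⟨ cong ((1ℚ + Y + B) *_) [Y-B]j ⟩
    (1ℚ + Y + B) * i₁            ≡⟨ e₁ ⟩
    1ℚ                           ∎
    where
    lemma : ∀ Y B j → ((1ℚ + Y) * Y - (1ℚ + B) * B) * j ≡ (1ℚ + Y + B) * ((Y - B) * j)
    lemma = solve-∀ ℚ-ring

  private
    -- Serves two shifts of `p (suc y) (suc b)` over the same denominators: c = 2 (y + 1) lowers the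
    -- second argument, c = - 2 (b + 1) the first.
    common : ∀ c → (1ℚ + c * j) * p (suc y) (suc b) ≡ ((Y - B) * (1ℚ + Y + B) + c) * (i₁ * i₂)
    common c = begin
      (1ℚ + c * j) * ((1ℚ + Y - (1ℚ + B)) * i₂)                      ≡⟨ l₁ Y B c j i₂ ⟩
      (Y - B) * 1ℚ * i₂ + c * ((Y - B) * j) * i₂                     ≡⟨ cong₂ (λ s t → (Y - B) * s * i₂ + c * t * i₂) (sym e₁) [Y-B]j ⟩
      (Y - B) * ((1ℚ + Y + B) * i₁) * i₂ + c * i₁ * i₂               ≡⟨ l₂ Y B c i₁ i₂ ⟩
      ((Y - B) * (1ℚ + Y + B) + c) * (i₁ * i₂)                       ∎
      where
      l₁ : ∀ Y B c j i₂ → (1ℚ + c * j) * ((1ℚ + Y - (1ℚ + B)) * i₂) ≡ (Y - B) * 1ℚ * i₂ + c * ((Y - B) * j) * i₂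
      l₁ = solve-∀ ℚ-ring
      l₂ : ∀ Y B c i₁ i₂ → (Y - B) * ((1ℚ + Y + B) * i₁) * i₂ + c * i₁ * i₂ ≡ ((Y - B) * (1ℚ + Y + B) + c) * (i₁ * i₂)
      l₂ = solve-∀ ℚ-ring

  p-shift : p (suc y) b ≡ ρ y b * p (suc y) (suc b)
  p-shift = begin
    (1ℚ + Y - B) * i₁                                              ≡⟨ *-identityʳ _ ⟨
    (1ℚ + Y - B) * i₁ * 1ℚ                                         ≡⟨ cong ((1ℚ + Y - B) * i₁ *_) e₂ ⟨
    (1ℚ + Y - B) * i₁ * ((1ℚ + Y + (1ℚ + B)) * i₂)                 ≡⟨ l Y B i₁ i₂ ⟩
    ((Y - B) * (1ℚ + Y + B) + (1ℚ + 1ℚ) * (1ℚ + Y)) * (i₁ * i₂)    ≡⟨ common _ ⟨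
    ρ y b * p (suc y) (suc b)                                      ∎
    where
    l : ∀ Y B i₁ i₂ → (1ℚ + Y - B) * i₁ * ((1ℚ + Y + (1ℚ + B)) * i₂) ≡ ((Y - B) * (1ℚ + Y + B) + (1ℚ + 1ℚ) * (1ℚ + Y)) * (i₁ * i₂)
    l = solve-∀ ℚ-ring

  -- β is `ρ b y`, the ratio with its arguments exchanged: `p` is antisymmetric, so lowering its
  -- first argument is described by the same function.
  β γ : ℚ
  β = 1ℚ + - ((1ℚ + 1ℚ) * ι (suc b)) * j
  γ = ρ y b

  β-p : β * p (suc y) (suc b) ≡ p y (suc b)
  β-p = begin
    β * p (suc y) (suc b)                                             ≡⟨ common _ ⟩
    ((Y - B) * (1ℚ + Y + B) + - ((1ℚ + 1ℚ) * (1ℚ + B))) * (i₁ * i₂)   ≡⟨ l Y B i₁ i₂ ⟩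
    (Y - (1ℚ + B)) * i₁ * ((1ℚ + Y + (1ℚ + B)) * i₂)                  ≡⟨ cong ((Y - (1ℚ + B)) * i₁ *_) e₂ ⟩
    (Y - (1ℚ + B)) * i₁ * 1ℚ                                          ≡⟨ *-identityʳ _ ⟩
    (Y - (1ℚ + B)) * i₁                                               ≡⟨ cong (λ z → (Y - (1ℚ + B)) * inv z) (l₂ Y B) ⟩
    (Y - (1ℚ + B)) * inv (Y + (1ℚ + B))                               ∎
    where
    l : ∀ Y B i₁ i₂ → ((Y - B) * (1ℚ + Y + B) + - ((1ℚ + 1ℚ) * (1ℚ + B))) * (i₁ * i₂) ≡ (Y - (1ℚ + B)) * i₁ * ((1ℚ + Y + (1ℚ + B)) * i₂)
    l = solve-∀ ℚ-ring
    l₂ : ∀ Y B → 1ℚ + Y + B ≡ Y + (1ℚ + B)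
    l₂ = solve-∀ ℚ-ring

  βx+γa : β * ι (suc y) + γ * ι (suc b) ≡ ι (suc y) + ι (suc b)
  βx+γa = l (ι (suc y)) (ι (suc b)) j
    where
    l : ∀ x a j → (1ℚ + - ((1ℚ + 1ℚ) * a) * j) * x + (1ℚ + (1ℚ + 1ℚ) * x * j) * a ≡ x + a
    l = solve-∀ ℚ-ring

-- Partial fractions: 1 / ((X - C)(A - C)) = (1 / (A - C) - 1 / (X - C)) / (X - A) for X, A, C =
-- `tri y`, `tri b`, `tri c`. The coefficients on the right do not depend on c.
ρ-* : ∀ {y b c} (b<y : b ℕ.< y) → c ℕ.< b →
  ρ y c * ρ b c ≡ (1ℚ - β b<y - γ b<y) + β b<y * ρ y c + γ b<y * ρ b c
ρ-* {y} {b} {c} b<y c<b = begin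
  ρ y c * ρ b c                                   ≡⟨ l₁ (ι (suc y)) (ι (suc b)) u w ⟩
  rest + 4xa * (u * w)                            ≡⟨ cong (λ z → rest + 4xa * z) uw ⟩
  rest + 4xa * (j * (w - u))                      ≡⟨ l₂ (ι (suc y)) (ι (suc b)) u w j ⟩
  (1ℚ - β b<y - γ b<y) + β b<y * ρ y c + γ b<y * ρ b c ∎
  where
  u w j rest 4xa : ℚ
  u = inv (tri y - tri c)
  w = inv (tri b - tri c)
  j = inv (tri y - tri b)
  rest = 1ℚ + (1ℚ + 1ℚ) * ι (suc y) * u + (1ℚ + 1ℚ) * ι (suc b) * w
  4xa = (1ℚ + 1ℚ) * ι (suc y) * ((1ℚ + 1ℚ) * ι (suc b))
  l₁ : ∀ x a u w → (1ℚ + (1ℚ + 1ℚ) * x * u) * (1ℚ + (1ℚ + 1ℚ) * a * w) ≡ 1ℚ + (1ℚ + 1ℚ) * x * u + (1ℚ + 1ℚ) * a * w + (1ℚ + 1ℚ) * x * ((1ℚ + 1ℚ) * a) * (u * w)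
  l₁ = solve-∀ ℚ-ring
  l₂ : ∀ x a u w j → 1ℚ + (1ℚ + 1ℚ) * x * u + (1ℚ + 1ℚ) * a * w + (1ℚ + 1ℚ) * x * ((1ℚ + 1ℚ) * a) * (j * (w - u)) ≡
    (1ℚ - (1ℚ + - ((1ℚ + 1ℚ) * a) * j) - (1ℚ + (1ℚ + 1ℚ) * x * j)) + (1ℚ + - ((1ℚ + 1ℚ) * a) * j) * (1ℚ + (1ℚ + 1ℚ) * x * u) + (1ℚ + (1ℚ + 1ℚ) * x * j) * (1ℚ + (1ℚ + 1ℚ) * a * w)
  l₂ = solve-∀ ℚ-ring
  l₃ : ∀ X A C u w j → (X - A) * j * (u * w) ≡ j * ((X - C) * u * w - (A - C) * w * u)
  l₃ = solve-∀ ℚ-ring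
  uw : u * w ≡ j * (w - u)
  uw = begin
    u * w                                                        ≡⟨ *-identityˡ (u * w) ⟨
    1ℚ * (u * w)                                                 ≡⟨ cong (_* (u * w)) (tri-inv b<y) ⟨
    (tri y - tri b) * j * (u * w)                                ≡⟨ l₃ (tri y) (tri b) (tri c) u w j ⟩
    j * ((tri y - tri c) * u * w - (tri b - tri c) * w * u)      ≡⟨ cong₂ (λ s t → j * (s * w - t * u)) (tri-inv (ℕ.<-trans c<b b<y)) (tri-inv c<b) ⟩
    j * (1ℚ * w - 1ℚ * u)                                        ≡⟨ cong₂ (λ s t → j * (s - t)) (*-identityˡ w) (*-identityˡ u) ⟩
    j * (w - u)                                                  ∎

sumInc-cong : ∀ {k} {h h′ : Vec Bool k → ℚ} v → (∀ w → weight w ≡ k ℕ.+ weight v → h w ≡ h′ w) → sumInc h v ≡ sumInc h′ v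
sumInc-cong []          eq = eq [] refl
sumInc-cong (false ∷ v) eq = eq (true ∷ v) refl
sumInc-cong (true ∷ v)  eq = refl

sumRem-cong : ∀ {k} {ψ ψ′ : ℕ → ℚ} {h h′ : Vec Bool k → ℚ} v →
  (∀ b → b ℕ.< k → ψ b ≡ ψ′ b) → (∀ w → suc (weight w) ≡ weight v → h w ≡ h′ w) → sumRem ψ h v ≡ sumRem ψ′ h′ v
sumRem-cong []          ψ≡ h≡ = refl
sumRem-cong (false ∷ v) ψ≡ h≡ = sumRem-cong v (λ b b<k → ψ≡ b (ℕ.m<n⇒m<1+n b<k)) (λ w → h≡ (false ∷ w))
sumRem-cong {suc k} (true ∷ v)  ψ≡ h≡ = cong₂ _+_
  (cong₂ _*_ (ψ≡ k ℕ.≤-refl) (sumInc-cong v λ w eq → h≡ (false ∷ w) (cong suc eq)))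
  (sumRem-cong v (λ b b<k → ψ≡ b (ℕ.m<n⇒m<1+n b<k)) (λ w eq → h≡ (true ∷ w) (trans (sym (ℕ.+-suc (suc k) (weight w))) (cong (suc k ℕ.+_) eq))))

sumInc-*ˡ : ∀ {k} c (h : Vec Bool k → ℚ) v → sumInc (λ w → c * h w) v ≡ c * sumInc h v
sumInc-*ˡ c h []          = refl
sumInc-*ˡ c h (false ∷ v) = refl
sumInc-*ˡ c h (true ∷ v)  = sym (*-zeroʳ c)

sumRem-*ˡ : ∀ {k} ψ c (h : Vec Bool k → ℚ) v → sumRem ψ (λ w → c * h w) v ≡ c * sumRem ψ h v
sumRem-*ˡ ψ c h []          = sym (*-zeroʳ c)
sumRem-*ˡ ψ c h (false ∷ v) = sumRem-*ˡ ψ c _ v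
sumRem-*ˡ {suc k} ψ c h (true ∷ v)  = begin
  ψ k * sumInc (λ w → c * h (false ∷ w)) v + sumRem ψ (λ w → c * h (true ∷ w)) v ≡⟨ cong₂ (λ s t → ψ k * s + t) (sumInc-*ˡ c _ v) (sumRem-*ˡ ψ c _ v) ⟩
  ψ k * (c * s) + c * t    ≡⟨ l (ψ k) c s t ⟩
  c * (ψ k * s + t)        ∎
  where
  s t : ℚ
  s = sumInc (λ w → h (false ∷ w)) v
  t = sumRem ψ (λ w → h (true ∷ w)) v
  l : ∀ a c s t → a * (c * s) + c * t ≡ c * (a * s + t)
  l = solve-∀ ℚ-ring

sumRem-linear : ∀ {k} α β γ (ψ ψ′ : ℕ → ℚ) (h : Vec Bool k → ℚ) v →
  sumRem (λ b → α + β * ψ b + γ * ψ′ b) h v ≡ α * sumRem (λ _ → 1ℚ) h v + β * sumRem ψ h v + γ * sumRem ψ′ h v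
sumRem-linear α β γ ψ ψ′ h [] = l α β γ
  where
  l : ∀ α β γ → 0ℚ ≡ α * 0ℚ + β * 0ℚ + γ * 0ℚ
  l = solve-∀ ℚ-ring
sumRem-linear α β γ ψ ψ′ h (false ∷ v) = sumRem-linear α β γ ψ ψ′ _ v
sumRem-linear {suc k} α β γ ψ ψ′ h (true ∷ v) = begin
  _ ≡⟨ cong ((α + β * ψ k + γ * ψ′ k) * sumInc (λ w → h (false ∷ w)) v +_) (sumRem-linear α β γ ψ ψ′ _ v) ⟩
  _ ≡⟨ l α β γ (ψ k) (ψ′ k) (sumInc (λ w → h (false ∷ w)) v) (sumRem (λ _ → 1ℚ) (λ w → h (true ∷ w)) v) (sumRem ψ (λ w → h (true ∷ w)) v) (sumRem ψ′ (λ w → h (true ∷ w)) v) ⟩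
  _ ∎
  where
  l : ∀ α β γ a b i r s t → (α + β * a + γ * b) * i + (α * r + β * s + γ * t) ≡ α * (1ℚ * i + r) + β * (a * i + s) + γ * (b * i + t)
  l = solve-∀ ℚ-ring

-- The vanishing of a part 1 fits the general rule because `p (suc y) 0` is 1.
sumInc-P : ∀ {k} y (h : Vec Bool k → ℚ) v → sumInc (λ w → P (suc y) w * h w) v ≡ p (suc y) k * P (suc y) v * sumInc h v
sumInc-P y h [] = begin
  1ℚ * h []                    ≡⟨ cong (_* h []) eq ⟨
  p (suc y) 0 * 1ℚ * h []      ∎
  where
  eq : p (suc y) 0 * 1ℚ ≡ 1ℚ
  eq = begin
    (1ℚ + ι y - 0ℚ) * inv (1ℚ + ι y + 0ℚ) * 1ℚ  ≡⟨ *-identityʳ _ ⟩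
    (1ℚ + ι y + 0ℚ) * inv (1ℚ + ι y + 0ℚ)       ≡⟨ *-inv (λ eq → ι-suc≢0 y (trans (sym (+-identityʳ _)) eq)) ⟩
    1ℚ ∎
sumInc-P y h (false ∷ v) = refl
sumInc-P {suc k} y h (true ∷ v)  = sym (*-zeroʳ (p (suc y) (suc k) * P (suc y) (true ∷ v)))

-- A removal alters a single factor of `P (suc y)`, by a ratio `ρ y b`. As all parts are at most y,
-- no denominator `tri y - tri b` vanishes.
sumRem-P : ∀ {k} y → k ℕ.≤ y → ∀ ψ (h : Vec Bool k → ℚ) v →
  sumRem ψ (λ w → P (suc y) w * h w) v ≡ P (suc y) v * sumRem (λ b → ψ b * ρ y b) h v
sumRem-P y k≤y ψ h []          = refl
sumRem-P y k≤y ψ h (false ∷ v) = sumRem-P y (ℕ.<⇒≤ k≤y) ψ _ v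
sumRem-P {suc k} y k≤y ψ h (true ∷ v)  = begin
  ψ k * sumInc (λ w → P (suc y) w * h (false ∷ w)) v + sumRem ψ (λ w → q * P (suc y) w * h (true ∷ w)) v
    ≡⟨ cong₂ (λ s t → ψ k * s + t) (sumInc-P y _ v) (sumRem-cong v (λ _ _ → refl) (λ w _ → *-assoc q _ _)) ⟩
  ψ k * (p (suc y) k * P (suc y) v * i) + sumRem ψ (λ w → q * (P (suc y) w * h (true ∷ w))) v
    ≡⟨ cong (ψ k * (p (suc y) k * P (suc y) v * i) +_) (trans (sumRem-*ˡ ψ q _ v) (cong (q *_) (sumRem-P y (ℕ.<⇒≤ k≤y) ψ _ v))) ⟩
  ψ k * (p (suc y) k * P (suc y) v * i) + q * (P (suc y) v * r)
    ≡⟨ cong (λ z → ψ k * (z * P (suc y) v * i) + q * (P (suc y) v * r)) (p-shift k≤y) ⟩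
  ψ k * (ρ y k * q * P (suc y) v * i) + q * (P (suc y) v * r)
    ≡⟨ l (ψ k) (ρ y k) q (P (suc y) v) i r ⟩
  q * P (suc y) v * (ψ k * ρ y k * i + r) ∎
  where
  q i r : ℚ
  q = p (suc y) (suc k)
  i = sumInc (λ w → h (false ∷ w)) v
  r = sumRem (λ b → ψ b * ρ y b) (λ w → h (true ∷ w)) v
  l : ∀ a b q P i r → a * (b * q * P * i) + q * (P * r) ≡ q * P * (a * b * i + r)
  l = solve-∀ ℚ-ring

p-diag : ∀ a → p a a ≡ 0ℚ
p-diag a = trans (cong (_* inv (ι a + ι a)) (+-inverseʳ (ι a))) (*-zeroˡ (inv (ι a + ι a)))

-- The collision of two parts k is covered by the product itself, through its factor `p k k`, which
-- is 0.
sumInc-H : ∀ {k} (v : Vec Bool k) → sumInc H v ≡ H v * P k v * 1/! k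
sumInc-H []          = refl
sumInc-H (false ∷ v) = refl
sumInc-H {suc k} (true ∷ v) = begin
  0ℚ                                               ≡⟨ l (H (true ∷ v)) (P (suc k) v) (1/! (suc k)) ⟨
  H (true ∷ v) * (0ℚ * P (suc k) v) * 1/! (suc k)  ≡⟨ cong (λ z → H (true ∷ v) * (z * P (suc k) v) * 1/! (suc k)) (p-diag (suc k)) ⟨
  H (true ∷ v) * (p (suc k) (suc k) * P (suc k) v) * 1/! (suc k) ∎
  where
  l : ∀ a b c → a * (0ℚ * b) * c ≡ 0ℚ
  l = solve-∀ ℚ-ring

1/!-suc : ∀ n → 1/! n ≡ ι (suc n) * 1/! (suc n)
1/!-suc n = begin
  1/! n                                  ≡⟨ *-identityˡ _ ⟨
  1ℚ * 1/! n                             ≡⟨ cong (_* 1/! n) (*-inv (ι-suc≢0 n)) ⟨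
  ι (suc n) * inv (ι (suc n)) * 1/! n    ≡⟨ *-assoc (ι (suc n)) (inv (ι (suc n))) (1/! n) ⟩
  ι (suc n) * (inv (ι (suc n)) * 1/! n)  ∎

-- The box comes either from the largest part, k + 1, or from a part of v; a removal of the second
-- kind multiplies `P (suc k)` by a value of `ρ k`.
sumRem-H-true : ∀ {k} ψ (v : Vec Bool k) →
  sumRem ψ H (true ∷ v) ≡ 1/! (suc k) * (ψ k * ι (suc k) * H v * P k v + P (suc k) v * sumRem (λ b → ψ b * ρ k b) H v)
sumRem-H-true {k} ψ v = begin
  ψ k * sumInc H v + sumRem ψ (λ w → H w * P (suc k) w * f) v
    ≡⟨ cong₂ (λ s t → ψ k * s + t) (sumInc-H v) (sumRem-cong v (λ _ _ → refl) (λ w _ → l₁ (H w) (P (suc k) w) f)) ⟩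
  ψ k * (H v * P k v * 1/! k) + sumRem ψ (λ w → f * (P (suc k) w * H w)) v
    ≡⟨ cong₂ (λ s t → ψ k * (H v * P k v * s) + t) (1/!-suc k) (trans (sumRem-*ˡ ψ f _ v) (cong (f *_) (sumRem-P k ℕ.≤-refl ψ H v))) ⟩
  ψ k * (H v * P k v * (ι (suc k) * f)) + f * (P (suc k) v * r)
    ≡⟨ l₂ (ψ k) (H v) (P k v) (ι (suc k)) f (P (suc k) v) r ⟩
  f * (ψ k * ι (suc k) * H v * P k v + P (suc k) v * r) ∎
  where
  f r : ℚ
  f = 1/! (suc k)
  r = sumRem (λ b → ψ b * ρ k b) H v
  l₁ : ∀ h q f → h * q * f ≡ f * (q * h)
  l₁ = solve-∀ ℚ-ring
  l₂ : ∀ a h q s f t r → a * (h * q * (s * f)) + f * (t * r) ≡ f * (a * s * h * q + t * r)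
  l₂ = solve-∀ ℚ-ring

-- The partial fraction expansion of ∏ (z − tri ν) / (z − tri (ν − 1)), over the parts ν of v, at
-- z = tri y; sumRem-1 is its coefficient of 1/z at infinity. Adding a part multiplies the weights
-- by another ρ, and ρ-* makes the product linear in the two ρ's.
sumRem-ρ : ∀ {k} y → k ℕ.≤ y → (v : Vec Bool k) →
  P (suc y) v * sumRem (ρ y) H v ≡ H v * ((ι (suc y) + ι (weight v)) * P (suc y) v - ι (suc y) * P y v)
sumRem-1 : ∀ {k} (v : Vec Bool k) → sumRem (λ _ → 1ℚ) H v ≡ ι (weight v) * H v

sumRem-1 []          = refl
sumRem-1 (false ∷ v) = sumRem-1 v
sumRem-1 {suc k} (true ∷ v)  = begin
  sumRem (λ _ → 1ℚ) H (true ∷ v)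
    ≡⟨ sumRem-H-true (λ _ → 1ℚ) v ⟩
  f * (1ℚ * ι (suc k) * H v * P k v + P (suc k) v * sumRem (λ b → 1ℚ * ρ k b) H v)
    ≡⟨ cong (λ z → f * (1ℚ * ι (suc k) * H v * P k v + P (suc k) v * z)) (sumRem-cong v (λ b _ → *-identityˡ (ρ k b)) (λ _ _ → refl)) ⟩
  f * (1ℚ * ι (suc k) * H v * P k v + P (suc k) v * sumRem (ρ k) H v)
    ≡⟨ cong (λ z → f * (1ℚ * ι (suc k) * H v * P k v + z)) (sumRem-ρ k ℕ.≤-refl v) ⟩
  -- The boundary term of `sumRem-ρ` at y = k cancels the contribution of the largest part.
  f * (1ℚ * ι (suc k) * H v * P k v + H v * ((ι (suc k) + ι (weight v)) * P (suc k) v - ι (suc k) * P k v))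
    ≡⟨ l f (ι (suc k)) (H v) (P k v) (ι (weight v)) (P (suc k) v) ⟩
  (ι (suc k) + ι (weight v)) * (H v * P (suc k) v * f)
    ≡⟨ cong (_* (H v * P (suc k) v * f)) (ι-+ (suc k) (weight v)) ⟨
  ι (weight (true ∷ v)) * H (true ∷ v) ∎
  where
  f : ℚ
  f = 1/! (suc k)
  l : ∀ f a h q n t → f * (1ℚ * a * h * q + h * ((a + n) * t - a * q)) ≡ (a + n) * (h * t * f)
  l = solve-∀ ℚ-ring

sumRem-ρ y k≤y [] = l (ι (suc y))
  where
  l : ∀ x → 1ℚ * 0ℚ ≡ 1ℚ * ((x + 0ℚ) * 1ℚ - x * 1ℚ)
  l = solve-∀ ℚ-ring
sumRem-ρ y k≤y (false ∷ v) = sumRem-ρ y (ℕ.<⇒≤ k≤y) v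
sumRem-ρ {suc k} y k<y (true ∷ v) = begin
  q * Px * sumRem (ρ y) H (true ∷ v)
    ≡⟨ cong (q * Px *_) (sumRem-H-true (ρ y) v) ⟩
  q * Px * (f * (γ k<y * a * h * Pa₁ + Pa * sumRem (λ b → ρ y b * ρ k b) H v))
    ≡⟨ cong (λ z → q * Px * (f * (γ k<y * a * h * Pa₁ + Pa * z))) (trans (sumRem-cong v (λ b b<k → ρ-* k<y b<k) (λ _ _ → refl)) (sumRem-linear (1ℚ - β k<y - γ k<y) (β k<y) (γ k<y) (ρ y) (ρ k) H v)) ⟩
  -- The three sums over v have the weights 1, `ρ y` and `ρ k`, all known for the shorter vector.
  q * Px * (f * (γ k<y * a * h * Pa₁ + Pa * ((1ℚ - β k<y - γ k<y) * sumRem (λ _ → 1ℚ) H v + β k<y * Sx + γ k<y * Sa)))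
    ≡⟨ cong (λ z → q * Px * (f * (γ k<y * a * h * Pa₁ + Pa * ((1ℚ - β k<y - γ k<y) * z + β k<y * Sx + γ k<y * Sa)))) (sumRem-1 v) ⟩
  q * Px * (f * (γ k<y * a * h * Pa₁ + Pa * ((1ℚ - β k<y - γ k<y) * (N * h) + β k<y * Sx + γ k<y * Sa)))
    ≡⟨ l₁ q Px f (γ k<y) a h Pa₁ Pa (β k<y) N Sx Sa ⟩
  q * f * (γ k<y * a * h * Pa₁ * Px + (1ℚ - β k<y - γ k<y) * N * h * Pa * Px + β k<y * Pa * (Px * Sx) + γ k<y * Px * (Pa * Sa))
    ≡⟨ cong₂ (λ s t → q * f * (γ k<y * a * h * Pa₁ * Px + (1ℚ - β k<y - γ k<y) * N * h * Pa * Px + β k<y * Pa * s + γ k<y * Px * t))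
         (sumRem-ρ y (ℕ.<⇒≤ k<y) v) (sumRem-ρ k ℕ.≤-refl v) ⟩
  q * f * (γ k<y * a * h * Pa₁ * Px + (1ℚ - β k<y - γ k<y) * N * h * Pa * Px + β k<y * Pa * (h * ((x + N) * Px - x * Py)) + γ k<y * Px * (h * ((a + N) * Pa - a * Pa₁)))
    ≡⟨ l₂ q Px f (γ k<y) a h Pa₁ Pa (β k<y) N x Py ⟩
  h * Pa * f * (((β k<y * x + γ k<y * a) + N) * (q * Px) - x * (β k<y * q * Py))
    -- The coefficients absorb the new part: βx + γa = x + a enlarges the weight, and β turns q into
    -- the factor that enlarges `P y`.
    ≡⟨ cong₂ (λ s t → h * Pa * f * ((s + N) * (q * Px) - x * (t * Py))) (βx+γa k<y) (β-p k<y) ⟩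
  h * Pa * f * ((x + a + N) * (q * Px) - x * (p y (suc k) * Py))
    ≡⟨ cong (λ z → h * Pa * f * (z * (q * Px) - x * (p y (suc k) * Py))) (trans (+-assoc x a N) (cong (x +_) (sym (ι-+ (suc k) (weight v))))) ⟩
  h * Pa * f * ((x + ι (weight (true ∷ v))) * (q * Px) - x * (p y (suc k) * Py)) ∎
  where
  q Px Py Pa Pa₁ f h a x N Sx Sa : ℚ
  q = p (suc y) (suc k)
  Px = P (suc y) v
  Py = P y v
  Pa = P (suc k) v
  Pa₁ = P k v
  f = 1/! (suc k)
  h = H v
  a = ι (suc k)
  x = ι (suc y)
  N = ι (weight v)
  Sx = sumRem (ρ y) H v
  Sa = sumRem (ρ k) H v
  l₁ : ∀ q Px f γ a h Pa₁ Pa β N Sx Sa → q * Px * (f * (γ * a * h * Pa₁ + Pa * ((1ℚ - β - γ) * (N * h) + β * Sx + γ * Sa))) ≡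
    q * f * (γ * a * h * Pa₁ * Px + (1ℚ - β - γ) * N * h * Pa * Px + β * Pa * (Px * Sx) + γ * Px * (Pa * Sa))
  l₁ = solve-∀ ℚ-ring
  l₂ : ∀ q Px f γ a h Pa₁ Pa β N x Py →
    q * f * (γ * a * h * Pa₁ * Px + (1ℚ - β - γ) * N * h * Pa * Px + β * Pa * (h * ((x + N) * Px - x * Py)) + γ * Px * (h * ((a + N) * Pa - a * Pa₁))) ≡
    h * Pa * f * (((β * x + γ * a) + N) * (q * Px) - x * (β * q * Py))
  l₂ = solve-∀ ℚ-ring

sumRem₁ : ∀ {k} → (Vec Bool k → ℚ) → Vec Bool k → ℚ
sumRem₁ = sumRem (λ _ → 1ℚ)

sumRem₁-cong : ∀ {k} {h h′ : Vec Bool k → ℚ} v → (∀ w → suc (weight w) ≡ weight v → h w ≡ h′ w) → sumRem₁ h v ≡ sumRem₁ h′ v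
sumRem₁-cong v = sumRem-cong v (λ _ _ → refl)

sumRem₁-zero : ∀ {k} (h : Vec Bool k → ℚ) v → weight v ≡ 0 → sumRem₁ h v ≡ 0ℚ
sumRem₁-zero h v |v|≡0 = begin
  sumRem₁ h v                ≡⟨ sumRem₁-cong v (λ w eq → absurd (trans eq |v|≡0)) ⟩
  sumRem₁ (λ w → 0ℚ * h w) v ≡⟨ sumRem-*ˡ _ 0ℚ h v ⟩
  0ℚ * sumRem₁ h v           ≡⟨ *-zeroˡ (sumRem₁ h v) ⟩
  0ℚ                         ∎
  where
  absurd : ∀ {n} {A : Set} → suc n ≡ 0 → A
  absurd ()

-- Removals lower the weight, so the recursion determines its solution.
sumRem₁-unique : ∀ {k} (g f f′ : Vec Bool k → ℚ) → (∀ v → f v ≡ g v + sumRem₁ f v) → (∀ v → f′ v ≡ g v + sumRem₁ f′ v) → ∀ v → f v ≡ f′ v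
sumRem₁-unique g f f′ rec rec′ v = go (weight v) v refl
  where
  go : ∀ n v → weight v ≡ n → f v ≡ f′ v
  go zero    v |v|≡n = begin
    f v                  ≡⟨ rec v ⟩
    g v + sumRem₁ f v    ≡⟨ cong (g v +_) (trans (sumRem₁-zero f v |v|≡n) (sym (sumRem₁-zero f′ v |v|≡n))) ⟩
    g v + sumRem₁ f′ v   ≡⟨ rec′ v ⟨
    f′ v                 ∎
  go (suc n) v |v|≡n = begin
    f v                  ≡⟨ rec v ⟩
    g v + sumRem₁ f v    ≡⟨ cong (g v +_) (sumRem₁-cong v (λ w eq → go n w (ℕ.suc-injective (trans eq |v|≡n)))) ⟩
    g v + sumRem₁ f′ v   ≡⟨ rec′ v ⟨
    f′ v                 ∎

-- The number of shifted tableaux of shape v, since by `F-rec` it obeys the recursion by the box of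
-- the largest entry.
F : ∀ {k} → Vec Bool k → ℚ
F v = ι (weight v !) * H v

𝟙-empty : ∀ {k} → Vec Bool k → ℚ
𝟙-empty []          = 1ℚ
𝟙-empty (false ∷ v) = 𝟙-empty v
𝟙-empty (true ∷ v)  = 0ℚ

𝟙-empty-suc : ∀ {k n} (v : Vec Bool k) → weight v ≡ suc n → 𝟙-empty v ≡ 0ℚ
𝟙-empty-suc (false ∷ v) eq = 𝟙-empty-suc v eq
𝟙-empty-suc (true ∷ v)  eq = refl

𝟙-empty-zero : ∀ {k} (v : Vec Bool k) → weight v ≡ 0 → 𝟙-empty v ≡ 1ℚ
𝟙-empty-zero []          eq = refl
𝟙-empty-zero (false ∷ v) eq = 𝟙-empty-zero v eq

F-rec : ∀ {k} (v : Vec Bool k) → F v ≡ 𝟙-empty v + sumRem₁ F v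
F-rec v = go (weight v) refl
  where
  H-empty : ∀ {k} (v : Vec Bool k) → weight v ≡ 0 → H v ≡ 𝟙-empty v
  H-empty []          eq = refl
  H-empty (false ∷ v) eq = H-empty v eq
  l : ∀ a b c → a * b * c ≡ 0ℚ + b * (a * c)
  l = solve-∀ ℚ-ring
  go : ∀ n → weight v ≡ n → F v ≡ 𝟙-empty v + sumRem₁ F v
  go zero    eq = begin
    ι (weight v !) * H v      ≡⟨ cong₂ (λ m h → ι (m !) * h) eq (H-empty v eq) ⟩
    1ℚ * 𝟙-empty v            ≡⟨ *-identityˡ (𝟙-empty v) ⟩
    𝟙-empty v                 ≡⟨ +-identityʳ (𝟙-empty v) ⟨
    𝟙-empty v + 0ℚ            ≡⟨ cong (𝟙-empty v +_) (sumRem₁-zero F v eq) ⟨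
    𝟙-empty v + sumRem₁ F v   ∎
  go (suc n) eq = begin
    ι (weight v !) * H v               ≡⟨ cong (λ m → ι (m !) * H v) eq ⟩
    ι (suc n ℕ.* n !) * H v            ≡⟨ cong (_* H v) (ι-* (suc n) (n !)) ⟩
    ι (suc n) * ι (n !) * H v          ≡⟨ l (ι (suc n)) (ι (n !)) (H v) ⟩
    0ℚ + ι (n !) * (ι (suc n) * H v)   ≡⟨ cong₂ (λ e m → e + ι (n !) * (ι m * H v)) (𝟙-empty-suc v eq) eq ⟨
    𝟙-empty v + ι (n !) * (ι (weight v) * H v) ≡⟨ cong (λ z → 𝟙-empty v + ι (n !) * z) (sumRem-1 v) ⟨
    𝟙-empty v + ι (n !) * sumRem₁ H v   ≡⟨ cong (𝟙-empty v +_) (sumRem-*ˡ _ (ι (n !)) H v) ⟨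
    𝟙-empty v + sumRem₁ (λ w → ι (n !) * H w) v ≡⟨ cong (𝟙-empty v +_) (sumRem₁-cong v (λ w e → cong (λ m → ι (m !) * H w) (ℕ.suc-injective (trans (sym eq) (sym e))))) ⟩
    𝟙-empty v + sumRem₁ F v             ∎

-- Summation by parts over strict partitions, and the cut at the pivot

∑ : ∀ {k} → (Vec Bool k → ℚ) → ℚ
∑ {zero}  h = h []
∑ {suc k} h = ∑ (λ v → h (false ∷ v)) + ∑ (λ v → h (true ∷ v))

∑-cong : ∀ {k} {h h′ : Vec Bool k → ℚ} → (∀ v → h v ≡ h′ v) → ∑ h ≡ ∑ h′
∑-cong {zero}  eq = eq []
∑-cong {suc k} eq = cong₂ _+_ (∑-cong (λ v → eq (false ∷ v))) (∑-cong (λ v → eq (true ∷ v)))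

∑-+ : ∀ {k} (h h′ : Vec Bool k → ℚ) → ∑ (λ v → h v + h′ v) ≡ ∑ h + ∑ h′
∑-+ {zero}  h h′ = refl
∑-+ {suc k} h h′ = trans (cong₂ _+_ (∑-+ (h ∘ (false ∷_)) (h′ ∘ (false ∷_))) (∑-+ (h ∘ (true ∷_)) (h′ ∘ (true ∷_))))
  (l (∑ (h ∘ (false ∷_))) (∑ (h′ ∘ (false ∷_))) (∑ (h ∘ (true ∷_))) (∑ (h′ ∘ (true ∷_))))
  where
  l : ∀ a b c d → (a + b) + (c + d) ≡ (a + c) + (b + d)
  l = solve-∀ ℚ-ring

∑-*ˡ : ∀ {k} c (h : Vec Bool k → ℚ) → ∑ (λ v → c * h v) ≡ c * ∑ h
∑-*ˡ {zero}  c h = refl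
∑-*ˡ {suc k} c h = trans (cong₂ _+_ (∑-*ˡ c (h ∘ (false ∷_))) (∑-*ˡ c (h ∘ (true ∷_))))
  (sym (*-distribˡ-+ c (∑ (h ∘ (false ∷_))) (∑ (h ∘ (true ∷_)))))

∑-zero : ∀ {k} (h : Vec Bool k → ℚ) → (∀ v → h v ≡ 0ℚ) → ∑ h ≡ 0ℚ
∑-zero {zero}  h eq = eq []
∑-zero {suc k} h eq = cong₂ _+_ (∑-zero _ (λ v → eq (false ∷ v))) (∑-zero _ (λ v → eq (true ∷ v)))

∑-𝟙-empty : ∀ {k} (h : Vec Bool k → ℚ) → ∑ (λ v → 𝟙-empty v * h v) ≡ h (replicate k false)
∑-𝟙-empty {zero}  h = *-identityˡ (h [])
∑-𝟙-empty {suc k} h = trans (cong₂ _+_ (∑-𝟙-empty (h ∘ (false ∷_))) (∑-zero {k} _ (λ v → *-zeroˡ (h (true ∷ v))))) (+-identityʳ (h (replicate (suc k) false)))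

comp : ∀ {k} → Vec Bool k → Vec Bool k
comp = map not

∑-𝟙-full : ∀ {k} (h : Vec Bool k → ℚ) → ∑ (λ v → 𝟙-empty (comp v) * h v) ≡ h (replicate k true)
∑-𝟙-full {zero}  h = *-identityˡ (h [])
∑-𝟙-full {suc k} h = trans (cong₂ _+_ (∑-zero {k} _ (λ v → *-zeroˡ (h (false ∷ v)))) (∑-𝟙-full (h ∘ (true ∷_)))) (+-identityˡ (h (replicate (suc k) true)))

sumDec : ∀ {k} → (Vec Bool k → ℚ) → Vec Bool k → ℚ
sumDec h []          = h []
sumDec h (false ∷ v) = 0ℚ
sumDec h (true ∷ v)  = h (false ∷ v)

-- The adjoint of `sumRem₁` under `∑`: boxes are added. The factor `1ℚ` mirrors the constant weight
-- there, so that complementation matches the two term by term.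
sumAdd : ∀ {k} → (Vec Bool k → ℚ) → Vec Bool k → ℚ
sumAdd h []          = 0ℚ
sumAdd h (false ∷ v) = 1ℚ * sumDec (λ w → h (true ∷ w)) v + sumAdd (λ w → h (false ∷ w)) v
sumAdd h (true ∷ v)  = sumAdd (λ w → h (true ∷ w)) v

sumDec-comp : ∀ {k} (h : Vec Bool k → ℚ) v → sumDec (h ∘ comp) v ≡ sumInc h (comp v)
sumDec-comp h []          = refl
sumDec-comp h (false ∷ v) = refl
sumDec-comp h (true ∷ v)  = refl

-- Raising a part b to b + 1 in v is lowering b + 1 to b in the complement.
sumAdd-comp : ∀ {k} (h : Vec Bool k → ℚ) v → sumAdd (h ∘ comp) v ≡ sumRem₁ h (comp v)
sumAdd-comp h []          = refl
sumAdd-comp h (false ∷ v) = cong₂ (λ s t → 1ℚ * s + t) (sumDec-comp _ v) (sumAdd-comp (h ∘ (true ∷_)) v)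
sumAdd-comp h (true ∷ v)  = sumAdd-comp (h ∘ (false ∷_)) v

sumInc-adjoint : ∀ {k} (f h : Vec Bool k → ℚ) → ∑ (λ v → f v * sumInc h v) ≡ ∑ (λ v → sumDec f v * h v)
sumInc-adjoint {zero}  f h = refl
sumInc-adjoint {suc k} f h = begin
  S + ∑ (λ v → f (true ∷ v) * 0ℚ)   ≡⟨ cong (S +_) (∑-zero {k} _ (λ v → *-zeroʳ (f (true ∷ v)))) ⟩
  S + 0ℚ                            ≡⟨ +-comm S 0ℚ ⟩
  0ℚ + S                            ≡⟨ cong (_+ S) (∑-zero {k} _ (λ v → *-zeroˡ (h (false ∷ v)))) ⟨
  ∑ (λ v → 0ℚ * h (false ∷ v)) + S  ∎
  where
  S : ℚ
  S = ∑ (λ v → f (false ∷ v) * h (true ∷ v))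

sumRem-adjoint : ∀ {k} (f h : Vec Bool k → ℚ) → ∑ (λ v → f v * sumRem₁ h v) ≡ ∑ (λ v → sumAdd f v * h v)
sumRem-adjoint {zero}  f h = trans (*-zeroʳ (f [])) (sym (*-zeroˡ (h [])))
sumRem-adjoint {suc k} f h = begin
  ∑ (λ v → f₀ v * sumRem₁ h₀ v) + ∑ (λ v → f₁ v * (1ℚ * sumInc h₀ v + sumRem₁ h₁ v))
    ≡⟨ cong₂ _+_ (sumRem-adjoint f₀ h₀) (trans (∑-cong (λ v → l₁ (f₁ v) (sumInc h₀ v) (sumRem₁ h₁ v))) (∑-+ (λ v → f₁ v * sumInc h₀ v) (λ v → f₁ v * sumRem₁ h₁ v))) ⟩
  ∑ (λ v → sumAdd f₀ v * h₀ v) + (∑ (λ v → f₁ v * sumInc h₀ v) + ∑ (λ v → f₁ v * sumRem₁ h₁ v))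
    ≡⟨ cong₂ (λ s t → ∑ (λ v → sumAdd f₀ v * h₀ v) + (s + t)) (sumInc-adjoint f₁ h₀) (sumRem-adjoint f₁ h₁) ⟩
  ∑ (λ v → sumAdd f₀ v * h₀ v) + (∑ (λ v → sumDec f₁ v * h₀ v) + ∑ (λ v → sumAdd f₁ v * h₁ v))
    ≡⟨ l₂ (∑ (λ v → sumAdd f₀ v * h₀ v)) (∑ (λ v → sumDec f₁ v * h₀ v)) (∑ (λ v → sumAdd f₁ v * h₁ v)) ⟩
  (∑ (λ v → sumDec f₁ v * h₀ v) + ∑ (λ v → sumAdd f₀ v * h₀ v)) + ∑ (λ v → sumAdd f₁ v * h₁ v)
    ≡⟨ cong (_+ ∑ (λ v → sumAdd f₁ v * h₁ v)) (trans (∑-cong (λ v → l₃ (sumDec f₁ v) (sumAdd f₀ v) (h₀ v))) (∑-+ (λ v → sumDec f₁ v * h₀ v) (λ v → sumAdd f₀ v * h₀ v))) ⟨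
  ∑ (λ v → (1ℚ * sumDec f₁ v + sumAdd f₀ v) * h₀ v) + ∑ (λ v → sumAdd f₁ v * h₁ v) ∎
  where
  f₀ f₁ h₀ h₁ : Vec Bool k → ℚ
  f₀ = f ∘ (false ∷_)
  f₁ = f ∘ (true ∷_)
  h₀ = h ∘ (false ∷_)
  h₁ = h ∘ (true ∷_)
  l₁ : ∀ a b c → a * (1ℚ * b + c) ≡ a * b + a * c
  l₁ = solve-∀ ℚ-ring
  l₂ : ∀ a b c → a + (b + c) ≡ (b + a) + c
  l₂ = solve-∀ ℚ-ring
  l₃ : ∀ a b c → (1ℚ * a + b) * c ≡ a * c + b * c
  l₃ = solve-∀ ℚ-ring

comp-replicate : ∀ k b → comp (replicate k b) ≡ replicate k (not b)
comp-replicate zero    b = refl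
comp-replicate (suc k) b = cong (not b ∷_) (comp-replicate k b)

-- Summation by parts.
green : ∀ {k} (s f t q : Vec Bool k → ℚ) → (∀ v → f v ≡ s v + sumRem₁ f v) → (∀ v → q v ≡ t v + sumAdd q v) →
  ∑ (λ v → s v * q v) ≡ ∑ (λ v → f v * t v)
green s f t q f-rec q-rec = cancel (begin
  ∑ (λ v → s v * q v) + X                              ≡⟨ cong (∑ (λ v → s v * q v) +_) (sumRem-adjoint q f) ⟨
  ∑ (λ v → s v * q v) + ∑ (λ v → q v * sumRem₁ f v)    ≡⟨ ∑-+ (λ v → s v * q v) (λ v → q v * sumRem₁ f v) ⟨
  ∑ (λ v → s v * q v + q v * sumRem₁ f v)              ≡⟨ ∑-cong (λ v → trans (l₁ (s v) (q v) (sumRem₁ f v)) (cong (_* q v) (sym (f-rec v)))) ⟩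
  -- The lines above expand f, the lines below expand q; the sum over pairs differing by one box is
  -- common to both.
  ∑ (λ v → f v * q v)                                  ≡⟨ ∑-cong (λ v → trans (cong (f v *_) (q-rec v)) (l₂ (f v) (t v) (sumAdd q v))) ⟩
  ∑ (λ v → f v * t v + sumAdd q v * f v)               ≡⟨ ∑-+ (λ v → f v * t v) (λ v → sumAdd q v * f v) ⟩
  ∑ (λ v → f v * t v) + X                              ∎)
  where
  X : ℚ
  X = ∑ (λ v → sumAdd q v * f v)
  l₁ : ∀ a b c → a * b + b * c ≡ (a + c) * b
  l₁ = solve-∀ ℚ-ring
  l₂ : ∀ a b c → a * (b + c) ≡ a * b + c * a
  l₂ = solve-∀ ℚ-ring
  l₃ : ∀ a x → a + x - x ≡ a
  l₃ = solve-∀ ℚ-ring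
  cancel : ∀ {a b} → a + X ≡ b + X → a ≡ b
  cancel {a} {b} eq = trans (sym (l₃ a X)) (trans (cong (_- X) eq) (l₃ b X))

Fᶜ-rec : ∀ {k} (v : Vec Bool k) → F (comp v) ≡ 𝟙-empty (comp v) + sumAdd (F ∘ comp) v
Fᶜ-rec v = trans (F-rec (comp v)) (cong (𝟙-empty (comp v) +_) (sym (sumAdd-comp F v)))

-- F v * F (comp v) counts the tableaux of staircase shape whose |v| smallest entries fill v,
-- so for each fixed value of |v| the summands add up to F of the staircase.
∑-telescope : ∀ k (W : ℕ → ℚ) →
  ∑ {k} (λ v → F v * F (comp v) * (W (suc (weight v)) - W (weight v))) ≡ F (replicate k true) * (W (suc (weight (replicate k true))) - W 0)
∑-telescope k W = begin
  ∑ (λ v → F v * Fᶜ v * (W (suc (weight v)) - W (weight v)))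
    ≡⟨ ∑-cong (λ v → l₁ (F v) (Fᶜ v) (W (suc (weight v))) (W (weight v))) ⟩
  ∑ (λ v → B v + (- 1ℚ) * A v)
    ≡⟨ trans (∑-+ B (λ v → (- 1ℚ) * A v)) (cong (∑ B +_) (∑-*ˡ (- 1ℚ) A)) ⟩
  ∑ B + (- 1ℚ) * ∑ A
    ≡⟨ cong (λ z → ∑ B + (- 1ℚ) * z) ∑A ⟩
  ∑ B + (- 1ℚ) * (W 0 * F full + X)
    ≡⟨ cong (λ z → z + (- 1ℚ) * (W 0 * F full + X)) ∑B ⟩
  (W (suc (weight full)) * F full + X) + (- 1ℚ) * (W 0 * F full + X)
    ≡⟨ l₂ (W (suc (weight full))) (W 0) (F full) X ⟩
  F full * (W (suc (weight full)) - W 0) ∎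
  where
  Fᶜ A B : Vec Bool k → ℚ
  Fᶜ v = F (comp v)
  A v = F v * Fᶜ v * W (weight v)
  B v = F v * Fᶜ v * W (suc (weight v))
  full : Vec Bool k
  full = replicate k true
  -- The sum over pairs of shapes differing by one box, with W at the larger size. `A` reaches it by
  -- expanding F, `B` by expanding `Fᶜ`.
  X : ℚ
  X = ∑ (λ v → sumAdd Fᶜ v * (W (suc (weight v)) * F v))
  l₁ : ∀ f g a b → f * g * (a - b) ≡ f * g * a + (- 1ℚ) * (f * g * b)
  l₁ = solve-∀ ℚ-ring
  l₂ : ∀ a b f x → (a * f + x) + (- 1ℚ) * (b * f + x) ≡ f * (a - b)
  l₂ = solve-∀ ℚ-ring
  l₃ : ∀ e s g w → (e + s) * g * w ≡ e * (w * g) + g * (w * s)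
  l₃ = solve-∀ ℚ-ring
  l₄ : ∀ f e s w → f * (e + s) * w ≡ e * (w * f) + s * (w * f)
  l₄ = solve-∀ ℚ-ring
  weight-empty : ∀ k → weight (replicate k false) ≡ 0
  weight-empty zero    = refl
  weight-empty (suc k) = weight-empty k
  shift : ∀ v → W (weight v) * sumRem₁ F v ≡ sumRem₁ (λ w → W (suc (weight w)) * F w) v
  shift v = trans (sym (sumRem-*ˡ _ (W (weight v)) F v)) (sumRem₁-cong v (λ w eq → cong (λ n → W n * F w) (sym eq)))
  ∑A : ∑ A ≡ W 0 * F full + X
  ∑A = begin
    ∑ A
      ≡⟨ ∑-cong (λ v → trans (cong (λ z → z * Fᶜ v * W (weight v)) (F-rec v)) (l₃ (𝟙-empty v) (sumRem₁ F v) (Fᶜ v) (W (weight v)))) ⟩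
    ∑ (λ v → 𝟙-empty v * (W (weight v) * Fᶜ v) + Fᶜ v * (W (weight v) * sumRem₁ F v))
      ≡⟨ ∑-+ (λ v → 𝟙-empty v * (W (weight v) * Fᶜ v)) (λ v → Fᶜ v * (W (weight v) * sumRem₁ F v)) ⟩
    ∑ (λ v → 𝟙-empty v * (W (weight v) * Fᶜ v)) + ∑ (λ v → Fᶜ v * (W (weight v) * sumRem₁ F v))
      ≡⟨ cong₂ _+_ (∑-𝟙-empty (λ v → W (weight v) * Fᶜ v)) (∑-cong (λ v → cong (Fᶜ v *_) (shift v))) ⟩
    W (weight (replicate k false)) * Fᶜ (replicate k false) + ∑ (λ v → Fᶜ v * sumRem₁ (λ w → W (suc (weight w)) * F w) v)
      ≡⟨ cong₂ _+_ (cong₂ (λ n v → W n * F v) (weight-empty k) (comp-replicate k false)) (sumRem-adjoint Fᶜ (λ w → W (suc (weight w)) * F w)) ⟩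
    W 0 * F full + X ∎
  ∑B : ∑ B ≡ W (suc (weight full)) * F full + X
  ∑B = begin
    ∑ B
      ≡⟨ ∑-cong (λ v → trans (cong (λ z → F v * z * W (suc (weight v))) (Fᶜ-rec v)) (l₄ (F v) (𝟙-empty (comp v)) (sumAdd Fᶜ v) (W (suc (weight v))))) ⟩
    ∑ {k} (λ v → 𝟙-empty (comp v) * (W (suc (weight v)) * F v) + sumAdd Fᶜ v * (W (suc (weight v)) * F v))
      ≡⟨ ∑-+ (λ v → 𝟙-empty (comp v) * (W (suc (weight v)) * F v)) (λ v → sumAdd Fᶜ v * (W (suc (weight v)) * F v)) ⟩
    ∑ {k} (λ v → 𝟙-empty (comp v) * (W (suc (weight v)) * F v)) + X
      ≡⟨ cong (_+ X) (∑-𝟙-full {k} (λ v → W (suc (weight v)) * F v)) ⟩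
    W (suc (weight full)) * F full + X ∎

-- Nₐ v counts the tableaux of the ideal (a , v) for n = m + 3. An ideal contains the pivot, the
-- box in row 2 and column n − 1, iff it is (2 , v) or (1 , true ∷ v). The other ideals are
-- ordinary shifted diagrams, and so are the complements of those containing the pivot once the
-- truncated corner is restored as the first box after the pivot.
module Pivot {m} (N₀ N₁ N₂ : Vec Bool (suc m) → ℚ)
  (N₀-rec : ∀ v → N₀ v ≡ 𝟙-empty v + sumRem₁ N₀ v)
  (N₁-rec : ∀ v → N₁ v ≡ sumInc N₀ v + sumRem₁ N₁ v)
  (N₂-rec : ∀ v → N₂ v ≡ sumInc N₁ v + sumRem₁ N₂ v) where

  -- Meant for the ideals (1 , false ∷ v), the shifted diagrams with first part n - 1; the part n -
  -- 2 would bring in the pivot.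
  pre : Vec Bool m → ℚ
  pre v = F (true ∷ false ∷ v)

  N₀≡F : ∀ v → N₀ v ≡ F v
  N₀≡F = sumRem₁-unique 𝟙-empty N₀ F N₀-rec F-rec

  pre-rec : ∀ v → pre v ≡ F (true ∷ v) + sumRem₁ pre v
  pre-rec v = trans (F-rec (true ∷ false ∷ v)) (l (F (true ∷ v)) (sumRem₁ pre v))
    where
    l : ∀ a b → 0ℚ + (1ℚ * a + b) ≡ a + b
    l = solve-∀ ℚ-ring

  N₁≡pre : ∀ v → N₁ (false ∷ v) ≡ pre v
  N₁≡pre = sumRem₁-unique (λ v → F (true ∷ v)) (λ v → N₁ (false ∷ v)) pre
    (λ v → trans (N₁-rec (false ∷ v)) (cong (_+ sumRem₁ (λ w → N₁ (false ∷ w)) v) (N₀≡F (true ∷ v)))) pre-rec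

  post : Vec Bool m → ℚ
  post v = N₁ (true ∷ v)

  -- In the ideal (1 , true ∷ v) the box on diagonal 0 is blocked. The first term removes the pivot,
  -- the second a box on a later diagonal.
  post-rec : ∀ v → post v ≡ sumInc pre v + sumRem₁ post v
  post-rec v = begin
    post v                                                              ≡⟨ N₁-rec (true ∷ v) ⟩
    0ℚ + (1ℚ * sumInc (λ w → N₁ (false ∷ w)) v + sumRem₁ post v)        ≡⟨ l (sumInc (λ w → N₁ (false ∷ w)) v) (sumRem₁ post v) ⟩
    sumInc (λ w → N₁ (false ∷ w)) v + sumRem₁ post v                    ≡⟨ cong (_+ sumRem₁ post v) (sumInc-cong v (λ w _ → N₁≡pre w)) ⟩
    sumInc pre v + sumRem₁ post v                                       ∎
    where
    l : ∀ a b → 0ℚ + (1ℚ * a + b) ≡ a + b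
    l = solve-∀ ℚ-ring

  preᶜ-rec : ∀ v → pre (comp v) ≡ F (comp (false ∷ v)) + sumAdd (pre ∘ comp) v
  preᶜ-rec v = trans (pre-rec (comp v)) (cong (F (true ∷ comp v) +_) (sym (sumAdd-comp pre v)))

  -- `green` first cuts each tableau where the second box of diagonal 0 enters, then moves the cut
  -- back to the pivot, after which `pre (comp v)` counts the completions.
  N₂-full : N₂ (replicate (suc m) true) ≡ ∑ (λ v → sumInc pre v * pre (comp v))
  N₂-full = begin
    N₂ (replicate (suc m) true)                          ≡⟨ ∑-𝟙-full N₂ ⟨
    ∑ (λ v → 𝟙-empty (comp v) * N₂ v)                    ≡⟨ ∑-cong (λ v → *-comm (𝟙-empty (comp v)) (N₂ v)) ⟩
    ∑ (λ v → N₂ v * 𝟙-empty (comp v))                    ≡⟨ green (sumInc N₁) N₂ (𝟙-empty ∘ comp) (F ∘ comp) N₂-rec Fᶜ-rec ⟨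
    ∑ (λ v → post v * F (comp (false ∷ v))) + ∑ {m} (λ v → 0ℚ * F (comp (true ∷ v)))  ≡⟨ cong (∑ (λ v → post v * F (comp (false ∷ v))) +_) (∑-zero {m} _ (λ v → *-zeroˡ (F (comp (true ∷ v))))) ⟩
    ∑ (λ v → post v * F (comp (false ∷ v))) + 0ℚ         ≡⟨ +-identityʳ (∑ (λ v → post v * F (comp (false ∷ v)))) ⟩
    ∑ (λ v → post v * F (comp (false ∷ v)))              ≡⟨ green (sumInc pre) post (λ v → F (comp (false ∷ v))) (pre ∘ comp) post-rec preᶜ-rec ⟨
    ∑ (λ v → sumInc pre v * pre (comp v))                ∎

-- Vandermonde convolution

∑< : ℕ → (ℕ → ℕ) → ℕ
∑< zero    f = 0
∑< (suc n) f = ∑< n f ℕ.+ f n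

∑<-cong : ∀ n {f h : ℕ → ℕ} → (∀ {i} → i ℕ.< n → f i ≡ h i) → ∑< n f ≡ ∑< n h
∑<-cong zero    eq = refl
∑<-cong (suc n) eq = cong₂ ℕ._+_ (∑<-cong n (λ i<n → eq (ℕ.m<n⇒m<1+n i<n))) (eq ℕ.≤-refl)

∑<-+ : ∀ n (f h : ℕ → ℕ) → ∑< n (λ i → f i ℕ.+ h i) ≡ ∑< n f ℕ.+ ∑< n h
∑<-+ zero    f h = refl
∑<-+ (suc n) f h = trans (cong (ℕ._+ (f n ℕ.+ h n)) (∑<-+ n f h)) (l (∑< n f) (∑< n h) (f n) (h n))
  where
  l : ∀ a b c d → a ℕ.+ b ℕ.+ (c ℕ.+ d) ≡ a ℕ.+ c ℕ.+ (b ℕ.+ d)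
  l = solveℕ-∀

-- The binomial coefficient (s + t) C t.
multichoose : ℕ → ℕ → ℕ
multichoose zero    t       = 1
multichoose (suc s) zero    = 1
multichoose (suc s) (suc t) = multichoose (suc s) t ℕ.+ multichoose s (suc t)

multichoose-! : ∀ s t → multichoose s t ℕ.* (s ! ℕ.* t !) ≡ (s ℕ.+ t) !
multichoose-! zero t          = trans (ℕ.*-identityˡ _) (ℕ.*-identityˡ (t !))
multichoose-! (suc s) zero    = trans (ℕ.*-identityˡ _) (trans (ℕ.*-identityʳ (suc s !)) (cong (λ n → suc n !) (sym (ℕ.+-identityʳ s))))
multichoose-! (suc s) (suc t) = begin
  (a ℕ.+ b) ℕ.* ((suc s ℕ.* s !) ℕ.* (suc t ℕ.* t !))
    ≡⟨ l a b s t (s !) (t !) ⟩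
  suc t ℕ.* (a ℕ.* ((suc s ℕ.* s !) ℕ.* t !)) ℕ.+ suc s ℕ.* (b ℕ.* (s ! ℕ.* (suc t ℕ.* t !)))
    ≡⟨ cong₂ (λ x y → suc t ℕ.* x ℕ.+ suc s ℕ.* y) (multichoose-! (suc s) t) (multichoose-! s (suc t)) ⟩
  suc t ℕ.* (suc s ℕ.+ t) ! ℕ.+ suc s ℕ.* (s ℕ.+ suc t) !
    ≡⟨ cong (λ n → suc t ℕ.* n ! ℕ.+ suc s ℕ.* (s ℕ.+ suc t) !) (ℕ.+-suc s t) ⟨
  suc t ℕ.* (s ℕ.+ suc t) ! ℕ.+ suc s ℕ.* (s ℕ.+ suc t) !
    ≡⟨ l₂ s t ((s ℕ.+ suc t) !) ⟩
  suc (s ℕ.+ suc t) ℕ.* (s ℕ.+ suc t) ! ∎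
  where
  a b : ℕ
  a = multichoose (suc s) t
  b = multichoose s (suc t)
  l : ∀ a b s t x y → (a ℕ.+ b) ℕ.* ((suc s ℕ.* x) ℕ.* (suc t ℕ.* y)) ≡ suc t ℕ.* (a ℕ.* ((suc s ℕ.* x) ℕ.* y)) ℕ.+ suc s ℕ.* (b ℕ.* (x ℕ.* (suc t ℕ.* y)))
  l = solveℕ-∀
  l₂ : ∀ s t z → suc t ℕ.* z ℕ.+ suc s ℕ.* z ≡ suc (s ℕ.+ suc t) ℕ.* z
  l₂ = solveℕ-∀

multichoose-zeroʳ : ∀ s → multichoose s 0 ≡ 1
multichoose-zeroʳ zero    = refl
multichoose-zeroʳ (suc s) = refl

multichoose-∑ : ∀ s n → ∑< (suc n) (multichoose s) ≡ multichoose (suc s) n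
multichoose-∑ s zero    = multichoose-zeroʳ s
multichoose-∑ s (suc n) = cong (ℕ._+ multichoose s (suc n)) (multichoose-∑ s n)

-- Multisets of size n from s + 1 kinds and another r + 1 kinds, sorted by the number i of elements
-- of the former.
multichoose-conv : ∀ s r n → ∑< (suc n) (λ i → multichoose s i ℕ.* multichoose r (n ∸ i)) ≡ multichoose (suc (s ℕ.+ r)) n
multichoose-conv s zero n = begin
  ∑< (suc n) (λ i → multichoose s i ℕ.* 1)     ≡⟨ ∑<-cong (suc n) (λ {i} _ → ℕ.*-identityʳ (multichoose s i)) ⟩
  ∑< (suc n) (multichoose s)                   ≡⟨ multichoose-∑ s n ⟩
  multichoose (suc s) n                        ≡⟨ cong (λ k → multichoose (suc k) n) (ℕ.+-identityʳ s) ⟨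
  multichoose (suc (s ℕ.+ 0)) n                ∎
multichoose-conv s (suc r) zero = trans (ℕ.*-identityʳ (multichoose s 0)) (multichoose-zeroʳ s)
multichoose-conv s (suc r) (suc n) = begin
  ∑< (suc n) (λ i → multichoose s i ℕ.* multichoose (suc r) (suc n ∸ i)) ℕ.+ multichoose s (suc n) ℕ.* multichoose (suc r) (n ∸ n)
    ≡⟨ cong₂ ℕ._+_ (trans (∑<-cong (suc n) step) (∑<-+ (suc n) _ _)) (cong (multichoose s (suc n) ℕ.*_) (last (n ∸ n) (ℕ.n∸n≡0 n))) ⟩
  ∑< (suc n) (λ i → multichoose s i ℕ.* multichoose (suc r) (n ∸ i)) ℕ.+ ∑< (suc n) (λ i → multichoose s i ℕ.* multichoose r (suc n ∸ i)) ℕ.+ multichoose s (suc n) ℕ.* multichoose r (n ∸ n)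
    ≡⟨ ℕ.+-assoc (∑< (suc n) (λ i → multichoose s i ℕ.* multichoose (suc r) (n ∸ i))) _ _ ⟩
  ∑< (suc n) (λ i → multichoose s i ℕ.* multichoose (suc r) (n ∸ i)) ℕ.+ ∑< (suc (suc n)) (λ i → multichoose s i ℕ.* multichoose r (suc n ∸ i))
    ≡⟨ cong₂ ℕ._+_ (multichoose-conv s (suc r) n) (multichoose-conv s r (suc n)) ⟩
  multichoose (suc (s ℕ.+ suc r)) n ℕ.+ multichoose (suc (s ℕ.+ r)) (suc n)
    ≡⟨ cong (λ k → multichoose (suc k) n ℕ.+ multichoose (suc (s ℕ.+ r)) (suc n)) (ℕ.+-suc s r) ⟩
  multichoose (suc (suc (s ℕ.+ r))) n ℕ.+ multichoose (suc (s ℕ.+ r)) (suc n)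
    ≡⟨ cong (λ k → multichoose (suc k) (suc n)) (ℕ.+-suc s r) ⟨
  multichoose (suc (s ℕ.+ suc r)) (suc n) ∎
  where
  last : ∀ d → d ≡ 0 → multichoose (suc r) d ≡ multichoose r d
  last zero refl = sym (multichoose-zeroʳ r)
  step : ∀ {i} → i ℕ.< suc n → multichoose s i ℕ.* multichoose (suc r) (suc n ∸ i) ≡
    multichoose s i ℕ.* multichoose (suc r) (n ∸ i) ℕ.+ multichoose s i ℕ.* multichoose r (suc n ∸ i)
  step {i} (ℕ.s≤s i≤n) rewrite ℕ.+-∸-assoc 1 i≤n = ℕ.*-distribˡ-+ (multichoose s i) _ _

-- The sum over ν

weight-comp : ∀ {k} (v : Vec Bool k) → weight v ℕ.+ weight (comp v) ≡ weight (replicate k true)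
weight-comp []                  = refl
weight-comp {suc k} (false ∷ v) = trans (l (weight v) k (weight (comp v))) (cong (suc k ℕ.+_) (weight-comp v))
  where
  l : ∀ a k b → a ℕ.+ suc (k ℕ.+ b) ≡ suc k ℕ.+ (a ℕ.+ b)
  l = solveℕ-∀
weight-comp {suc k} (true ∷ v)  = trans (ℕ.+-assoc (suc k) (weight v) (weight (comp v))) (cong (suc k ℕ.+_) (weight-comp v))

-- Every part up to k occurs in exactly one of v and its complement.
P-comp : ∀ {k} x (v : Vec Bool k) → P x v * P x (comp v) ≡ P x (replicate k true)
P-comp x []                  = refl
P-comp {suc k} x (false ∷ v) = trans (l (P x v) (p x (suc k)) (P x (comp v))) (cong (p x (suc k) *_) (P-comp x v))
  where
  l : ∀ a b c → a * (b * c) ≡ b * (a * c)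
  l = solve-∀ ℚ-ring
P-comp {suc k} x (true ∷ v)  = trans (*-assoc (p x (suc k)) (P x v) (P x (comp v))) (cong (p x (suc k) *_) (P-comp x v))

module _ (k : ℕ) where
  private
    a b s : ℕ
    -- The parts n - 1 and n - 3 for n = k + 4; `M` is the size of δₙ₋₄.
    a = suc (suc (suc k))
    b = suc k
    s = a ℕ.+ b
    ones : Vec Bool k
    ones = replicate k true
    M : ℕ
    M = weight ones
    c : ℚ
    c = p a b * (1/! a * 1/! b)
    w : ℕ → ℕ
    w t = multichoose s t ℕ.* multichoose s (M ∸ t)

  -- What the two Schur products share for all ν: the pair (a , b) twice, its coupling with ν and νᶜ
  -- together, and s! twice.
  K : ℚ
  K = c * c * (P a ones * P b ones) * (ι (s !) * ι (s !))

  private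
    -- Schur's product separates a and b from u; exchanging (s + t)! for t! leaves s! and a binomial
    -- coefficient.
    F-ab : ∀ (u : Vec Bool k) → F (true ∷ false ∷ true ∷ u) ≡ c * ι (s !) * (P a u * P b u) * (ι (multichoose s (weight u)) * F u)
    F-ab u = begin
      ι ((a ℕ.+ (b ℕ.+ t)) !) * (H u * P b u * 1/! b * (p a b * P a u) * 1/! a)
        ≡⟨ cong (_* (H u * P b u * 1/! b * (p a b * P a u) * 1/! a)) !-split ⟩
      ι (multichoose s t) * (ι (s !) * ι (t !)) * (H u * P b u * 1/! b * (p a b * P a u) * 1/! a)
        ≡⟨ l (ι (multichoose s t)) (ι (s !)) (ι (t !)) (H u) (P b u) (1/! b) (p a b) (P a u) (1/! a) ⟩
      c * ι (s !) * (P a u * P b u) * (ι (multichoose s t) * (ι (t !) * H u)) ∎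
      where
      t : ℕ
      t = weight u
      !-split : ι ((a ℕ.+ (b ℕ.+ t)) !) ≡ ι (multichoose s t) * (ι (s !) * ι (t !))
      !-split = begin
        ι ((a ℕ.+ (b ℕ.+ t)) !)    ≡⟨ cong (λ n → ι (n !)) (ℕ.+-assoc a b t) ⟨
        ι ((s ℕ.+ t) !)            ≡⟨ cong ι (multichoose-! s t) ⟨
        ι (multichoose s t ℕ.* (s ! ℕ.* t !)) ≡⟨ trans (ι-* (multichoose s t) (s ! ℕ.* t !)) (cong (ι (multichoose s t) *_) (ι-* (s !) (t !))) ⟩
        ι (multichoose s t) * (ι (s !) * ι (t !)) ∎
      l : ∀ m s t h pb fb q pa fa → m * (s * t) * (h * pb * fb * (q * pa) * fa) ≡ q * (fa * fb) * s * (pa * pb) * (m * (t * h))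
      l = solve-∀ ℚ-ring

    F-ab-comp : ∀ (u : Vec Bool k) → F (true ∷ false ∷ true ∷ u) * F (true ∷ false ∷ true ∷ comp u) ≡ K * (ι (w (weight u)) * (F u * F (comp u)))
    F-ab-comp u = begin
      F (true ∷ false ∷ true ∷ u) * F (true ∷ false ∷ true ∷ comp u)
        ≡⟨ cong₂ _*_ (F-ab u) (F-ab (comp u)) ⟩
      c * S * (P a u * P b u) * (m * F u) * (c * S * (P a (comp u) * P b (comp u)) * (m′ * F (comp u)))
        ≡⟨ l c S (P a u) (P b u) m (F u) (P a (comp u)) (P b (comp u)) m′ (F (comp u)) ⟩
      c * c * ((P a u * P a (comp u)) * (P b u * P b (comp u))) * (S * S) * (m * m′ * (F u * F (comp u)))
        ≡⟨ cong₂ (λ x y → c * c * x * (S * S) * (y * (F u * F (comp u)))) (cong₂ _*_ (P-comp a u) (P-comp b u))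
             (trans (sym (ι-* (multichoose s (weight u)) (multichoose s (weight (comp u))))) (cong (λ n → ι (multichoose s (weight u) ℕ.* multichoose s n)) |uᶜ|)) ⟩
      K * (ι (w (weight u)) * (F u * F (comp u))) ∎
      where
      S m m′ : ℚ
      S = ι (s !)
      m = ι (multichoose s (weight u))
      m′ = ι (multichoose s (weight (comp u)))
      |uᶜ| : weight (comp u) ≡ M ∸ weight u
      |uᶜ| = trans (sym (ℕ.m+n∸m≡n (weight u) (weight (comp u)))) (cong (_∸ weight u) (weight-comp u))
      l : ∀ c S pa pb m f pa′ pb′ m′ f′ → c * S * (pa * pb) * (m * f) * (c * S * (pa′ * pb′) * (m′ * f′)) ≡
        c * c * ((pa * pa′) * (pb * pb′)) * (S * S) * (m * m′ * (f * f′))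
      l = solve-∀ ℚ-ring

  ∑-F-ab : ∑ {k} (λ u → F (true ∷ false ∷ true ∷ u) * F (true ∷ false ∷ true ∷ comp u)) ≡ K * (F ones * ι (multichoose (suc (s ℕ.+ s)) M))
  ∑-F-ab = begin
    ∑ {k} (λ u → F (true ∷ false ∷ true ∷ u) * F (true ∷ false ∷ true ∷ comp u))
      ≡⟨ ∑-cong (λ u → trans (F-ab-comp u) (cong (K *_) (trans (*-comm (ι (w (weight u))) (F u * F (comp u))) (cong (F u * F (comp u) *_) (sym (diff (weight u))))))) ⟩
    ∑ {k} (λ u → K * (F u * F (comp u) * (W (suc (weight u)) - W (weight u))))
      ≡⟨ ∑-*ˡ {k} K (λ u → F u * F (comp u) * (W (suc (weight u)) - W (weight u))) ⟩
    K * ∑ {k} (λ u → F u * F (comp u) * (W (suc (weight u)) - W (weight u)))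
      ≡⟨ cong (K *_) (∑-telescope k W) ⟩
    K * (F ones * (W (suc M) - 0ℚ))
      ≡⟨ cong (λ x → K * (F ones * x)) (trans (+-identityʳ (W (suc M))) (cong ι (multichoose-conv s s M))) ⟩
    K * (F ones * ι (multichoose (suc (s ℕ.+ s)) M)) ∎
    where
    -- Partial sums, so that the increments in `∑-telescope` are the weights wanted.
    W : ℕ → ℚ
    W t = ι (∑< t w)
    l : ∀ x y → x + y - x ≡ y
    l = solve-∀ ℚ-ring
    diff : ∀ t → W (suc t) - W t ≡ ι (w t)
    diff t = trans (cong (_- W t) (ι-+ (∑< t w) (w t))) (l (W t) (ι (w t)))

  module Total (N₀ N₁ N₂ : Vec Bool (suc (suc k)) → ℚ)
    (N₀-rec : ∀ v → N₀ v ≡ 𝟙-empty v + sumRem₁ N₀ v)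
    (N₁-rec : ∀ v → N₁ v ≡ sumInc N₀ v + sumRem₁ N₁ v)
    (N₂-rec : ∀ v → N₂ v ≡ sumInc N₁ v + sumRem₁ N₂ v) where

    open Pivot N₀ N₁ N₂ N₀-rec N₁-rec N₂-rec

    total : N₂ (replicate (suc (suc k)) true) ≡ K * (F ones * ι (multichoose (suc (s ℕ.+ s)) M))
    total = begin
      N₂ (replicate (suc (suc k)) true)
        ≡⟨ N₂-full ⟩
      X + ∑ {k} (λ u → 0ℚ * pre (comp (true ∷ u)))
        ≡⟨ cong (X +_) (∑-zero {k} _ (λ u → *-zeroˡ (pre (comp (true ∷ u))))) ⟩
      X + 0ℚ
        ≡⟨ +-identityʳ X ⟩
      X
        ≡⟨ ∑-F-ab ⟩
      K * (F ones * ι (multichoose (suc (s ℕ.+ s)) M)) ∎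
      where
      X : ℚ
      X = ∑ {k} (λ u → F (true ∷ false ∷ true ∷ u) * F (true ∷ false ∷ true ∷ comp u))

-- Lengths of the lists of linear extensions

sumOver : ∀ {A : Set} → (A → ℚ) → List A → ℚ
sumOver h []       = 0ℚ
sumOver h (x ∷ xs) = h x + sumOver h xs

sumOver-++ : ∀ {A : Set} (h : A → ℚ) xs ys → sumOver h (xs ++ ys) ≡ sumOver h xs + sumOver h ys
sumOver-++ h []       ys = sym (+-identityˡ (sumOver h ys))
sumOver-++ h (x ∷ xs) ys = trans (cong (h x +_) (sumOver-++ h xs ys)) (sym (+-assoc (h x) (sumOver h xs) (sumOver h ys)))

sumOver-map : ∀ {A B : Set} (h : B → ℚ) (f : A → B) xs → sumOver h (List.map f xs) ≡ sumOver (h ∘ f) xs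
sumOver-map h f []       = refl
sumOver-map h f (x ∷ xs) = cong (h (f x) +_) (sumOver-map h f xs)

sumOver-incs : ∀ {k} (h : Vec Bool k → ℚ) v → sumOver h (incs v) ≡ sumInc h v
sumOver-incs h []          = +-identityʳ (h [])
sumOver-incs h (false ∷ v) = +-identityʳ (h (true ∷ v))
sumOver-incs h (true ∷ v)  = refl

sumOver-rems : ∀ {k} (h : Vec Bool k → ℚ) v → sumOver (h ∘ proj₂) (rems v) ≡ sumRem₁ h v
sumOver-rems h []          = refl
sumOver-rems h (false ∷ v) = trans (sumOver-map (h ∘ proj₂) _ (rems v)) (sumOver-rems (h ∘ (false ∷_)) v)
sumOver-rems h (true ∷ v)  = begin
  sumOver (h ∘ proj₂) (List.map (λ w → 0 , false ∷ w) (incs v) ++ List.map (λ (r , w) → suc r , true ∷ w) (rems v))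
    ≡⟨ sumOver-++ (h ∘ proj₂) (List.map (λ w → 0 , false ∷ w) (incs v)) _ ⟩
  sumOver (h ∘ proj₂) (List.map (λ w → 0 , false ∷ w) (incs v)) + sumOver (h ∘ proj₂) (List.map (λ (r , w) → suc r , true ∷ w) (rems v))
    ≡⟨ cong₂ _+_ (sumOver-map (h ∘ proj₂) _ (incs v)) (sumOver-map (h ∘ proj₂) _ (rems v)) ⟩
  sumOver (h ∘ (false ∷_)) (incs v) + sumOver (h ∘ (true ∷_) ∘ proj₂) (rems v)
    ≡⟨ cong₂ _+_ (trans (sumOver-incs (h ∘ (false ∷_)) v) (sym (*-identityˡ (sumInc (h ∘ (false ∷_)) v)))) (sumOver-rems (h ∘ (true ∷_)) v) ⟩
  1ℚ * sumInc (h ∘ (false ∷_)) v + sumRem₁ (h ∘ (true ∷_)) v ∎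

length-concat-map : ∀ {A B : Set} (f : A → List B) xs → ι (length (concat (List.map f xs))) ≡ sumOver (ι ∘ length ∘ f) xs
length-concat-map f []       = refl
length-concat-map f (x ∷ xs) = begin
  ι (length (f x ++ concat (List.map f xs)))             ≡⟨ cong ι (length-++ (f x)) ⟩
  ι (length (f x) ℕ.+ length (concat (List.map f xs)))   ≡⟨ ι-+ (length (f x)) _ ⟩
  ι (length (f x)) + ι (length (concat (List.map f xs))) ≡⟨ cong (ι (length (f x)) +_) (length-concat-map f xs) ⟩
  ι (length (f x)) + sumOver (ι ∘ length ∘ f) xs         ∎

count : ∀ {k} → ℕ → ℕ → Vec Bool k → ℚ
count t a v = ι (length (extensions t a v))

count-moves : ∀ {k} t a (v : Vec Bool k) → count (suc t) a v ≡ sumOver (λ (r , a′ , w) → count t a′ w) (tops a v) + sumRem₁ (count t a) v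
count-moves t a v = begin
  count (suc t) a v
    ≡⟨ length-concat-map (extend t) (moves a v) ⟩
  sumOver (ι ∘ length ∘ extend t) (moves a v)
    ≡⟨ sumOver-cong (λ (r , a′ , w) → cong ι (length-map (place (diag a′ w r) r t) (extensions t a′ w))) (moves a v) ⟩
  sumOver h (tops a v ++ List.map (λ (r , w) → suc r , a , w) (rems v))
    ≡⟨ sumOver-++ h (tops a v) _ ⟩
  sumOver h (tops a v) + sumOver h (List.map (λ (r , w) → suc r , a , w) (rems v))
    ≡⟨ cong (sumOver h (tops a v) +_) (trans (sumOver-map h _ (rems v)) (sumOver-rems (count t a) v)) ⟩
  sumOver h (tops a v) + sumRem₁ (count t a) v ∎
  where
  h : Move _ → ℚ
  h (r , a′ , w) = count t a′ w
  sumOver-cong : ∀ {A : Set} {h h′ : A → ℚ} → (∀ x → h x ≡ h′ x) → ∀ xs → sumOver h xs ≡ sumOver h′ xs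
  sumOver-cong eq []       = refl
  sumOver-cong eq (x ∷ xs) = cong₂ _+_ (eq x) (sumOver-cong eq xs)

count-zero : ∀ {k} t (v : Vec Bool k) → count (suc t) 0 v ≡ sumRem₁ (count t 0) v
count-zero t v = trans (count-moves t 0 v) (+-identityˡ (sumRem₁ (count t 0) v))

count-suc : ∀ {k} t a (v : Vec Bool k) → count (suc t) (suc a) v ≡ sumInc (count t a) v + sumRem₁ (count t (suc a)) v
count-suc t a v = trans (count-moves t (suc a) v) (cong (_+ sumRem₁ (count t (suc a)) v)
  (trans (sumOver-map (λ (r , a′ , w) → count t a′ w) _ (incs v)) (sumOver-incs (count t a) v)))

-- `extensions` recurs on its first argument; its length is a number of tableaux when this is the
-- size of the ideal.
N : ∀ {k} → ℕ → Vec Bool k → ℚ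
N a v = count (idealSize a v) a v

N-zero : ∀ {k} (v : Vec Bool k) → N 0 v ≡ 𝟙-empty v + sumRem₁ (N 0) v
N-zero v = go (weight v) refl
  where
  go : ∀ n → weight v ≡ n → count (weight v) 0 v ≡ 𝟙-empty v + sumRem₁ (N 0) v
  go zero    eq = begin
    count (weight v) 0 v         ≡⟨ cong (λ n → count n 0 v) eq ⟩
    1ℚ + 0ℚ                      ≡⟨ cong₂ _+_ (𝟙-empty-zero v eq) (sumRem₁-zero (N 0) v eq) ⟨
    𝟙-empty v + sumRem₁ (N 0) v  ∎
  go (suc n) eq = begin
    count (weight v) 0 v         ≡⟨ cong (λ n → count n 0 v) eq ⟩
    count (suc n) 0 v            ≡⟨ count-zero n v ⟩
    sumRem₁ (count n 0) v        ≡⟨ sumRem₁-cong v (λ w e → cong (λ m → count m 0 w) (ℕ.suc-injective (trans (sym eq) (sym e)))) ⟩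
    sumRem₁ (N 0) v              ≡⟨ +-identityˡ _ ⟨
    0ℚ + sumRem₁ (N 0) v         ≡⟨ cong (_+ sumRem₁ (N 0) v) (𝟙-empty-suc v eq) ⟨
    𝟙-empty v + sumRem₁ (N 0) v  ∎

N-suc : ∀ {k} a (v : Vec Bool k) → N (suc a) v ≡ sumInc (N a) v + sumRem₁ (N (suc a)) v
N-suc {k} a v = begin
  N (suc a) v                                         ≡⟨ count-suc t a v ⟩
  sumInc (count t a) v + sumRem₁ (count t (suc a)) v  ≡⟨ cong₂ _+_
    (sumInc-cong v (λ w eq → cong (λ n → count n a w) (trans (l₁ k (a ℕ.* suc k) (weight v)) (cong (a ℕ.* suc k ℕ.+_) (sym eq)))))
    (sumRem₁-cong v (λ w eq → cong (λ n → count n (suc a) w) (trans (cong (k ℕ.+ a ℕ.* suc k ℕ.+_) (sym eq)) (ℕ.+-suc (k ℕ.+ a ℕ.* suc k) (weight w))))) ⟩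
  sumInc (N a) v + sumRem₁ (N (suc a)) v              ∎
  where
  t : ℕ
  t = k ℕ.+ a ℕ.* suc k ℕ.+ weight v
  l₁ : ∀ k b c → k ℕ.+ b ℕ.+ c ≡ b ℕ.+ (k ℕ.+ c)
  l₁ k b c = trans (cong (ℕ._+ c) (ℕ.+-comm k b)) (ℕ.+-assoc b k c)

-- The fractions, Catalan numbers and staircase numbers of the statement

open import Data.Integer using (+_)

-- `_/_` reduces to lowest terms, hence the passage through unnormalised rationals.
ι≡/1 : ∀ n → ι n ≡ + n / 1
ι≡/1 zero    = refl
ι≡/1 (suc n) = trans (cong (λ x → 1ℚ + x) (ι≡/1 n)) (toℚᵘ-injective (ℚᵘ.≃-trans (toℚᵘ-homo-+ 1ℚ (+ n / 1))
  (ℚᵘ.≃-trans (ℚᵘ.+-congʳ (toℚᵘ 1ℚ) (toℚᵘ-fromℚᵘ (ℚᵘ.mkℚᵘ (+ n) 0))) (ℚᵘ.≃-trans (ℚᵘ.*≡* eq) (ℚᵘ.≃-sym (toℚᵘ-fromℚᵘ (ℚᵘ.mkℚᵘ (+ suc n) 0)))))))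
  where
  eq : ((+ 1 ℤ.* + 1) ℤ.+ (+ n ℤ.* + 1)) ℤ.* + 1 ≡ + suc n ℤ.* + 1
  eq = cong (ℤ._* + 1) (cong (λ z → + 1 ℤ.+ z) (ℤ.*-identityʳ (+ n)))

/-*ι : ∀ p q .{{_ : ℕ.NonZero q}} → (+ p / q) * ι q ≡ ι p
/-*ι p q@(suc d) = trans (cong₂ _*_ {x = + p / q} refl (ι≡/1 q)) (trans (toℚᵘ-injective (ℚᵘ.≃-trans (toℚᵘ-homo-* (+ p / q) (+ q / 1))
  (ℚᵘ.≃-trans (ℚᵘ.*-cong (toℚᵘ-fromℚᵘ (ℚᵘ.mkℚᵘ (+ p) d)) (toℚᵘ-fromℚᵘ (ℚᵘ.mkℚᵘ (+ q) 0)))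
    (ℚᵘ.≃-trans (ℚᵘ.*≡* eq) (ℚᵘ.≃-sym (toℚᵘ-fromℚᵘ (ℚᵘ.mkℚᵘ (+ p) 0)))))))
  (sym (ι≡/1 p)))
  where
  eq : (+ p ℤ.* + q) ℤ.* + 1 ≡ + p ℤ.* + (q ℕ.* 1)
  eq = trans (ℤ.*-identityʳ (+ p ℤ.* + q)) (cong (λ z → + p ℤ.* + z) (sym (ℕ.*-identityʳ q)))

÷-* : ∀ a b .{{_ : NonZero b}} → (a ÷ b) * b ≡ a
÷-* a b = trans (*-assoc a (1/ b) b) (trans (cong (a *_) (*-inverseˡ b)) (*-identityʳ a))

-- The inverse is carried as data, so that long products are shown invertible factor by factor.
record IsUnit (x : ℚ) : Set where
  constructor unit
  field
    inverse   : ℚ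
    *-inverse : x * inverse ≡ 1ℚ

infixl 7 _unit-*_
_unit-*_ : ∀ {x y} → IsUnit x → IsUnit y → IsUnit (x * y)
_unit-*_ {x} {y} (unit x⁻¹ ex) (unit y⁻¹ ey) = unit (x⁻¹ * y⁻¹) (trans (l x y x⁻¹ y⁻¹) (trans (cong₂ _*_ ex ey) (*-identityˡ 1ℚ)))
  where
  l : ∀ x y a b → x * y * (a * b) ≡ (x * a) * (y * b)
  l = solve-∀ ℚ-ring

*-cancel-unit : ∀ {a b x} → IsUnit x → a * x ≡ b * x → a ≡ b
*-cancel-unit {a} {b} {x} (unit y xy≡1) eq = trans (sym (undo a)) (trans (cong (_* y) eq) (undo b))
  where
  undo : ∀ a → a * x * y ≡ a
  undo a = trans (*-assoc a x y) (trans (cong (a *_) xy≡1) (*-identityʳ a))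

ι-unit : ∀ n .{{_ : ℕ.NonZero n}} → IsUnit (ι n)
ι-unit (suc n) = unit (inv (ι (suc n))) (*-inv (ι-suc≢0 n))

!-unit : ∀ n → IsUnit (ι (n !))
!-unit n = ι-unit (n !) {{n ℕ.!≢0}}

ι-!-suc : ∀ n → ι (suc n !) ≡ ι (suc n) * ι (n !)
ι-!-suc n = ι-* (suc n) (n !)

1/!-! : ∀ n → 1/! n * ι (n !) ≡ 1ℚ
1/!-! zero    = refl
1/!-! (suc n) = begin
  inv (ι (suc n)) * 1/! n * ι (suc n !)             ≡⟨ cong (inv (ι (suc n)) * 1/! n *_) (ι-!-suc n) ⟩
  inv (ι (suc n)) * 1/! n * (ι (suc n) * ι (n !))   ≡⟨ l (inv (ι (suc n))) (1/! n) (ι (suc n)) (ι (n !)) ⟩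
  (ι (suc n) * inv (ι (suc n))) * (1/! n * ι (n !)) ≡⟨ cong₂ _*_ (*-inv (ι-suc≢0 n)) (1/!-! n) ⟩
  1ℚ * 1ℚ                                           ≡⟨ *-identityˡ 1ℚ ⟩
  1ℚ                                                ∎
  where
  l : ∀ a b c d → a * b * (c * d) ≡ (c * a) * (b * d)
  l = solve-∀ ℚ-ring

-- Catalan numbers

C-! : ∀ m → ((2 ℕ.* m) C m) ℕ.* (m ! ℕ.* m !) ≡ (2 ℕ.* m) !
C-! m = begin
  ((2 ℕ.* m) C m) ℕ.* (m ! ℕ.* m !)                     ≡⟨ cong (λ z → ((2 ℕ.* m) C m) ℕ.* (m ! ℕ.* z !)) [2m]∸m ⟨
  ((2 ℕ.* m) C m) ℕ.* (m ! ℕ.* (2 ℕ.* m ∸ m) !)         ≡⟨ cong (ℕ._* (m ! ℕ.* (2 ℕ.* m ∸ m) !)) (nCk≡n!/k![n-k]! m≤2m) ⟩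
  _                                                     ≡⟨ m/n*n≡m (subst (_∣ (2 ℕ.* m) !) (ℕ.*-comm ((2 ℕ.* m ∸ m) !) (m !)) ([n∸k]!k!∣n! m≤2m)) ⟩
  (2 ℕ.* m) !                                           ∎
  where
  instance _ = m ℕ.!* (2 ℕ.* m ∸ m) !≢0
  m≤2m : m ≤ 2 ℕ.* m
  m≤2m = ℕ.m≤m+n m (m ℕ.+ 0)
  [2m]∸m : 2 ℕ.* m ∸ m ≡ m
  [2m]∸m = trans (ℕ.m+n∸m≡n m (m ℕ.+ 0)) (ℕ.+-identityʳ m)

catalan-! : ∀ m → catalan m * (ι (m !) * ι (suc m !)) ≡ ι ((2 ℕ.* m) !)
catalan-! m = begin
  (+ 1 / suc m) * (+ c / 1) * (ι (m !) * ι (suc m !))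
    ≡⟨ cong₂ (λ x y → (+ 1 / suc m) * x * (ι (m !) * y)) (sym (ι≡/1 c)) (ι-!-suc m) ⟩
  (+ 1 / suc m) * ι c * (ι (m !) * (ι (suc m) * ι (m !)))
    ≡⟨ l (+ 1 / suc m) (ι c) (ι (m !)) (ι (suc m)) ⟩
  ((+ 1 / suc m) * ι (suc m)) * (ι c * (ι (m !) * ι (m !)))
    ≡⟨ cong₂ _*_ (/-*ι 1 (suc m)) (trans (cong (ι c *_) (sym (ι-* (m !) (m !)))) (sym (ι-* c (m ! ℕ.* m !)))) ⟩
  1ℚ * ι (c ℕ.* (m ! ℕ.* m !))
    ≡⟨ *-identityˡ _ ⟩
  ι (c ℕ.* (m ! ℕ.* m !))
    ≡⟨ cong ι (C-! m) ⟩
  ι ((2 ℕ.* m) !) ∎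
  where
  c : ℕ
  c = (2 ℕ.* m) C m
  l : ∀ a c f s → a * c * (f * (s * f)) ≡ (a * s) * (c * (f * f))
  l = solve-∀ ℚ-ring

-- The product formula for full staircases

product-applyUpTo : ∀ f n → product (applyUpTo f (suc n)) ≡ product (applyUpTo f n) ℕ.* f n
product-applyUpTo f n = begin
  product (applyUpTo f (suc n))             ≡⟨ cong product (applyUpTo-∷ʳ f n) ⟨
  product (applyUpTo f n ∷ʳ f n)            ≡⟨ product-++ (applyUpTo f n) (f n ∷ []) ⟩
  product (applyUpTo f n) ℕ.* (f n ℕ.* 1)   ≡⟨ cong (product (applyUpTo f n) ℕ.*_) (ℕ.*-identityʳ (f n)) ⟩
  product (applyUpTo f n) ℕ.* f n           ∎

rowProduct : ℕ → ℕ
rowProduct j = product (applyUpTo (λ i → i ℕ.+ j) j)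

-- The factors with larger index j + 1 are j + 1, ..., 2 j + 1.
rowProduct-! : ∀ j → rowProduct (suc j) ℕ.* j ! ≡ (suc j ℕ.+ j) !
rowProduct-! j = go (suc j)
  where
  l : ∀ a b c → a ℕ.* b ℕ.* c ≡ b ℕ.* (a ℕ.* c)
  l = solveℕ-∀
  go : ∀ t → product (applyUpTo (λ i → i ℕ.+ suc j) t) ℕ.* j ! ≡ (t ℕ.+ j) !
  go zero    = ℕ.*-identityˡ (j !)
  go (suc t) = begin
    product (applyUpTo (λ i → i ℕ.+ suc j) (suc t)) ℕ.* j !                  ≡⟨ cong (ℕ._* j !) (product-applyUpTo (λ i → i ℕ.+ suc j) t) ⟩
    product (applyUpTo (λ i → i ℕ.+ suc j) t) ℕ.* (t ℕ.+ suc j) ℕ.* j !      ≡⟨ l (product (applyUpTo (λ i → i ℕ.+ suc j) t)) (t ℕ.+ suc j) (j !) ⟩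
    (t ℕ.+ suc j) ℕ.* (product (applyUpTo (λ i → i ℕ.+ suc j) t) ℕ.* j !)    ≡⟨ cong₂ ℕ._*_ (ℕ.+-suc t j) (go t) ⟩
    suc (t ℕ.+ j) ℕ.* (t ℕ.+ j) !                                            ∎

D : ℕ → ℚ
D n = ι (∏[i+j] n)

D-suc : ∀ n → D (suc n) * ι (n !) ≡ D n * ι ((suc n ℕ.+ n) !)
D-suc n = begin
  D (suc n) * ι (n !)                                      ≡⟨ cong (λ z → ι z * ι (n !)) (product-applyUpTo rowProduct (suc n)) ⟩
  ι (∏[i+j] n ℕ.* rowProduct (suc n)) * ι (n !)            ≡⟨ cong (_* ι (n !)) (ι-* (∏[i+j] n) (rowProduct (suc n))) ⟩
  D n * ι (rowProduct (suc n)) * ι (n !)                   ≡⟨ *-assoc (D n) (ι (rowProduct (suc n))) (ι (n !)) ⟩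
  D n * (ι (rowProduct (suc n)) * ι (n !))                 ≡⟨ cong (D n *_) (trans (sym (ι-* (rowProduct (suc n)) (n !))) (cong ι (rowProduct-! n))) ⟩
  D n * ι ((suc n ℕ.+ n) !)                                ∎

-- ∏ (x - i) / (x + i) over i = 1, ..., n: the numerators give (x - 1)! / d!, the denominators (x +
-- n)! / x!.
P-ones : ∀ n d x → x ≡ suc (n ℕ.+ d) → P x (replicate n true) * (ι ((x ℕ.+ n) !) * ι (d !)) ≡ ι ((n ℕ.+ d) !) * ι (x !)
P-ones zero    d .(suc d) refl = begin
  1ℚ * (ι ((suc d ℕ.+ 0) !) * ι (d !))  ≡⟨ *-identityˡ _ ⟩
  ι ((suc d ℕ.+ 0) !) * ι (d !)         ≡⟨ cong (λ z → ι (z !) * ι (d !)) (ℕ.+-identityʳ (suc d)) ⟩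
  ι (suc d !) * ι (d !)                 ≡⟨ *-comm (ι (suc d !)) (ι (d !)) ⟩
  ι (d !) * ι (suc d !)                 ∎
P-ones (suc n) d x x≡ = begin
  (ι x - ι (suc n)) * i * p′ * (ι ((x ℕ.+ suc n) !) * ι (d !))
    ≡⟨ cong₂ (λ y z → y * i * p′ * (z * ι (d !))) x-n (trans (cong (λ z → ι (z !)) (ℕ.+-suc x n)) (trans (ι-!-suc (x ℕ.+ n)) (cong (_* ι ((x ℕ.+ n) !)) x+n))) ⟩
  ι (suc d) * i * p′ * ((ι x + ι (suc n)) * ι ((x ℕ.+ n) !) * ι (d !))
    ≡⟨ l (ι (suc d)) i p′ (ι x + ι (suc n)) (ι ((x ℕ.+ n) !)) (ι (d !)) ⟩
  ((ι x + ι (suc n)) * i) * (p′ * (ι ((x ℕ.+ n) !) * (ι (suc d) * ι (d !))))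
    ≡⟨ cong₂ (λ y z → y * (p′ * (ι ((x ℕ.+ n) !) * z))) (*-inv (λ eq → ι-suc≢0 (x ℕ.+ n) (trans x+n eq))) (sym (ι-!-suc d)) ⟩
  1ℚ * (p′ * (ι ((x ℕ.+ n) !) * ι (suc d !)))
    ≡⟨ *-identityˡ _ ⟩
  p′ * (ι ((x ℕ.+ n) !) * ι (suc d !))
    ≡⟨ P-ones n (suc d) x (trans x≡ (cong suc (sym (ℕ.+-suc n d)))) ⟩
  ι ((n ℕ.+ suc d) !) * ι (x !)
    ≡⟨ cong (λ z → ι (z !) * ι (x !)) (ℕ.+-suc n d) ⟩
  ι ((suc n ℕ.+ d) !) * ι (x !) ∎
  where
  p′ i : ℚ
  p′ = P x (replicate n true)
  i = inv (ι x + ι (suc n))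
  x+n : ι (suc (x ℕ.+ n)) ≡ ι x + ι (suc n)
  x+n = trans (cong ι (sym (ℕ.+-suc x n))) (ι-+ x (suc n))
  l₀ : ∀ a b → a + b - a ≡ b
  l₀ = solve-∀ ℚ-ring
  x-n : ι x - ι (suc n) ≡ ι (suc d)
  x-n = trans (cong (λ z → ι z - ι (suc n)) (trans x≡ (cong suc (sym (ℕ.+-suc n d))))) (trans (cong (_- ι (suc n)) (ι-+ (suc n) (suc d))) (l₀ (ι (suc n)) (ι (suc d))))
  l : ∀ s i p a f d → s * i * p * (a * f * d) ≡ (a * i) * (p * (f * (s * d)))
  l = solve-∀ ℚ-ring

-- By `P-ones` with d = 0, a new largest part contributes n! / (2 n + 1)!, the reciprocal of the new
-- factor of `D`.
H-ones : ∀ n → H (replicate n true) * D n ≡ 1ℚ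
H-ones zero    = refl
H-ones (suc n) = *-cancel-unit (!-unit n unit-* !-unit (suc n)) (begin
  h * q * f * D (suc n) * (ι (n !) * ι (suc n !))
    ≡⟨ l₁ h q f (D (suc n)) (ι (n !)) (ι (suc n !)) ⟩
  h * q * (f * ι (suc n !)) * (D (suc n) * ι (n !))
    ≡⟨ cong₂ (λ x y → h * q * x * y) (1/!-! (suc n)) (D-suc n) ⟩
  h * q * 1ℚ * (D n * ι ((suc n ℕ.+ n) !))
    ≡⟨ l₂ h q (D n) (ι ((suc n ℕ.+ n) !)) ⟩
  (h * D n) * (q * (ι ((suc n ℕ.+ n) !) * ι 1))
    ≡⟨ cong₂ _*_ (H-ones n) (P-ones n 0 (suc n) (cong suc (sym (ℕ.+-identityʳ n)))) ⟩
  1ℚ * (ι ((n ℕ.+ 0) !) * ι (suc n !))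
    ≡⟨ cong (λ z → 1ℚ * (ι (z !) * ι (suc n !))) (ℕ.+-identityʳ n) ⟩
  1ℚ * (ι (n !) * ι (suc n !)) ∎)
  where
  h q f : ℚ
  h = H (replicate n true)
  q = P (suc n) (replicate n true)
  f = 1/! (suc n)
  l₁ : ∀ h q f d a b → h * q * f * d * (a * b) ≡ h * q * (f * b) * (d * a)
  l₁ = solve-∀ ℚ-ring
  l₂ : ∀ h q d r → h * q * 1ℚ * (d * r) ≡ (h * d) * (q * (r * (1ℚ + 0ℚ)))
  l₂ = solve-∀ ℚ-ring

weight-ones : ∀ n → suc n C 2 ≡ weight (replicate n true)
weight-ones zero    = refl
weight-ones (suc n) = trans (sym (nCk+nC[k+1]≡[n+1]C[k+1] (suc n) 1)) (cong₂ ℕ._+_ (nC1≡n (suc n)) (weight-ones n))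

2*weight-ones : ∀ n → 2 ℕ.* weight (replicate n true) ≡ n ℕ.* suc n
2*weight-ones zero    = refl
2*weight-ones (suc n) = trans (l₁ n (weight (replicate n true))) (trans (cong (2 ℕ.* suc n ℕ.+_) (2*weight-ones n)) (l₂ n))
  where
  l₁ : ∀ n w → 2 ℕ.* (suc n ℕ.+ w) ≡ 2 ℕ.* suc n ℕ.+ 2 ℕ.* w
  l₁ = solveℕ-∀
  l₂ : ∀ n → 2 ℕ.* suc n ℕ.+ n ℕ.* suc n ≡ suc n ℕ.* suc (suc n)
  l₂ = solveℕ-∀

-- Comparison of the two closed forms

*-cross-cancel : ∀ {L R α β γ δ r} → IsUnit α → IsUnit γ → IsUnit r → L * α ≡ β → R * γ ≡ δ → β * (γ * r) ≡ δ * α * r → L ≡ R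
*-cross-cancel {L} {R} {α} {β} {γ} {δ} {r} uα uγ ur Lα Rγ eq = *-cancel-unit (uα unit-* uγ unit-* ur) (begin
  L * (α * γ * r)     ≡⟨ l₁ L α γ r ⟩
  (L * α) * (γ * r)   ≡⟨ cong (_* (γ * r)) Lα ⟩
  β * (γ * r)         ≡⟨ eq ⟩
  δ * α * r           ≡⟨ cong (λ z → z * α * r) Rγ ⟨
  R * γ * α * r       ≡⟨ l₂ R α γ r ⟩
  R * (α * γ * r)     ∎)
  where
  l₁ : ∀ L α γ r → L * (α * γ * r) ≡ (L * α) * (γ * r)
  l₁ = solve-∀ ℚ-ring
  l₂ : ∀ R α γ r → R * γ * α * r ≡ R * (α * γ * r)
  l₂ = solve-∀ ℚ-ring

two : ℚ
two = 1ℚ + 1ℚ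

-- Both sides of the theorem are brought to the form ratio of products of factorials,
-- L = numL / denL and R = numR / denR.
module Arithmetic (k : ℕ) where

  n a b s M s′ B : ℕ
  n = suc (suc (suc (suc k)))
  a = suc (suc (suc k))
  b = suc k
  s = a ℕ.+ b
  M = weight (replicate k true)
  -- This is 2 s + 1, so that B = n (n + 1) / 2 - 1 is the number of boxes.
  s′ = 9 ℕ.+ (k ℕ.+ k ℕ.+ (k ℕ.+ k))
  B = s′ ℕ.+ M

  f q : ℕ → ℚ
  f i = ι ((i ℕ.+ k) !)
  q i = ι ((i ℕ.+ (k ℕ.+ k)) !)

  h D₀ mc w z Pa Pb fa fb pab sab Mf : ℚ
  h = H (replicate k true)
  D₀ = D k
  mc = ι (multichoose (suc (s ℕ.+ s)) M)
  w = ι (s′ !)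
  z = ι (B !)
  Pa = P a (replicate k true)
  Pb = P b (replicate k true)
  fa = 1/! a
  fb = 1/! b
  pab = p a b
  sab = ι a + ι b
  Mf = ι (M !)

  denL numL : ℚ
  denL = sab * sab * (f 3 * f 1 * (f 3 * f 1)) * (q 3 * two) * q 1 * w * D₀
  numL = two * two * (f 2 * f 3) * (f 0 * f 1) * (q 4 * q 4) * z

  s≡ : s ≡ 4 ℕ.+ (k ℕ.+ k)
  s≡ = l k
    where
    l : ∀ k → suc (suc (suc k)) ℕ.+ suc k ≡ 4 ℕ.+ (k ℕ.+ k)
    l = solveℕ-∀

  s′≡ : suc (s ℕ.+ s) ≡ s′
  s′≡ = l k
    where
    l : ∀ k → suc (suc (suc (suc k)) ℕ.+ suc k ℕ.+ (suc (suc (suc k)) ℕ.+ suc k)) ≡ 9 ℕ.+ (k ℕ.+ k ℕ.+ (k ℕ.+ k))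
    l = solveℕ-∀

  mc-! : mc * (w * Mf) ≡ z
  mc-! = begin
    mc * (w * Mf)                                 ≡⟨ cong (λ t → ι (multichoose t M) * (w * Mf)) s′≡ ⟩
    ι (multichoose s′ M) * (ι (s′ !) * ι (M !))   ≡⟨ cong (ι (multichoose s′ M) *_) (ι-* (s′ !) (M !)) ⟨
    ι (multichoose s′ M) * ι (s′ ! ℕ.* M !)       ≡⟨ ι-* (multichoose s′ M) (s′ ! ℕ.* M !) ⟨
    ι (multichoose s′ M ℕ.* (s′ ! ℕ.* M !))       ≡⟨ cong ι (multichoose-! s′ M) ⟩
    z ∎

  pab-sab : pab * sab ≡ two
  pab-sab = begin
    (ι a - ι b) * inv sab * sab      ≡⟨ l₁ (ι k) (inv sab) sab ⟩
    two * (sab * inv sab)            ≡⟨ cong (two *_) (*-inv (λ eq → ι-suc≢0 (suc (suc k) ℕ.+ b) (trans (ι-+ a b) eq))) ⟩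
    two * 1ℚ                         ≡⟨ *-identityʳ two ⟩
    two                              ∎
    where
    l₁ : ∀ x i t → (1ℚ + (1ℚ + (1ℚ + x)) - (1ℚ + x)) * i * t ≡ (1ℚ + 1ℚ) * (t * i)
    l₁ = solve-∀ ℚ-ring

  -- `P-ones` with d = a - k - 1 = 2, so `two` stands for 2!; for `Pb` it is 0!.
  Pa-! : Pa * (q 3 * two) ≡ f 2 * f 3
  Pa-! = trans (P-ones k 2 a (cong suc (ℕ.+-comm 2 k))) (cong (λ t → ι (t !) * f 3) (ℕ.+-comm k 2))

  Pb-! : Pb * (q 1 * 1ℚ) ≡ f 0 * f 1
  Pb-! = trans (P-ones k 0 b (cong suc (sym (ℕ.+-identityʳ k)))) (cong (λ t → ι (t !) * f 1) (ℕ.+-identityʳ k))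

  L : ℚ
  L = K k * (F (replicate k true) * mc)

  L-denL : L * denL ≡ numL
  L-denL = begin
    pab * (fa * fb) * (pab * (fa * fb)) * (Pa * Pb) * (ι (s !) * ι (s !)) * (Mf * h * mc) * denL
      ≡⟨ cong (λ t → pab * (fa * fb) * (pab * (fa * fb)) * (Pa * Pb) * (ι (t !) * ι (t !)) * (Mf * h * mc) * denL) s≡ ⟩
    pab * (fa * fb) * (pab * (fa * fb)) * (Pa * Pb) * (q 4 * q 4) * (Mf * h * mc) * denL
      ≡⟨ l₁ pab fa fb Pa Pb (q 4) Mf h mc sab (f 3) (f 1) (q 3) (q 1) w D₀ ⟩
    (pab * sab) * (pab * sab) * ((fa * f 3) * (fa * f 3)) * ((fb * f 1) * (fb * f 1)) * (Pa * (q 3 * two)) * (Pb * (q 1 * 1ℚ)) * (q 4 * q 4) * (h * D₀) * (mc * (w * Mf))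
      ≡⟨ cong₂ (λ u v → u * u * (v * v) * ((fb * f 1) * (fb * f 1)) * (Pa * (q 3 * two)) * (Pb * (q 1 * 1ℚ)) * (q 4 * q 4) * (h * D₀) * (mc * (w * Mf))) pab-sab (1/!-! a) ⟩
    two * two * (1ℚ * 1ℚ) * ((fb * f 1) * (fb * f 1)) * (Pa * (q 3 * two)) * (Pb * (q 1 * 1ℚ)) * (q 4 * q 4) * (h * D₀) * (mc * (w * Mf))
      ≡⟨ cong₂ (λ u v → two * two * (1ℚ * 1ℚ) * (u * u) * v * (Pb * (q 1 * 1ℚ)) * (q 4 * q 4) * (h * D₀) * (mc * (w * Mf))) (1/!-! b) Pa-! ⟩
    two * two * (1ℚ * 1ℚ) * (1ℚ * 1ℚ) * (f 2 * f 3) * (Pb * (q 1 * 1ℚ)) * (q 4 * q 4) * (h * D₀) * (mc * (w * Mf))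
      ≡⟨ cong₂ (λ u v → two * two * (1ℚ * 1ℚ) * (1ℚ * 1ℚ) * (f 2 * f 3) * u * (q 4 * q 4) * v * (mc * (w * Mf))) Pb-! (H-ones k) ⟩
    two * two * (1ℚ * 1ℚ) * (1ℚ * 1ℚ) * (f 2 * f 3) * (f 0 * f 1) * (q 4 * q 4) * 1ℚ * (mc * (w * Mf))
      ≡⟨ cong (λ u → two * two * (1ℚ * 1ℚ) * (1ℚ * 1ℚ) * (f 2 * f 3) * (f 0 * f 1) * (q 4 * q 4) * 1ℚ * u) mc-! ⟩
    two * two * (1ℚ * 1ℚ) * (1ℚ * 1ℚ) * (f 2 * f 3) * (f 0 * f 1) * (q 4 * q 4) * 1ℚ * z
      ≡⟨ l₂ (f 2) (f 3) (f 0) (f 1) (q 4) z ⟩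
    numL ∎
    where
    l₁ : ∀ p fa fb Pa Pb q4 Mf h mc s f3 f1 q3 q1 w D →
      p * (fa * fb) * (p * (fa * fb)) * (Pa * Pb) * (q4 * q4) * (Mf * h * mc) * (s * s * (f3 * f1 * (f3 * f1)) * (q3 * (1ℚ + 1ℚ)) * q1 * w * D) ≡
      (p * s) * (p * s) * ((fa * f3) * (fa * f3)) * ((fb * f1) * (fb * f1)) * (Pa * (q3 * (1ℚ + 1ℚ))) * (Pb * (q1 * 1ℚ)) * (q4 * q4) * (h * D) * (mc * (w * Mf))
    l₁ = solve-∀ ℚ-ring
    l₂ : ∀ f2 f3 f0 f1 q4 z → (1ℚ + 1ℚ) * (1ℚ + 1ℚ) * (1ℚ * 1ℚ) * (1ℚ * 1ℚ) * (f2 * f3) * (f0 * f1) * (q4 * q4) * 1ℚ * z ≡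
      (1ℚ + 1ℚ) * (1ℚ + 1ℚ) * (f2 * f3) * (f0 * f1) * (q4 * q4) * z
    l₂ = solve-∀ ℚ-ring

  w₁₀ Cₙ Cₙ₋₂ C₂ₙ₋₃ Q R denR numR X : ℚ
  w₁₀ = ι ((10 ℕ.+ (k ℕ.+ k ℕ.+ (k ℕ.+ k))) !)
  Cₙ = catalan n
  Cₙ₋₂ = catalan (n ∸ 2)
  C₂ₙ₋₃ = catalan (2 ℕ.* n ∸ 3)
  Q = ((Cₙ * Cₙ₋₂) ÷ ((+ 2 / 1) * C₂ₙ₋₃)) {{2catalan-nonZero (2 ℕ.* n ∸ 3)}}
  R = g n * Q
  denR = D n * (f 4 * f 5) * (f 2 * f 3) * two * w₁₀
  -- The untruncated staircase has one box more: `g n` brings (B + 1)! against B! on the other side.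
  X = ι (suc B)
  numR = X * z * q 8 * q 4 * q 5 * q 6

  c₃ : 2 ℕ.* n ∸ 3 ≡ 5 ℕ.+ (k ℕ.+ k)
  c₃ = l k
    where
    l : ∀ k → suc (k ℕ.+ (suc (suc (suc (suc k))) ℕ.+ 0)) ≡ 5 ℕ.+ (k ℕ.+ k)
    l = solveℕ-∀

  Cₙ-! : Cₙ * (f 4 * f 5) ≡ q 8
  Cₙ-! = trans (catalan-! n) (cong (λ t → ι (t !)) (l k))
    where
    l : ∀ k → 2 ℕ.* suc (suc (suc (suc k))) ≡ 8 ℕ.+ (k ℕ.+ k)
    l = solveℕ-∀

  Cₙ₋₂-! : Cₙ₋₂ * (f 2 * f 3) ≡ q 4
  Cₙ₋₂-! = trans (catalan-! (n ∸ 2)) (cong (λ t → ι (t !)) (l k))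
    where
    l : ∀ k → 2 ℕ.* suc (suc k) ≡ 4 ℕ.+ (k ℕ.+ k)
    l = solveℕ-∀

  C₂ₙ₋₃-! : C₂ₙ₋₃ * (q 5 * q 6) ≡ w₁₀
  C₂ₙ₋₃-! = begin
    catalan (2 ℕ.* n ∸ 3) * (q 5 * q 6)      ≡⟨ cong (λ t → catalan t * (q 5 * q 6)) c₃ ⟩
    catalan (5 ℕ.+ (k ℕ.+ k)) * (q 5 * q 6)  ≡⟨ catalan-! (5 ℕ.+ (k ℕ.+ k)) ⟩
    ι ((2 ℕ.* (5 ℕ.+ (k ℕ.+ k))) !)          ≡⟨ cong (λ t → ι (t !)) (l k) ⟩
    w₁₀                                      ∎
    where
    l : ∀ k → 2 ℕ.* (5 ℕ.+ (k ℕ.+ k)) ≡ 10 ℕ.+ (k ℕ.+ k ℕ.+ (k ℕ.+ k))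
    l = solveℕ-∀

  size≡ : weight (replicate n true) ≡ suc B
  size≡ = l k M
    where
    l : ∀ k M → suc (suc (suc (suc k))) ℕ.+ (suc (suc (suc k)) ℕ.+ (suc (suc k) ℕ.+ (suc k ℕ.+ M))) ≡ suc (9 ℕ.+ (k ℕ.+ k ℕ.+ (k ℕ.+ k)) ℕ.+ M)
    l = solveℕ-∀

  g-D : g n * D n ≡ X * z
  g-D = begin
    g n * D n               ≡⟨ /-*ι ((suc n C 2) !) (∏[i+j] n) {{∏[i+j]-nonZero n}} ⟩
    ι ((suc n C 2) !)       ≡⟨ cong (λ t → ι (t !)) (trans (weight-ones n) size≡) ⟩
    ι (suc B !)             ≡⟨ ι-!-suc B ⟩
    X * z                   ∎

  R-denR : R * denR ≡ numR
  R-denR = begin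
    g n * Q * (D n * (f 4 * f 5) * (f 2 * f 3) * two * w₁₀)
      ≡⟨ cong (λ t → g n * Q * (D n * (f 4 * f 5) * (f 2 * f 3) * two * t)) C₂ₙ₋₃-! ⟨
    g n * Q * (D n * (f 4 * f 5) * (f 2 * f 3) * two * (C₂ₙ₋₃ * (q 5 * q 6)))
      ≡⟨ l₁ (g n) Q (D n) (f 4 * f 5) (f 2 * f 3) two C₂ₙ₋₃ (q 5) (q 6) ⟩
    (g n * D n) * (Q * (two * C₂ₙ₋₃)) * (f 4 * f 5) * (f 2 * f 3) * (q 5 * q 6)
      ≡⟨ cong₂ (λ u v → u * v * (f 4 * f 5) * (f 2 * f 3) * (q 5 * q 6)) g-D (÷-* (Cₙ * Cₙ₋₂) ((+ 2 / 1) * C₂ₙ₋₃) {{2catalan-nonZero (2 ℕ.* n ∸ 3)}}) ⟩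
    (X * z) * (Cₙ * Cₙ₋₂) * (f 4 * f 5) * (f 2 * f 3) * (q 5 * q 6)
      ≡⟨ l₂ X z Cₙ Cₙ₋₂ (f 4 * f 5) (f 2 * f 3) (q 5) (q 6) ⟩
    X * z * (Cₙ * (f 4 * f 5)) * (Cₙ₋₂ * (f 2 * f 3)) * q 5 * q 6
      ≡⟨ cong₂ (λ u v → X * z * u * v * q 5 * q 6) Cₙ-! Cₙ₋₂-! ⟩
    numR ∎
    where
    l₁ : ∀ g Q D x y t c u v → g * Q * (D * x * y * t * (c * (u * v))) ≡ (g * D) * (Q * (t * c)) * x * y * (u * v)
    l₁ = solve-∀ ℚ-ring
    l₂ : ∀ X z c d x y u v → (X * z) * (c * d) * x * y * (u * v) ≡ X * z * (c * x) * (d * y) * u * v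
    l₂ = solve-∀ ℚ-ring

  -- The factor that takes `D n` down to `D k`: each of the four uses of `D-suc` consumes one
  -- factorial.
  r : ℚ
  r = f 0 * f 1 * f 2 * f 3

  D-r : D n * r ≡ D₀ * q 1 * q 3 * q 5 * q 7
  D-r = begin
    D n * (f 0 * f 1 * f 2 * f 3)                ≡⟨ l (D n) (f 0) (f 1) (f 2) (f 3) ⟩
    (D n * f 3) * f 2 * f 1 * f 0                ≡⟨ cong (λ t → t * f 2 * f 1 * f 0) (D-row 3 7 (l₃ k)) ⟩
    (D (3 ℕ.+ k) * q 7) * f 2 * f 1 * f 0        ≡⟨ l′ (D (3 ℕ.+ k)) (q 7) (f 2) (f 1) (f 0) ⟩
    (D (3 ℕ.+ k) * f 2) * f 1 * f 0 * q 7        ≡⟨ cong (λ t → t * f 1 * f 0 * q 7) (D-row 2 5 (l₂ k)) ⟩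
    (D (2 ℕ.+ k) * q 5) * f 1 * f 0 * q 7        ≡⟨ l′ (D (2 ℕ.+ k)) (q 5) (f 1) (f 0) (q 7) ⟩
    (D (2 ℕ.+ k) * f 1) * f 0 * q 7 * q 5        ≡⟨ cong (λ t → t * f 0 * q 7 * q 5) (D-row 1 3 (l₁ k)) ⟩
    (D (1 ℕ.+ k) * q 3) * f 0 * q 7 * q 5        ≡⟨ l′ (D (1 ℕ.+ k)) (q 3) (f 0) (q 7) (q 5) ⟩
    (D (1 ℕ.+ k) * f 0) * q 7 * q 5 * q 3        ≡⟨ cong (λ t → t * q 7 * q 5 * q 3) (D-row 0 1 refl) ⟩
    (D₀ * q 1) * q 7 * q 5 * q 3                 ≡⟨ l″ D₀ (q 1) (q 7) (q 5) (q 3) ⟩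
    D₀ * q 1 * q 3 * q 5 * q 7                   ∎
    where
    D-row : ∀ i j → suc (i ℕ.+ k) ℕ.+ (i ℕ.+ k) ≡ j ℕ.+ (k ℕ.+ k) → D (suc (i ℕ.+ k)) * f i ≡ D (i ℕ.+ k) * q j
    D-row i j eq = trans (D-suc (i ℕ.+ k)) (cong (λ t → D (i ℕ.+ k) * ι (t !)) eq)
    l₁ : ∀ k → suc (1 ℕ.+ k) ℕ.+ (1 ℕ.+ k) ≡ 3 ℕ.+ (k ℕ.+ k)
    l₁ = solveℕ-∀
    l₂ : ∀ k → suc (2 ℕ.+ k) ℕ.+ (2 ℕ.+ k) ≡ 5 ℕ.+ (k ℕ.+ k)
    l₂ = solveℕ-∀
    l₃ : ∀ k → suc (3 ℕ.+ k) ℕ.+ (3 ℕ.+ k) ≡ 7 ℕ.+ (k ℕ.+ k)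
    l₃ = solveℕ-∀
    l : ∀ D a b c d → D * (a * b * c * d) ≡ (D * d) * c * b * a
    l = solve-∀ ℚ-ring
    l′ : ∀ D a b c d → (D * a) * b * c * d ≡ (D * b) * c * d * a
    l′ = solve-∀ ℚ-ring
    l″ : ∀ D a b c d → (D * a) * b * c * d ≡ D * a * d * c * b
    l″ = solve-∀ ℚ-ring

  y : ℕ → ℚ
  y i = ι (i ℕ.+ k)

  t₅ : ℚ
  t₅ = ι (5 ℕ.+ (k ℕ.+ k))

  f-suc : ∀ i → f (suc i) ≡ y (suc i) * f i
  f-suc i = ι-!-suc (i ℕ.+ k)

  q₈ : q 8 ≡ two * y 4 * q 7
  q₈ = trans (ι-!-suc (7 ℕ.+ (k ℕ.+ k))) (cong (_* q 7) (trans (cong (λ t → 1ℚ + (1ℚ + (1ℚ + (1ℚ + (1ℚ + (1ℚ + (1ℚ + (1ℚ + t)))))))) (ι-+ k k)) (l (ι k))))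
    where
    l : ∀ x → 1ℚ + (1ℚ + (1ℚ + (1ℚ + (1ℚ + (1ℚ + (1ℚ + (1ℚ + (x + x)))))))) ≡ (1ℚ + 1ℚ) * (1ℚ + (1ℚ + (1ℚ + (1ℚ + x))))
    l = solve-∀ ℚ-ring

  q₆ : q 6 ≡ two * y 3 * (t₅ * q 4)
  q₆ = trans (ι-!-suc (5 ℕ.+ (k ℕ.+ k))) (cong₂ _*_ (trans (cong (λ t → 1ℚ + (1ℚ + (1ℚ + (1ℚ + (1ℚ + (1ℚ + t)))))) (ι-+ k k)) (l (ι k))) (ι-!-suc (4 ℕ.+ (k ℕ.+ k))))
    where
    l : ∀ x → 1ℚ + (1ℚ + (1ℚ + (1ℚ + (1ℚ + (1ℚ + (x + x)))))) ≡ (1ℚ + 1ℚ) * (1ℚ + (1ℚ + (1ℚ + x)))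
    l = solve-∀ ℚ-ring

  w₁₀≡ : w₁₀ ≡ two * t₅ * w
  w₁₀≡ = trans (ι-!-suc s′) (cong (_* w) (trans (cong ι (l k)) (trans (ι-* 2 (5 ℕ.+ (k ℕ.+ k))) (cong (_* t₅) {x = ι 2} refl))))
    where
    l : ∀ k → 10 ℕ.+ (k ℕ.+ k ℕ.+ (k ℕ.+ k)) ≡ 2 ℕ.* (5 ℕ.+ (k ℕ.+ k))
    l = solveℕ-∀

  sab≡ : sab ≡ two * y 2
  sab≡ = l (ι k)
    where
    l : ∀ x → 1ℚ + (1ℚ + (1ℚ + x)) + (1ℚ + x) ≡ (1ℚ + 1ℚ) * (1ℚ + (1ℚ + x))
    l = solve-∀ ℚ-ring

  2X : two * X ≡ y 4 * y 5
  2X = begin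
    two * X                                        ≡⟨ cong (_* X) {x = ι 2} refl ⟨
    ι 2 * X                                        ≡⟨ ι-* 2 (suc B) ⟨
    ι (2 ℕ.* suc B)                                ≡⟨ cong (λ t → ι (2 ℕ.* t)) size≡ ⟨
    ι (2 ℕ.* weight (replicate n true))            ≡⟨ cong ι (2*weight-ones n) ⟩
    ι (n ℕ.* suc n)                                ≡⟨ ι-* n (suc n) ⟩
    y 4 * y 5                                      ∎

  -- Neighbouring factorials differ by linear factors. Once these are matched, there remains n (n +
  -- 1) against 2 (B + 1), which `2X` identifies.
  cross : numL * (denR * r) ≡ numR * denL * r
  cross = begin
    numL * (denR * r)
      ≡⟨ l₁ numL (D n) (f 4 * f 5) (f 2 * f 3) two w₁₀ r ⟩
    numL * (f 4 * f 5) * (f 2 * f 3) * two * w₁₀ * (D n * r)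
      ≡⟨ cong₂ (λ u v → numL * (f 4 * f 5) * (f 2 * f 3) * two * u * v) w₁₀≡ D-r ⟩
    numL * (f 4 * f 5) * (f 2 * f 3) * two * (two * t₅ * w) * (D₀ * q 1 * q 3 * q 5 * q 7)
      ≡⟨ cong (λ u → numL * u * (f 2 * f 3) * two * (two * t₅ * w) * (D₀ * q 1 * q 3 * q 5 * q 7))
           (cong₂ _*_ (f-suc 3) (trans (f-suc 4) (cong (y 5 *_) (f-suc 3)))) ⟩
    numL * (y 4 * f 3 * (y 5 * (y 4 * f 3))) * (f 2 * f 3) * two * (two * t₅ * w) * (D₀ * q 1 * q 3 * q 5 * q 7)
      ≡⟨ l₂ (f 0) (f 1) (f 2) (f 3) (q 4) z (y 4) (y 5) t₅ w D₀ (q 1) (q 3) (q 5) (q 7) ⟩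
    (y 4 * y 5) * (f 2 * f 2 * rest)
      ≡⟨ cong₂ (λ u v → u * (v * v * rest)) (sym 2X) (f-suc 1) ⟩
    (two * X) * (y 2 * f 1 * (y 2 * f 1) * rest)
      ≡⟨ cong (λ u → (two * X) * (y 2 * f 1 * (y 2 * f 1) * u)) rest≡ ⟩
    (two * X) * (y 2 * f 1 * (y 2 * f 1) * (rest′ * (y 3 * f 2)))
      ≡⟨ l₃ (f 0) (f 1) (f 2) (f 3) (q 4) z (y 4) t₅ w D₀ (q 1) (q 3) (q 5) (q 7) X (y 2) (y 3) ⟩
    X * z * (two * y 4 * q 7) * q 4 * q 5 * (two * y 3 * (t₅ * q 4)) * (two * y 2 * (two * y 2) * (f 3 * f 1 * (f 3 * f 1)) * (q 3 * two) * q 1 * w * D₀) * r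
      ≡⟨ cong₂ (λ u v → X * z * u * q 4 * q 5 * v * (two * y 2 * (two * y 2) * (f 3 * f 1 * (f 3 * f 1)) * (q 3 * two) * q 1 * w * D₀) * r) (sym q₈) (sym q₆) ⟩
    X * z * q 8 * q 4 * q 5 * q 6 * (two * y 2 * (two * y 2) * (f 3 * f 1 * (f 3 * f 1)) * (q 3 * two) * q 1 * w * D₀) * r
      ≡⟨ cong (λ u → X * z * q 8 * q 4 * q 5 * q 6 * (u * u * (f 3 * f 1 * (f 3 * f 1)) * (q 3 * two) * q 1 * w * D₀) * r) sab≡ ⟨
    numR * denL * r ∎
    where
    rest rest′ : ℚ
    rest′ = two * two * two * two * (f 3 * f 3 * f 3) * (f 0 * f 1) * (q 4 * q 4) * z * y 4 * t₅ * w * D₀ * q 1 * q 3 * q 5 * q 7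
    rest = rest′ * f 3
    rest≡ : rest ≡ rest′ * (y 3 * f 2)
    rest≡ = cong (rest′ *_) (f-suc 2)
    l₁ : ∀ numL D u v t w r → numL * (D * u * v * t * w * r) ≡ numL * u * v * t * w * (D * r)
    l₁ = solve-∀ ℚ-ring
    l₂ : ∀ f0 f1 f2 f3 q4 z y4 y5 t w D q1 q3 q5 q7 →
      (1ℚ + 1ℚ) * (1ℚ + 1ℚ) * (f2 * f3) * (f0 * f1) * (q4 * q4) * z * (y4 * f3 * (y5 * (y4 * f3))) * (f2 * f3) * (1ℚ + 1ℚ) * ((1ℚ + 1ℚ) * t * w) * (D * q1 * q3 * q5 * q7) ≡
      (y4 * y5) * (f2 * f2 * ((1ℚ + 1ℚ) * (1ℚ + 1ℚ) * (1ℚ + 1ℚ) * (1ℚ + 1ℚ) * (f3 * f3 * f3) * (f0 * f1) * (q4 * q4) * z * y4 * t * w * D * q1 * q3 * q5 * q7 * f3))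
    l₂ = solve-∀ ℚ-ring
    l₃ : ∀ f0 f1 f2 f3 q4 z y4 t w D q1 q3 q5 q7 X y2 y3 →
      ((1ℚ + 1ℚ) * X) * (y2 * f1 * (y2 * f1) * ((1ℚ + 1ℚ) * (1ℚ + 1ℚ) * (1ℚ + 1ℚ) * (1ℚ + 1ℚ) * (f3 * f3 * f3) * (f0 * f1) * (q4 * q4) * z * y4 * t * w * D * q1 * q3 * q5 * q7 * (y3 * f2))) ≡
      X * z * ((1ℚ + 1ℚ) * y4 * q7) * q4 * q5 * ((1ℚ + 1ℚ) * y3 * (t * q4)) * ((1ℚ + 1ℚ) * y2 * ((1ℚ + 1ℚ) * y2) * (f3 * f1 * (f3 * f1)) * (q3 * (1ℚ + 1ℚ)) * q1 * w * D) * (f0 * f1 * f2 * f3)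
    l₃ = solve-∀ ℚ-ring

  L≡R : L ≡ R
  L≡R = *-cross-cancel u-denL u-denR ur L-denL R-denR cross
    where
    uf : ∀ i → IsUnit (f i)
    uf i = !-unit (i ℕ.+ k)
    uq : ∀ i → IsUnit (q i)
    uq i = !-unit (i ℕ.+ (k ℕ.+ k))
    u2 : IsUnit two
    u2 = ι-unit 2
    uD : ∀ n → IsUnit (D n)
    uD n = ι-unit (∏[i+j] n) {{∏[i+j]-nonZero n}}
    usab : IsUnit sab
    usab = subst IsUnit (ι-+ a b) (ι-unit (a ℕ.+ b))
    u-denL : IsUnit denL
    u-denL = usab unit-* usab unit-* (uf 3 unit-* uf 1 unit-* (uf 3 unit-* uf 1)) unit-* (uq 3 unit-* u2) unit-* uq 1 unit-* !-unit s′ unit-* uD k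
    u-denR : IsUnit denR
    u-denR = uD n unit-* (uf 4 unit-* uf 5) unit-* (uf 2 unit-* uf 3) unit-* u2 unit-* !-unit (10 ℕ.+ (k ℕ.+ k ℕ.+ (k ℕ.+ k)))
    ur : IsUnit r
    ur = uf 0 unit-* uf 1 unit-* uf 2 unit-* uf 3

theorem1 : ∀ (n : ℕ) → 3 ≤ n →
    let instance _ = 2catalan-nonZero (2 *ℕ n ∸ 3) in
    ∃[ N ] HasCardinality (ShiftedSYT-setoid (δ n) (δ 1)) N ×
    + N / 1 ≡ g n * ((catalan n * catalan (n ∸ 2)) ÷ ((+ 2 / 1) * catalan (2 *ℕ n ∸ 3)))
-- For n = 3 the part n − 3 of the shape below the pivot vanishes.
theorem1 (suc (suc (suc zero)))    (s≤s (s≤s (s≤s z≤n))) = _ , Tableaux.tableaux-cardinality 0 , refl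
theorem1 (suc (suc (suc (suc k)))) (s≤s (s≤s (s≤s z≤n))) = length exts , tableaux-cardinality , (begin
  + length exts / 1      ≡⟨ ι≡/1 (length exts) ⟨
  ι (length exts)        ≡⟨ cong (λ t → ι (length (extensions t 2 full))) sz≡ ⟨
  N 2 full               ≡⟨ Total.total k (N 0) (N 1) (N 2) N-zero (N-suc 0) (N-suc 1) ⟩
  Arithmetic.L k         ≡⟨ Arithmetic.L≡R k ⟩
  Arithmetic.R k         ∎)
  where
  open Tableaux (suc k) using (exts; full; sz≡; tableaux-cardinality)
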